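{- For $a,b,c\in\mathbb Z_{\ge2}$, \begin{align*} &(1+(-1)^a)\zeta_3(a,b,c)+(1+(-1)^b)\{\zeta_3(b,a,c)+\zeta_3(b,c,a)\}+(-1)^b(1+(-1)^c)\zeta_3(c,b,a)\\ &=2\bigg\{\sum_{\xi=0}^{[a/2]}\zeta(2\xi)\sum_{\omega=0}^{a-2\xi}\binom{\omega+b-1}{\omega}\binom{a+c-2\xi-\omega-1}{c-1}\zeta_2(b+\omega,a+c-2\xi-\omega)\\ &\quad+\sum_{\xi=0}^{[b/2]}\zeta(2\xi)\sum_{\omega=0}^{a-1}\binom{\omega+b-2\xi}{\omega}\binom{a+c-\omega-2}{c-1}\zeta_2(b-2\xi+\omega+1,a+c-1-\omega)\\ &\quad+(-1)^b\sum_{\xi=0}^{[c/2]}\zeta(2\xi)\sum_{\omega=0}^{c-2\xi}\binom{\omega+b-1}{\omega}\binom{a+c-2\xi-\omega-1}{a-1}\zeta_2(b+\omega,a+c-2\xi-\omega)\\ &\quad+(-1)^b\sum_{\xi=0}^{[b/2]}\zeta(2\xi)\sum_{\omega=0}^{c-1}\binom{\omega+b-2\xi}{\omega}\binom{a+c-\omega-2}{a-1}\zeta_2(b-2\xi+\omega+1,a+c-1-\omega)\bigg\}\\ &\quad-\zeta_2(a+b,c)-(1+(-1)^b)\zeta_2(b,a+c)-(-1)^b\zeta_2(b+c,a). \end{align*}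
   Context: $\zeta_r(s_1,\ldots,s_r)=\sum_{0<n_1<\cdots<n_r}n_1^{ -s_1}\cdots n_r^{ -s_r}$ is the Euler–Zagier multiple zeta value (here $r=2,3$), $\zeta$ is the Riemann zeta-function (so $\zeta(0)=-1/2$), and $[x]$ denotes the integer part of $x$. -}

module Defs where

open import Data.Integer as ℤ using (ℤ; +_)
open import Data.List using (List; []; _∷_)
open import Data.List.Relation.Unary.All using (All; []; _∷_)
open import Data.Nat as ℕ using (ℕ; zero; suc; _⊔_; z≤n; s≤s; ≤′-refl; ≤′-step)
open import Data.Nat.Coprimality as Coprimality using (1-coprimeTo)
import Data.Integer.Properties as ℤₚ
import Data.Nat.Properties as ℕₚ
open import Data.Product using (∃; _×_; _,_; proj₁; proj₂)
open import Data.Rational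
  using (ℚ; mkℚ; 0ℚ; 1ℚ; -½; ½; _/_; _+_; _-_; _*_; -_; 1/_; ∣_∣; _<_; _≤_; *≤*; positive;
         nonNegative; toℚᵘ)
open import Data.Rational.Properties
  using (+-comm; +-identityˡ; +-identityʳ; +-inverseʳ; +-mono-≤; +-mono-<; +-mono-≤-<;
         +-monoʳ-≤; +-monoˡ-≤; *-comm; *-zeroʳ; *-identityʳ; *-inverseˡ; *-monoʳ-≤-nonNeg;
         *-monoˡ-≤-nonNeg; *-monoʳ-<-pos; positive⁻¹; nonNegative⁻¹; pos*pos⇒pos;
         pos⇒nonZero; pos⇒nonNeg; 1/pos⇒pos; normalize-nonNeg; normalize-coprime;
         ∣p+q∣≤∣p∣+∣q∣; ∣p*q∣≡∣p∣*∣q∣; ∣-p∣≡∣p∣; ∣-∣-nonNeg; 0≤p⇒∣p∣≡p; ≤-refl; ≤-trans;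
         ≤-reflexive; <⇒≤; ≤-<-trans; <-≤-trans; toℚᵘ-injective; toℚᵘ-homo-+; toℚᵘ-homo-*;
         toℚᵘ-fromℚᵘ; ≤-total; module ≤-Reasoning)
open import Data.Rational.Solver using (module +-*-Solver)
import Data.Rational.Unnormalised as ℚᵘ
import Data.Rational.Unnormalised.Properties as ℚᵘₚ
open import Data.Sum using (inj₁; inj₂)
open import Relation.Binary.PropositionalEquality
  using (_≡_; refl; sym; trans; cong; subst; subst₂; module ≡-Reasoning)

open +-*-Solver using (solve; _:+_; _:*_; _:-_; :-_; _:=_; con)

Cauchy : (ℕ → ℚ) → Set
Cauchy x = ∀ ε → 0ℚ < ε → ∃ λ N → ∀ m n → N ℕ.≤ m → N ℕ.≤ n → ∣ x m - x n ∣ < ε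

record ℝ : Set where
  constructor mkℝ
  field
    seq    : ℕ → ℚ
    cauchy : Cauchy seq

open ℝ public

infix 4 _≈_

_≈_ : ℝ → ℝ → Set
x ≈ y = ∀ ε → 0ℚ < ε → ∃ λ N → ∀ n → N ℕ.≤ n → ∣ seq x n - seq y n ∣ < ε

½*-pos : ∀ {ε} → 0ℚ < ε → 0ℚ < ½ * ε
½*-pos {ε} 0<ε = positive⁻¹ (½ * ε) {{pos*pos⇒pos ½ ε {{positive 0<ε}}}}

½+½ : ∀ ε → ½ * ε + ½ * ε ≡ ε
½+½ = solve 1 (λ e → con ½ :* e :+ con ½ :* e := e) refl

∣p-q∣≡∣q-p∣ : ∀ p q → ∣ p - q ∣ ≡ ∣ q - p ∣
∣p-q∣≡∣q-p∣ p q =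
  trans (cong ∣_∣ (solve 2 (λ p q → p :- q := :- (q :- p)) refl p q)) (∣-p∣≡∣p∣ (q - p))

fromℕ : ℕ → ℚ
fromℕ n = mkℚ (+ n) 0 (Coprimality.sym (1-coprimeTo n))

fromℕ-mono : ∀ {m n} → m ℕ.≤ n → fromℕ m ≤ fromℕ n
fromℕ-mono {m} {n} m≤n = *≤* (ℤₚ.*-monoʳ-≤-nonNeg (+ 1) (ℤ.+≤+ m≤n))

p≤fromℕ : ∀ p → ∃ λ n → p ≤ fromℕ n
p≤fromℕ (mkℚ (+ n) d c) = n , *≤* (subst₂ ℤ._≤_ (ℤₚ.pos-* n 1) (ℤₚ.pos-* n (suc d))
                                      (ℤ.+≤+ (ℕₚ.*-monoʳ-≤ n (s≤s z≤n))))
p≤fromℕ (mkℚ (ℤ.-[1+ n ]) d c) = 0 , *≤* ℤ.-≤+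

archimedean : ∀ C ε → 0ℚ < ε → ∃ λ N → C ≤ ε * fromℕ N
archimedean C ε 0<ε = n , (begin
  C              ≡⟨ sym (trans (cong (_* C) (trans (*-comm ε 1/ε) (*-inverseˡ ε)))
                               (solve 1 (λ c → con 1ℚ :* c := c) refl C)) ⟩
  ε * 1/ε * C    ≡⟨ solve 3 (λ e f c → e :* f :* c := e :* (c :* f)) refl ε 1/ε C ⟩
  ε * (C * 1/ε)  ≤⟨ *-monoˡ-≤-nonNeg ε (proj₂ (p≤fromℕ (C * 1/ε))) ⟩
  ε * fromℕ n    ∎)
  where
  open ≤-Reasoning
  instance
    _ = positive 0<ε
    _ = pos⇒nonZero ε
    _ = pos⇒nonNeg ε
  1/ε = 1/ ε
  n = proj₁ (p≤fromℕ (C * 1/ε))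

infixl 6 _+ℝ_ _-ℝ_
infixl 7 _*ℝ_
infix  8 -ℝ_

const-cauchy : ∀ q → Cauchy (λ _ → q)
const-cauchy q ε 0<ε = 0 , λ _ _ _ _ → subst (_< ε) (sym (cong ∣_∣ (+-inverseʳ q))) 0<ε

fromℚ : ℚ → ℝ
fromℚ q = mkℝ (λ _ → q) (const-cauchy q)

fromℤ : ℤ → ℝ
fromℤ z = fromℚ (z / 1)

⟦_⟧ : ℕ → ℝ
⟦ n ⟧ = fromℤ (+ n)

+-cauchy : ∀ x y → Cauchy x → Cauchy y → Cauchy (λ n → x n + y n)
+-cauchy x y cx cy ε 0<ε = M ⊔ N , λ m n M⊔N≤m M⊔N≤n → begin-strict
    ∣ (x m + y m) - (x n + y n) ∣
      ≡⟨ cong ∣_∣ (solve 4 (λ a b c d → (a :+ b) :- (c :+ d) := (a :- c) :+ (b :- d)) refl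
                     (x m) (y m) (x n) (y n)) ⟩
    ∣ (x m - x n) + (y m - y n) ∣
      ≤⟨ ∣p+q∣≤∣p∣+∣q∣ (x m - x n) (y m - y n) ⟩
    ∣ x m - x n ∣ + ∣ y m - y n ∣
      <⟨ +-mono-< (proj₂ X m n (ℕₚ.m⊔n≤o⇒m≤o M N M⊔N≤m) (ℕₚ.m⊔n≤o⇒m≤o M N M⊔N≤n))
                  (proj₂ Y m n (ℕₚ.m⊔n≤o⇒n≤o M N M⊔N≤m) (ℕₚ.m⊔n≤o⇒n≤o M N M⊔N≤n)) ⟩
    ½ * ε + ½ * ε
      ≡⟨ ½+½ ε ⟩
    ε ∎
  where
  open ≤-Reasoning
  X = cx (½ * ε) (½*-pos 0<ε)
  Y = cy (½ * ε) (½*-pos 0<ε)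
  M = proj₁ X
  N = proj₁ Y

neg-cauchy : ∀ x → Cauchy x → Cauchy (λ n → - x n)
neg-cauchy x cx ε 0<ε = proj₁ (cx ε 0<ε) , λ m n N≤m N≤n →
  subst (_< ε)
    (trans (sym (∣-p∣≡∣p∣ (x m - x n)))
           (cong ∣_∣ (solve 2 (λ a b → :- (a :- b) := (:- a) :- (:- b)) refl (x m) (x n))))
    (proj₂ (cx ε 0<ε) m n N≤m N≤n)

eventually-bounded : ∀ x → Cauchy x →
                     ∃ λ B → 0ℚ < B × ∃ λ N → ∀ n → N ℕ.≤ n → ∣ x n ∣ ≤ B
eventually-bounded x cx = 1ℚ + ∣ x N ∣ , 0<B , N , λ n N≤n → begin
    ∣ x n ∣                  ≡⟨ cong ∣_∣ (solve 2 (λ a b → a := (a :- b) :+ b) refl (x n) (x N)) ⟩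
    ∣ (x n - x N) + x N ∣    ≤⟨ ∣p+q∣≤∣p∣+∣q∣ (x n - x N) (x N) ⟩
    ∣ x n - x N ∣ + ∣ x N ∣  ≤⟨ +-monoˡ-≤ ∣ x N ∣ (<⇒≤ (proj₂ X n N N≤n ℕₚ.≤-refl)) ⟩
    1ℚ + ∣ x N ∣             ∎
  where
  open ≤-Reasoning
  X = cx 1ℚ (positive⁻¹ 1ℚ)
  N = proj₁ X
  0<B : 0ℚ < 1ℚ + ∣ x N ∣
  0<B = <-≤-trans (positive⁻¹ 1ℚ)
          (subst (_≤ 1ℚ + ∣ x N ∣) (+-identityʳ 1ℚ)
            (+-monoʳ-≤ 1ℚ (nonNegative⁻¹ ∣ x N ∣ {{∣-∣-nonNeg (x N)}})))

-- A Cauchy sequence scaled by a fixed positive bound is still eventually small.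
scaled : ∀ x → Cauchy x → ∀ B → 0ℚ < B → ∀ ε → 0ℚ < ε →
         ∃ λ N → ∀ m n → N ℕ.≤ m → N ℕ.≤ n → B * ∣ x m - x n ∣ < ε
scaled x cx B 0<B ε 0<ε = proj₁ X , λ m n N≤m N≤n →
    subst (B * ∣ x m - x n ∣ <_) eq (*-monoʳ-<-pos B (proj₂ X m n N≤m N≤n))
  where
  instance
    _ = positive 0<B
    _ = positive 0<ε
    _ = pos⇒nonZero B
  1/B = 1/ B
  X = cx (1/B * ε) (positive⁻¹ (1/B * ε) {{pos*pos⇒pos 1/B {{1/pos⇒pos B}} ε}})
  eq : B * (1/B * ε) ≡ ε
  eq = trans (solve 3 (λ b c e → b :* (c :* e) := (c :* b) :* e) refl B 1/B ε)
             (trans (cong (_* ε) (*-inverseˡ B)) (solve 1 (λ e → con 1ℚ :* e := e) refl ε))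

*-difference : ∀ a b c d A B → ∣ a ∣ ≤ A → ∣ d ∣ ≤ B →
               ∣ a * b - c * d ∣ ≤ A * ∣ b - d ∣ + B * ∣ a - c ∣
*-difference a b c d A B a≤A d≤B = begin
    ∣ a * b - c * d ∣                  ≡⟨ cong ∣_∣ (split a b c d) ⟩
    ∣ (b - d) * a + (a - c) * d ∣      ≤⟨ ∣p+q∣≤∣p∣+∣q∣ ((b - d) * a) ((a - c) * d) ⟩
    ∣ (b - d) * a ∣ + ∣ (a - c) * d ∣  ≤⟨ +-mono-≤ (bound (b - d) a A a≤A) (bound (a - c) d B d≤B) ⟩
    A * ∣ b - d ∣ + B * ∣ a - c ∣      ∎
  where
  open ≤-Reasoning
  split : ∀ a b c d → a * b - c * d ≡ (b - d) * a + (a - c) * d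
  split = solve 4 (λ a b c d → a :* b :- c :* d := (b :- d) :* a :+ (a :- c) :* d) refl
  bound : ∀ p q C → ∣ q ∣ ≤ C → ∣ p * q ∣ ≤ C * ∣ p ∣
  bound p q C q≤C = begin
    ∣ p * q ∣      ≡⟨ ∣p*q∣≡∣p∣*∣q∣ p q ⟩
    ∣ p ∣ * ∣ q ∣  ≤⟨ *-monoˡ-≤-nonNeg ∣ p ∣ {{∣-∣-nonNeg p}} q≤C ⟩
    ∣ p ∣ * C      ≡⟨ *-comm ∣ p ∣ C ⟩
    C * ∣ p ∣      ∎

*-cauchy : ∀ x y → Cauchy x → Cauchy y → Cauchy (λ n → x n * y n)
*-cauchy x y cx cy ε 0<ε = (K ⊔ L) ⊔ (M ⊔ N) , λ m n ≤m ≤n →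
    subst (∣ x m * y m - x n * y n ∣ <_) (½+½ ε)
      (≤-<-trans
        (*-difference (x m) (y m) (x n) (y n) A B
          (x≤A m (ℕₚ.m⊔n≤o⇒m≤o K L (ℕₚ.m⊔n≤o⇒m≤o (K ⊔ L) (M ⊔ N) ≤m)))
          (y≤B n (ℕₚ.m⊔n≤o⇒n≤o K L (ℕₚ.m⊔n≤o⇒m≤o (K ⊔ L) (M ⊔ N) ≤n))))
        (+-mono-<
          (proj₂ Y m n (ℕₚ.m⊔n≤o⇒n≤o M N (ℕₚ.m⊔n≤o⇒n≤o (K ⊔ L) (M ⊔ N) ≤m))
                       (ℕₚ.m⊔n≤o⇒n≤o M N (ℕₚ.m⊔n≤o⇒n≤o (K ⊔ L) (M ⊔ N) ≤n)))
          (proj₂ X m n (ℕₚ.m⊔n≤o⇒m≤o M N (ℕₚ.m⊔n≤o⇒n≤o (K ⊔ L) (M ⊔ N) ≤m))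
                       (ℕₚ.m⊔n≤o⇒m≤o M N (ℕₚ.m⊔n≤o⇒n≤o (K ⊔ L) (M ⊔ N) ≤n)))))
  where
  bx = eventually-bounded x cx
  by = eventually-bounded y cy
  A = proj₁ bx
  B = proj₁ by
  K = proj₁ (proj₂ (proj₂ bx))
  L = proj₁ (proj₂ (proj₂ by))
  x≤A = proj₂ (proj₂ (proj₂ bx))
  y≤B = proj₂ (proj₂ (proj₂ by))
  X = scaled x cx B (proj₁ (proj₂ by)) (½ * ε) (½*-pos 0<ε)
  Y = scaled y cy A (proj₁ (proj₂ bx)) (½ * ε) (½*-pos 0<ε)
  M = proj₁ X
  N = proj₁ Y

_+ℝ_ : ℝ → ℝ → ℝ
x +ℝ y = mkℝ (λ n → seq x n + seq y n) (+-cauchy (seq x) (seq y) (cauchy x) (cauchy y))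

-ℝ_ : ℝ → ℝ
-ℝ x = mkℝ (λ n → - seq x n) (neg-cauchy (seq x) (cauchy x))

_-ℝ_ : ℝ → ℝ → ℝ
x -ℝ y = x +ℝ (-ℝ y)

_*ℝ_ : ℝ → ℝ → ℝ
x *ℝ y = mkℝ (λ n → seq x n * seq y n) (*-cauchy (seq x) (seq y) (cauchy x) (cauchy y))

∑≤ : ℕ → (ℕ → ℝ) → ℝ
∑≤ zero    f = f zero
∑≤ (suc n) f = ∑≤ n f +ℝ f (suc n)

infixr 6.5 ∑≤
syntax ∑≤ n (λ i → e) = ∑[ i ≤ n ] e

[-1]^_ : ℕ → ℝ
[-1]^ n = fromℤ (ℤ.-1ℤ ℤ.^ n)

-- (k + 1)⁻ˢ
recip : ℕ → ℕ → ℚ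
recip k s = (+ 1 / (suc k ℕ.^ s)) {{ℕₚ.m^n≢0 (suc k) s}}

-- The exponents are listed from the outermost (largest) summation variable inwards:
-- nested (sᵣ ∷ … ∷ s₁ ∷ []) N = ∑_{0 < n₁ < ⋯ < nᵣ ≤ N} n₁^{-s₁} ⋯ nᵣ^{-sᵣ}.
nested : List ℕ → ℕ → ℚ
nested []       N       = 1ℚ
nested (s ∷ ss) zero    = 0ℚ
nested (s ∷ ss) (suc k) = nested (s ∷ ss) k + recip k s * nested ss k

*-nonneg : ∀ {p q} → 0ℚ ≤ p → 0ℚ ≤ q → 0ℚ ≤ p * q
*-nonneg {p} {q} 0≤p 0≤q =
  subst (_≤ p * q) (*-zeroʳ p) (*-monoˡ-≤-nonNeg p {{nonNegative 0≤p}} 0≤q)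

+-nonneg : ∀ {p q} → 0ℚ ≤ p → 0ℚ ≤ q → 0ℚ ≤ p + q
+-nonneg {p} {q} 0≤p 0≤q = subst (_≤ p + q) (+-identityˡ 0ℚ) (+-mono-≤ 0≤p 0≤q)

*-mono-≤ : ∀ {p q r s} → 0ℚ ≤ r → 0ℚ ≤ q → p ≤ q → r ≤ s → p * r ≤ q * s
*-mono-≤ {p} {q} {r} {s} 0≤r 0≤q p≤q r≤s =
  ≤-trans (*-monoʳ-≤-nonNeg r {{nonNegative 0≤r}} p≤q)
          (*-monoˡ-≤-nonNeg q {{nonNegative 0≤q}} r≤s)

p≤p+q : ∀ p {q} → 0ℚ ≤ q → p ≤ p + q
p≤p+q p {q} 0≤q = subst (_≤ p + q) (+-identityʳ p) (+-monoʳ-≤ p 0≤q)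

fromℕ-suc : ∀ n → fromℕ (suc n) ≡ fromℕ n + 1ℚ
fromℕ-suc n = toℚᵘ-injective
  (ℚᵘₚ.≃-trans (ℚᵘ.*≡* (cong (ℤ._* (+ 1)) eq)) (ℚᵘₚ.≃-sym (toℚᵘ-homo-+ (fromℕ n) 1ℚ)))
  where
  eq : + suc n ≡ + n ℤ.* + 1 ℤ.+ + 1
  eq = trans (cong +_ (ℕₚ.+-comm 1 n)) (cong (ℤ._+ + 1) (sym (ℤₚ.*-identityʳ (+ n))))

toℚᵘ-1/ : ∀ d → toℚᵘ (+ 1 / suc d) ℚᵘ.≃ ℚᵘ.mkℚᵘ (+ 1) d
toℚᵘ-1/ d = toℚᵘ-fromℚᵘ (ℚᵘ.mkℚᵘ (+ 1) d)

1/-* : ∀ d e .{{_ : ℕ.NonZero d}} .{{_ : ℕ.NonZero e}} .{{_ : ℕ.NonZero (d ℕ.* e)}} →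
       + 1 / (d ℕ.* e) ≡ (+ 1 / d) * (+ 1 / e)
1/-* (suc d) (suc e) = toℚᵘ-injective
  (ℚᵘₚ.≃-trans (toℚᵘ-1/ (e ℕ.+ d ℕ.* suc e))
  (ℚᵘₚ.≃-trans (ℚᵘ.*≡* refl)
  (ℚᵘₚ.≃-sym (ℚᵘₚ.≃-trans (toℚᵘ-homo-* (+ 1 / suc d) (+ 1 / suc e))
                           (ℚᵘₚ.*-cong (toℚᵘ-1/ d) (toℚᵘ-1/ e))))))

1/-inverse : ∀ d → (+ 1 / suc d) * fromℕ (suc d) ≡ 1ℚ
1/-inverse d = trans (cong (_* fromℕ (suc d)) (normalize-coprime (1-coprimeTo (suc d))))
                     (*-inverseˡ (fromℕ (suc d)))

-- (k + 1)⁻¹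
inv : ℕ → ℚ
inv k = + 1 / suc k

recip-nonneg : ∀ k s → 0ℚ ≤ recip k s
recip-nonneg k s = nonNegative⁻¹ (recip k s) {{normalize-nonNeg 1 (suc k ℕ.^ s) {{ℕₚ.m^n≢0 (suc k) s}}}}

inv-nonneg : ∀ k → 0ℚ ≤ inv k
inv-nonneg k = nonNegative⁻¹ (inv k) {{normalize-nonNeg 1 (suc k)}}

recip-suc : ∀ k s → recip k (suc s) ≡ inv k * recip k s
recip-suc k s = 1/-* (suc k) (suc k ℕ.^ s)
  {{_}} {{ℕₚ.m^n≢0 (suc k) s}} {{ℕₚ.m^n≢0 (suc k) (suc s)}}

inv-difference : ∀ k → inv k ≡ inv (suc k) + inv k * inv (suc k)
inv-difference k = begin
  u                                ≡⟨ solve 1 (λ u → u := u :* con 1ℚ) refl u ⟩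
  u * 1ℚ                           ≡⟨ cong (u *_) (sym (1/-inverse (suc k))) ⟩
  u * (w * fromℕ (suc (suc k)))    ≡⟨ cong (λ n → u * (w * n)) (fromℕ-suc (suc k)) ⟩
  u * (w * (fromℕ (suc k) + 1ℚ))   ≡⟨ solve 3 (λ u w n → u :* (w :* (n :+ con 1ℚ)) := (u :* n) :* w :+ u :* w)
                                        refl u w (fromℕ (suc k)) ⟩
  (u * fromℕ (suc k)) * w + u * w  ≡⟨ cong (λ z → z * w + u * w) (1/-inverse k) ⟩
  1ℚ * w + u * w                   ≡⟨ cong (_+ u * w) (solve 1 (λ w → con 1ℚ :* w := w) refl w) ⟩
  w + u * w                        ∎
  where
  open ≡-Reasoning
  u = inv k
  w = inv (suc k)

inv-antitone : ∀ k → inv (suc k) ≤ inv k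
inv-antitone k = subst (inv (suc k) ≤_) (sym (inv-difference k))
  (p≤p+q (inv (suc k)) (*-nonneg (inv-nonneg k) (inv-nonneg (suc k))))

inv≤1 : ∀ k → inv k ≤ 1ℚ
inv≤1 zero    = ≤-refl
inv≤1 (suc k) = ≤-trans (inv-antitone k) (inv≤1 k)

recip≤1 : ∀ k s → recip k s ≤ 1ℚ
recip≤1 k zero    = ≤-refl
recip≤1 k (suc s) = subst (_≤ 1ℚ) (sym (recip-suc k s))
  (*-mono-≤ (recip-nonneg k s) (nonNegative⁻¹ 1ℚ) (inv≤1 k) (recip≤1 k s))

recip≤inv : ∀ k s → recip k (suc s) ≤ inv k
recip≤inv k s = subst₂ _≤_ (sym (recip-suc k s)) (*-identityʳ (inv k))
  (*-monoˡ-≤-nonNeg (inv k) {{nonNegative (inv-nonneg k)}} (recip≤1 k s))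

recip≤inv² : ∀ k s → recip k (suc (suc s)) ≤ inv k * inv k
recip≤inv² k s = subst (_≤ inv k * inv k) (sym (recip-suc k (suc s)))
  (*-monoˡ-≤-nonNeg (inv k) {{nonNegative (inv-nonneg k)}} (recip≤inv k s))

AllPositive : List ℕ → Set
AllPositive = All (1 ℕ.≤_)

nested-nonneg : ∀ ss N → 0ℚ ≤ nested ss N
nested-nonneg []       N       = nonNegative⁻¹ 1ℚ
nested-nonneg (s ∷ ss) zero    = ≤-refl
nested-nonneg (s ∷ ss) (suc k) =
  +-nonneg (nested-nonneg (s ∷ ss) k) (*-nonneg (recip-nonneg k s) (nested-nonneg ss k))

-- The sum of nested over all suffixes of the list, and over its proper suffixes.
suffixes⁺ suffixes : List ℕ → ℕ → ℚ
suffixes⁺ []       N = 0ℚ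
suffixes⁺ (s ∷ ss) N = suffixes ss N
suffixes ss N = suffixes⁺ ss N + nested ss N

suffixes⁺-nonneg : ∀ ss N → 0ℚ ≤ suffixes⁺ ss N
suffixes⁺-nonneg []       N = ≤-refl
suffixes⁺-nonneg (s ∷ ss) N = +-nonneg (suffixes⁺-nonneg ss N) (nested-nonneg ss N)

suffixes-nonneg : ∀ ss N → 0ℚ ≤ suffixes ss N
suffixes-nonneg ss = suffixes⁺-nonneg (0 ∷ ss)

suffixes-step : ∀ {ss} → AllPositive ss → ∀ k →
                suffixes ss (suc k) ≤ suffixes ss k + inv k * suffixes⁺ ss k
suffixes-step [] k = ≤-reflexive (solve 1 (λ v → con 0ℚ :+ con 1ℚ := (con 0ℚ :+ con 1ℚ) :+ v :* con 0ℚ) refl (inv k))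
suffixes-step {suc s ∷ ss} (s≤s _ ∷ pos) k = begin
  suffixes ss (suc k) + (S + recip k (suc s) * h)
    ≤⟨ +-mono-≤ (suffixes-step pos k)
         (+-monoʳ-≤ S (*-monoʳ-≤-nonNeg h {{nonNegative (nested-nonneg ss k)}} (recip≤inv k s))) ⟩
  (b + h + v * b) + (S + v * h)
    ≡⟨ solve 4 (λ b h v S → (b :+ h :+ v :* b) :+ (S :+ v :* h) := ((b :+ h) :+ S) :+ v :* (b :+ h))
         refl b h v S ⟩
  ((b + h) + S) + v * (b + h) ∎
  where
  open ≤-Reasoning
  S = nested (suc s ∷ ss) k
  h = nested ss k
  b = suffixes⁺ ss k
  v = inv k

suffixes-sublinear : ∀ {ss} → AllPositive ss → ∀ ε → 0ℚ < ε →
                     ∃ λ N → ∀ n → N ℕ.≤ n → suffixes ss n ≤ ε * fromℕ n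
suffixes-sublinear [] ε 0<ε = proj₁ a , λ n N≤n →
    ≤-trans (proj₂ a) (*-monoˡ-≤-nonNeg ε {{pos⇒nonNeg ε {{positive 0<ε}}}} (fromℕ-mono N≤n))
  where a = archimedean (0ℚ + 1ℚ) ε 0<ε
suffixes-sublinear {s ∷ ss} (p ∷ pos) ε 0<ε = M ⊔ N , λ n M⊔N≤n →
    subst (suffixes (s ∷ ss) n ≤_)
      (trans (solve 2 (λ d x → d :* x :+ d :* x := (d :+ d) :* x) refl δ (fromℕ n))
             (cong (_* fromℕ n) (½+½ ε)))
      (≤-trans (linear n (ℕₚ.m⊔n≤o⇒m≤o M N M⊔N≤n))
        (+-monoˡ-≤ (δ * fromℕ n)
          (≤-trans (proj₂ arch) (*-monoˡ-≤-nonNeg δ (fromℕ-mono (ℕₚ.m⊔n≤o⇒n≤o M N M⊔N≤n))))))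
  where
  open ≤-Reasoning
  δ = ½ * ε
  0<δ = ½*-pos 0<ε
  instance
    _ = pos⇒nonNeg δ {{positive 0<δ}}
  ih = suffixes-sublinear pos δ 0<δ
  M = proj₁ ih
  C = suffixes (s ∷ ss) M
  arch = archimedean C δ 0<δ
  N = proj₁ arch
  small : ∀ n → M ℕ.≤ n → inv n * suffixes ss n ≤ δ
  small n M≤n = begin
    inv n * suffixes ss n      ≤⟨ *-monoˡ-≤-nonNeg (inv n) {{nonNegative (inv-nonneg n)}}
                                    (≤-trans (proj₂ ih n M≤n) (*-monoˡ-≤-nonNeg δ (fromℕ-mono (ℕₚ.n≤1+n n)))) ⟩
    inv n * (δ * fromℕ (suc n))  ≡⟨ solve 3 (λ v d x → v :* (d :* x) := d :* (v :* x)) refl (inv n) δ (fromℕ (suc n)) ⟩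
    δ * (inv n * fromℕ (suc n))  ≡⟨ cong (δ *_) (1/-inverse n) ⟩
    δ * 1ℚ                       ≡⟨ *-identityʳ δ ⟩
    δ                            ∎
  linear′ : ∀ {n} → M ℕ.≤′ n → suffixes (s ∷ ss) n ≤ C + δ * fromℕ n
  linear′ ≤′-refl = p≤p+q C (*-nonneg (<⇒≤ 0<δ) (fromℕ-mono z≤n))
  linear′ {suc n} (≤′-step M≤n) = begin
    suffixes (s ∷ ss) (suc n)                    ≤⟨ suffixes-step (p ∷ pos) n ⟩
    suffixes (s ∷ ss) n + inv n * suffixes ss n  ≤⟨ +-mono-≤ (linear′ M≤n) (small n (ℕₚ.≤′⇒≤ M≤n)) ⟩
    (C + δ * fromℕ n) + δ                        ≡⟨ solve 3 (λ c d x → (c :+ d :* x) :+ d := c :+ d :* (x :+ con 1ℚ))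
                                                      refl C δ (fromℕ n) ⟩
    C + δ * (fromℕ n + 1ℚ)                       ≡⟨ cong (λ x → C + δ * x) (sym (fromℕ-suc n)) ⟩
    C + δ * fromℕ (suc n)                        ∎
  linear : ∀ n → M ℕ.≤ n → suffixes (s ∷ ss) n ≤ C + δ * fromℕ n
  linear n M≤n = linear′ (ℕₚ.≤⇒≤′ M≤n)

tail : List ℕ → ℕ → ℚ
tail ss k = suffixes ss (suc k) * inv k

tail-nonneg : ∀ ss k → 0ℚ ≤ tail ss k
tail-nonneg ss k = *-nonneg (suffixes-nonneg ss (suc k)) (inv-nonneg k)

tail-step : ∀ t {ss} → AllPositive ss → ∀ k →
            nested (suc (suc t) ∷ ss) (suc (suc k)) + tail ss (suc k) ≤
            nested (suc (suc t) ∷ ss) (suc k) + tail ss k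
tail-step t {ss} pos k = begin
  (S + recip (suc k) (suc (suc t)) * h) + suffixes ss (suc (suc k)) * w
    ≤⟨ +-mono-≤ (+-monoʳ-≤ S (*-monoʳ-≤-nonNeg h {{nonNegative (nested-nonneg ss (suc k))}} (recip≤inv² (suc k) t)))
                (*-monoʳ-≤-nonNeg w {{nonNegative (inv-nonneg (suc k))}} (suffixes-step pos (suc k))) ⟩
  (S + w * w * h) + (b + h + w * b) * w
    ≡⟨ solve 4 (λ S w h b → (S :+ w :* w :* h) :+ (b :+ h :+ w :* b) :* w := S :+ (b :+ h) :* (w :+ w :* w))
         refl S w h b ⟩
  S + (b + h) * (w + w * w)
    ≤⟨ +-monoʳ-≤ S (*-monoˡ-≤-nonNeg (b + h) {{nonNegative (suffixes-nonneg ss (suc k))}}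
         (+-monoʳ-≤ w (*-monoʳ-≤-nonNeg w {{nonNegative (inv-nonneg (suc k))}} (inv-antitone k)))) ⟩
  S + (b + h) * (w + inv k * w)
    ≡⟨ cong (λ x → S + (b + h) * x) (sym (inv-difference k)) ⟩
  S + (b + h) * inv k ∎
  where
  open ≤-Reasoning
  S = nested (suc (suc t) ∷ ss) (suc k)
  h = nested ss (suc k)
  b = suffixes⁺ ss (suc k)
  w = inv (suc k)

nested-mono′ : ∀ s ss {m n} → m ℕ.≤′ n → nested (s ∷ ss) m ≤ nested (s ∷ ss) n
nested-mono′ s ss ≤′-refl = ≤-refl
nested-mono′ s ss {m} {suc n} (≤′-step m≤n) = ≤-trans (nested-mono′ s ss m≤n)
  (p≤p+q (nested (s ∷ ss) n) (*-nonneg (recip-nonneg n s) (nested-nonneg ss n)))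

tail-bound′ : ∀ t {ss} → AllPositive ss → ∀ {n m} → n ℕ.≤′ m →
              nested (suc (suc t) ∷ ss) (suc m) + tail ss m ≤
              nested (suc (suc t) ∷ ss) (suc n) + tail ss n
tail-bound′ t pos ≤′-refl               = ≤-refl
tail-bound′ t pos {m = suc m} (≤′-step n≤m) = ≤-trans (tail-step t pos m) (tail-bound′ t pos n≤m)

tail-bound : ∀ t {ss} → AllPositive ss → ∀ n m → n ℕ.≤ m →
             ∣ nested (suc (suc t) ∷ ss) (suc m) - nested (suc (suc t) ∷ ss) (suc n) ∣ ≤ tail ss n
tail-bound t {ss} pos n m n≤m = begin
  ∣ x - y ∣           ≡⟨ 0≤p⇒∣p∣≡p 0≤x-y ⟩
  x - y               ≤⟨ +-monoˡ-≤ (- y) (≤-trans (p≤p+q x (tail-nonneg ss m)) (tail-bound′ t pos (ℕₚ.≤⇒≤′ n≤m))) ⟩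
  (y + tail ss n) - y ≡⟨ solve 2 (λ y g → (y :+ g) :- y := g) refl y (tail ss n) ⟩
  tail ss n           ∎
  where
  open ≤-Reasoning
  x = nested (suc (suc t) ∷ ss) (suc m)
  y = nested (suc (suc t) ∷ ss) (suc n)
  0≤x-y : 0ℚ ≤ x - y
  0≤x-y = subst (_≤ x - y) (+-inverseʳ y)
    (+-monoˡ-≤ (- y) (nested-mono′ (suc (suc t)) ss (ℕₚ.≤⇒≤′ (s≤s n≤m))))

tail-null : ∀ {ss} → AllPositive ss → ∀ ε → 0ℚ < ε → ∃ λ N → ∀ n → N ℕ.≤ n → tail ss n < ε
tail-null {ss} pos ε 0<ε = proj₁ a , λ n N≤n → begin-strict
    suffixes ss (suc n) * inv n    ≤⟨ *-monoʳ-≤-nonNeg (inv n) {{nonNegative (inv-nonneg n)}}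
                                        (proj₂ a (suc n) (ℕₚ.m≤n⇒m≤1+n N≤n)) ⟩
    δ * fromℕ (suc n) * inv n      ≡⟨ solve 3 (λ d x v → d :* x :* v := d :* (v :* x)) refl δ (fromℕ (suc n)) (inv n) ⟩
    δ * (inv n * fromℕ (suc n))    ≡⟨ cong (δ *_) (1/-inverse n) ⟩
    δ * 1ℚ                         ≡⟨ solve 1 (λ d → d :* con 1ℚ := d :+ con 0ℚ) refl δ ⟩
    δ + 0ℚ                         <⟨ +-mono-≤-< (≤-refl {δ}) (½*-pos 0<ε) ⟩
    δ + δ                          ≡⟨ ½+½ ε ⟩
    ε                              ∎
  where
  open ≤-Reasoning
  δ = ½ * ε
  a = suffixes-sublinear pos δ (½*-pos 0<ε)

nested-cauchy : ∀ t {ss} → AllPositive ss → Cauchy (nested (suc (suc t) ∷ ss))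
nested-cauchy t {ss} pos ε 0<ε = suc N , go
  where
  N = proj₁ (tail-null pos ε 0<ε)
  S = nested (suc (suc t) ∷ ss)
  go : ∀ m n → suc N ℕ.≤ m → suc N ℕ.≤ n → ∣ S m - S n ∣ < ε
  go (suc m) (suc n) (s≤s N≤m) (s≤s N≤n) with ℕₚ.≤-total n m
  ... | inj₁ n≤m = ≤-<-trans (tail-bound t pos n m n≤m) (proj₂ (tail-null pos ε 0<ε) n N≤n)
  ... | inj₂ m≤n = subst (_< ε) (∣p-q∣≡∣q-p∣ (S (suc n)) (S (suc m)))
                     (≤-<-trans (tail-bound t pos m n m≤n) (proj₂ (tail-null pos ε 0<ε) m N≤m))

-- The value at 0 is the one given by analytic continuation; 0 at the pole is a dummy value.
ζ : ℕ → ℝ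
ζ zero          = fromℚ -½
ζ (suc zero)    = fromℚ 0ℚ
ζ (suc (suc s)) = mkℝ (nested (suc (suc s) ∷ [])) (nested-cauchy s [])

-- Arguments with the last one ≥ 2 and the others ≥ 1 give the convergent series;
-- elsewhere the value is a dummy.
ζ₂ : ℕ → ℕ → ℝ
ζ₂ (suc s₁) (suc (suc s₂)) =
  mkℝ (nested (suc (suc s₂) ∷ suc s₁ ∷ [])) (nested-cauchy s₂ (s≤s z≤n ∷ []))
ζ₂ _ _ = fromℚ 0ℚ

ζ₃ : ℕ → ℕ → ℕ → ℝ
ζ₃ (suc s₁) (suc s₂) (suc (suc s₃)) =
  mkℝ (nested (suc (suc s₃) ∷ suc s₂ ∷ suc s₁ ∷ [])) (nested-cauchy s₃ (s≤s z≤n ∷ s≤s z≤n ∷ []))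
ζ₃ _ _ _ = fromℚ 0ℚ

{-# OPTIONS --safe #-}

-- Put e(k) = 1/k for nonzero integers k and e(0) = 0, and sum e(k)ᵃ e(n₁ - k)ᵇ e(n₂ - k)ᶜ over all
-- integers k and all 0 < n₁ < n₂. The part k < n₁ contributes (-1)ᵃ ζ₃(a,b,c) + ζ(a) ζ₂(b,c), and
-- the reflection k ↦ n₂ - k, n₁ ↦ n₂ - n₁ turns the part k > n₁ into (-1)ᵇ times the same expression
-- with a and c exchanged; expanding the products by the stuffle relation gives the triple zeta
-- values of the theorem. On the other hand, expand e(k)ᵃ e(n₂ - k)ᶜ into partial fractions, and then
-- each e(k)ⁱ e(n₁ - k)ᵇ once more. Only sums of e(k)ᵘ over k ∈ ℤ remain; they vanish for odd u and
-- equal 2 ζ(u) for even u > 0, while the correction terms at the poles take the place of 2 ζ(0) = -1.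
-- The sums are truncated to |k| ≲ M and n₂ ≤ N, and M tends to ∞ before N does.

module Submission where

-- The exponent u = 1 occurs among the sums of e(k)ᵘ, and there neither half of ℤ converges by
-- itself. All sums therefore stay on finite windows whose excess over [-M, M] has a length
-- independent of M, so that the two harmonic sums cancel up to finitely many small terms. The two
-- reflections behave differently. k ↦ n₂ - k preserves the window [-M, n₂ + M], so the main
-- identity is exact for all N and M. k ↦ n₁ - k, needed for the second expansion, moves the window
-- by amounts depending on n₁ and n₂. This is why M tends to ∞ with N fixed: only finitely many
-- pairs n₁ < n₂ occur and no uniform estimate is required. Equality of reals compares rational
-- truncations at one common index N. Hence the stuffle relations and the passage to even zeta
-- values are carried out as exact identities of truncated sums, and limits enter only through the
-- windows, the triple sum over negative k and one Cauchy product.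

module Proof where

  open import Algebra.Bundles using (CommutativeRing)
  open import Data.Empty using (⊥-elim)
  open import Data.Integer as ℤ using (ℤ; +_; -[1+_]; _⊖_)
  import Data.Integer.Properties as ℤₚ
  import Data.Integer.Solver
  open import Data.List using ([]; _∷_)
  open import Data.List.Relation.Unary.All using ([]; _∷_)
  open import Data.Nat as ℕ using (ℕ; zero; suc; z≤n; s≤s; _∸_; _⊔_; ⌊_/2⌋; ⌈_/2⌉)
  open import Data.Nat.Combinatorics using (_C_; nCn≡1; nCk≡nC[n∸k]; nCk+nC[k+1]≡[n+1]C[k+1])
  open import Data.Nat.Coprimality as Coprimality using (1-coprimeTo)
  import Data.Nat.Properties as ℕₚ
  open import Data.Product using (∃; _×_; _,_; proj₁; proj₂)
  open import Data.Rational
    using (ℚ; mkℚ; 0ℚ; 1ℚ; ½; _/_; _+_; _-_; _*_; -_; 1/_; ∣_∣; _<_; _≤_; positive; nonNegative; toℚᵘ)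
  open import Data.Rational.Properties
  open import Data.Rational.Solver using (module +-*-Solver)
  import Data.Rational.Unnormalised as ℚᵘ
  import Data.Rational.Unnormalised.Properties as ℚᵘₚ
  open import Function using (_∘_)
  open import Relation.Binary.PropositionalEquality
    using (_≡_; _≢_; refl; sym; trans; cong; cong₂; subst; subst₂; module ≡-Reasoning)
  open import Relation.Nullary using (yes; no)
  open import Algebra.Properties.Semiring.Exp (CommutativeRing.semiring +-*-commutativeRing)
    using (_^_; ^-homo-*)

  open import Defs
    using (Cauchy; ½*-pos; ½+½; ∣p-q∣≡∣q-p∣; fromℕ; fromℕ-mono; archimedean; eventually-bounded;
           *-cauchy; inv; 1/-inverse; inv-nonneg; recip; recip-nonneg; recip-suc; recip≤inv; nested;
           nested-nonneg; nested-mono′; nested-cauchy; *-nonneg; +-nonneg; *-mono-≤; p≤p+q;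
           ℝ; seq; _*ℝ_; ∑≤; [-1]^_; ⟦_⟧; ζ; ζ₂; ζ₃)

  open +-*-Solver using (solve; _:+_; _:*_; _:-_; :-_; _:=_; con)
  module ℤ-Solver = Data.Integer.Solver.+-*-Solver

  -- Finite sums, power series and partial fractions

  ∑ : ℕ → (ℕ → ℚ) → ℚ
  ∑ zero    f = 0ℚ
  ∑ (suc n) f = ∑ n f + f n

  ∑-cong< : ∀ n {f g} → (∀ i → i ℕ.< n → f i ≡ g i) → ∑ n f ≡ ∑ n g
  ∑-cong< zero    f≡g = refl
  ∑-cong< (suc n) f≡g = cong₂ _+_ (∑-cong< n (λ i i<n → f≡g i (ℕₚ.m<n⇒m<1+n i<n))) (f≡g n ℕₚ.≤-refl)

  ∑-cong : ∀ n {f g} → (∀ i → f i ≡ g i) → ∑ n f ≡ ∑ n g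
  ∑-cong n f≡g = ∑-cong< n (λ i _ → f≡g i)

  ∑-zero : ∀ n → ∑ n (λ _ → 0ℚ) ≡ 0ℚ
  ∑-zero zero    = refl
  ∑-zero (suc n) = trans (+-identityʳ _) (∑-zero n)

  +-interchange : ∀ p q r s → (p + q) + (r + s) ≡ (p + r) + (q + s)
  +-interchange = solve 4 (λ p q r s → (p :+ q) :+ (r :+ s) := (p :+ r) :+ (q :+ s)) refl

  ∑-+ : ∀ n f g → ∑ n (λ i → f i + g i) ≡ ∑ n f + ∑ n g
  ∑-+ zero    f g = refl
  ∑-+ (suc n) f g = trans (cong (_+ (f n + g n)) (∑-+ n f g)) (+-interchange (∑ n f) (∑ n g) (f n) (g n))

  ∑-*ˡ : ∀ n c f → ∑ n (λ i → c * f i) ≡ c * ∑ n f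
  ∑-*ˡ zero    c f = sym (*-zeroʳ c)
  ∑-*ˡ (suc n) c f = trans (cong (_+ c * f n) (∑-*ˡ n c f)) (sym (*-distribˡ-+ c (∑ n f) (f n)))

  ∑-*ʳ : ∀ n c f → ∑ n (λ i → f i * c) ≡ ∑ n f * c
  ∑-*ʳ n c f = trans (∑-cong n (λ i → *-comm (f i) c)) (trans (∑-*ˡ n c f) (*-comm c (∑ n f)))

  ∑-swap : ∀ m n (f : ℕ → ℕ → ℚ) → ∑ m (λ i → ∑ n (f i)) ≡ ∑ n (λ j → ∑ m (λ i → f i j))
  ∑-swap zero    n f = sym (∑-zero n)
  ∑-swap (suc m) n f =
    trans (cong (_+ ∑ n (f m)) (∑-swap m n f)) (sym (∑-+ n (λ j → ∑ m (λ i → f i j)) (f m)))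

  ∑-head : ∀ n f → ∑ (suc n) f ≡ f 0 + ∑ n (f ∘ suc)
  ∑-head zero    f = trans (+-identityˡ (f 0)) (sym (+-identityʳ (f 0)))
  ∑-head (suc n) f = trans (cong (_+ f (suc n)) (∑-head n f)) (+-assoc (f 0) (∑ n (f ∘ suc)) (f (suc n)))

  ∑-split : ∀ m n f → ∑ (m ℕ.+ n) f ≡ ∑ m f + ∑ n (λ i → f (m ℕ.+ i))
  ∑-split zero    n f = sym (+-identityˡ (∑ n f))
  ∑-split (suc m) n f = begin
    ∑ (suc (m ℕ.+ n)) f                                   ≡⟨ ∑-head (m ℕ.+ n) f ⟩
    f 0 + ∑ (m ℕ.+ n) (f ∘ suc)                           ≡⟨ cong (λ r → f 0 + r) (∑-split m n (f ∘ suc)) ⟩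
    f 0 + (∑ m (f ∘ suc) + ∑ n (λ i → f (suc m ℕ.+ i)))   ≡⟨ sym (+-assoc (f 0) _ _) ⟩
    (f 0 + ∑ m (f ∘ suc)) + ∑ n (λ i → f (suc m ℕ.+ i))   ≡⟨ cong (_+ ∑ n (λ i → f (suc m ℕ.+ i))) (sym (∑-head m f)) ⟩
    ∑ (suc m) f + ∑ n (λ i → f (suc m ℕ.+ i))             ∎
    where open ≡-Reasoning

  ∑-rev : ∀ n f → ∑ n f ≡ ∑ n (λ i → f (n ∸ suc i))
  ∑-rev zero    f = refl
  ∑-rev (suc n) f = begin
    ∑ n f + f n                          ≡⟨ +-comm (∑ n f) (f n) ⟩
    f n + ∑ n f                          ≡⟨ cong (λ r → f n + r) (∑-rev n f) ⟩
    f n + ∑ n (λ i → f (n ∸ suc i))      ≡⟨ sym (∑-head n (λ i → f (n ∸ i))) ⟩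
    ∑ (suc n) (λ i → f (n ∸ i))          ∎
    where open ≡-Reasoning

  -- The coefficients of a product of two power series.
  conv : (ℕ → ℚ) → (ℕ → ℚ) → ℕ → ℚ
  conv f g zero    = f 0 * g 0
  conv f g (suc n) = f 0 * g (suc n) + conv (f ∘ suc) g n

  conv≡∑ : ∀ f g n → conv f g n ≡ ∑ (suc n) (λ i → f i * g (n ∸ i))
  conv≡∑ f g zero    = sym (+-identityˡ (f 0 * g 0))
  conv≡∑ f g (suc n) = trans (cong (λ r → f 0 * g (suc n) + r) (conv≡∑ (f ∘ suc) g n))
                             (sym (∑-head (suc n) (λ i → f i * g (suc n ∸ i))))

  conv-cong : ∀ n {f f′ g g′} → (∀ i → f i ≡ f′ i) → (∀ i → g i ≡ g′ i) → conv f g n ≡ conv f′ g′ n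
  conv-cong zero    p q = cong₂ _*_ (p 0) (q 0)
  conv-cong (suc n) p q = cong₂ _+_ (cong₂ _*_ (p 0) (q (suc n))) (conv-cong n (p ∘ suc) q)

  conv-∑ˡ : ∀ m (f : ℕ → ℕ → ℚ) g n →
            conv (λ i → ∑ m (λ x → f x i)) g n ≡ ∑ m (λ x → conv (f x) g n)
  conv-∑ˡ m f g zero    = sym (∑-*ʳ m (g 0) (λ x → f x 0))
  conv-∑ˡ m f g (suc n) = trans
    (cong₂ _+_ (sym (∑-*ʳ m (g (suc n)) (λ x → f x 0))) (conv-∑ˡ m (λ x → f x ∘ suc) g n))
    (sym (∑-+ m (λ x → f x 0 * g (suc n)) (λ x → conv (f x ∘ suc) g n)))

  conv-∑ʳ : ∀ m f (g : ℕ → ℕ → ℚ) n →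
            conv f (λ i → ∑ m (λ x → g x i)) n ≡ ∑ m (λ x → conv f (g x) n)
  conv-∑ʳ m f g zero    = sym (∑-*ˡ m (f 0) (λ x → g x 0))
  conv-∑ʳ m f g (suc n) = trans
    (cong₂ _+_ (sym (∑-*ˡ m (f 0) (λ x → g x (suc n)))) (conv-∑ʳ m (f ∘ suc) g n))
    (sym (∑-+ m (λ x → f 0 * g x (suc n)) (λ x → conv (f ∘ suc) (g x) n)))

  conv-+ˡ : ∀ f f′ g n → conv (λ i → f i + f′ i) g n ≡ conv f g n + conv f′ g n
  conv-+ˡ f f′ g zero    = *-distribʳ-+ (g 0) (f 0) (f′ 0)
  conv-+ˡ f f′ g (suc n) = trans
    (cong₂ _+_ (*-distribʳ-+ (g (suc n)) (f 0) (f′ 0)) (conv-+ˡ (f ∘ suc) (f′ ∘ suc) g n))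
    (+-interchange (f 0 * g (suc n)) (f′ 0 * g (suc n)) _ _)

  conv-*ˡ : ∀ c f g n → conv (λ i → c * f i) g n ≡ c * conv f g n
  conv-*ˡ c f g zero    = *-assoc c (f 0) (g 0)
  conv-*ˡ c f g (suc n) = trans
    (cong₂ _+_ (*-assoc c (f 0) (g (suc n))) (conv-*ˡ c (f ∘ suc) g n))
    (sym (*-distribˡ-+ c (f 0 * g (suc n)) (conv (f ∘ suc) g n)))

  conv-*ʳ : ∀ c f g n → conv f (λ i → g i * c) n ≡ conv f g n * c
  conv-*ʳ c f g zero    = sym (*-assoc (f 0) (g 0) c)
  conv-*ʳ c f g (suc n) = trans
    (cong₂ _+_ (sym (*-assoc (f 0) (g (suc n)) c)) (conv-*ʳ c (f ∘ suc) g n))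
    (sym (*-distribʳ-+ c (f 0 * g (suc n)) (conv (f ∘ suc) g n)))

  conv-zeroˡ : ∀ g n → conv (λ _ → 0ℚ) g n ≡ 0ℚ
  conv-zeroˡ g zero    = *-zeroˡ (g 0)
  conv-zeroˡ g (suc n) = trans (cong₂ _+_ (*-zeroˡ (g (suc n))) (conv-zeroˡ g n)) (+-identityʳ 0ℚ)

  conv-assoc : ∀ f g h n → conv (conv f g) h n ≡ conv f (conv g h) n
  conv-assoc f g h zero    = *-assoc (f 0) (g 0) (h 0)
  conv-assoc f g h (suc n) = begin
    f 0 * g 0 * h (suc n) + conv (λ i → f 0 * g (suc i) + conv (f ∘ suc) g i) h n
      ≡⟨ cong₂ _+_ (*-assoc (f 0) (g 0) (h (suc n)))
           (conv-+ˡ (λ i → f 0 * g (suc i)) (conv (f ∘ suc) g) h n) ⟩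
    f 0 * (g 0 * h (suc n)) + (conv (λ i → f 0 * g (suc i)) h n + conv (conv (f ∘ suc) g) h n)
      ≡⟨ cong (λ r → f 0 * (g 0 * h (suc n)) + r) (cong₂ _+_ (conv-*ˡ (f 0) (g ∘ suc) h n) (conv-assoc (f ∘ suc) g h n)) ⟩
    f 0 * (g 0 * h (suc n)) + (f 0 * conv (g ∘ suc) h n + conv (f ∘ suc) (conv g h) n)
      ≡⟨ sym (+-assoc (f 0 * (g 0 * h (suc n))) _ _) ⟩
    f 0 * (g 0 * h (suc n)) + f 0 * conv (g ∘ suc) h n + conv (f ∘ suc) (conv g h) n
      ≡⟨ cong (_+ conv (f ∘ suc) (conv g h) n) (sym (*-distribˡ-+ (f 0) _ _)) ⟩
    f 0 * (g 0 * h (suc n) + conv (g ∘ suc) h n) + conv (f ∘ suc) (conv g h) n ∎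
    where open ≡-Reasoning

  -- The convolutions act on independent indices of `F`, so they commute. This collects the second
  -- expansion in `part-expand` into one convolution of `E` against `geo₂`.
  conv-fubini : ∀ (f : ℕ → ℚ) (F : ℕ → ℕ → ℚ) g m n →
                conv (λ i → conv f (F i) m) g n ≡ conv f (λ j → conv (λ i → F i j) g n) m
  conv-fubini f F g m zero    = sym (conv-*ʳ (g 0) f (F 0) m)
  conv-fubini f F g m (suc n) = begin
    conv f (F 0) m * g (suc n) + conv (λ i → conv f (F (suc i)) m) g n
      ≡⟨ cong₂ _+_ (sym (conv-*ʳ (g (suc n)) f (F 0) m)) (conv-fubini f (F ∘ suc) g m n) ⟩
    conv f (λ j → F 0 j * g (suc n)) m + conv f (λ j → conv (λ i → F (suc i) j) g n) m
      ≡⟨ sym (conv-+ʳ f (λ j → F 0 j * g (suc n)) (λ j → conv (λ i → F (suc i) j) g n) m) ⟩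
    conv f (λ j → conv (λ i → F i j) g (suc n)) m ∎
    where
    open ≡-Reasoning
    conv-+ʳ : ∀ f g g′ n → conv f (λ i → g i + g′ i) n ≡ conv f g n + conv f g′ n
    conv-+ʳ f g g′ zero    = *-distribˡ-+ (f 0) (g 0) (g′ 0)
    conv-+ʳ f g g′ (suc n) = trans
      (cong₂ _+_ (*-distribˡ-+ (f 0) (g (suc n)) (g′ (suc n))) (conv-+ʳ (f ∘ suc) g g′ n))
      (+-interchange (f 0 * g (suc n)) (f 0 * g′ (suc n)) _ _)

  δ : ℕ → ℚ
  δ zero    = 1ℚ
  δ (suc n) = 0ℚ

  conv-δ : ∀ f n → conv f δ n ≡ f n
  conv-δ f zero    = *-identityʳ (f 0)
  conv-δ f (suc n) = trans (cong₂ _+_ (*-zeroʳ (f 0)) (conv-δ (f ∘ suc) n)) (+-identityˡ (f (suc n)))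

  -- The binomial coefficient (m + n choose m).
  bin : ℕ → ℕ → ℚ
  bin zero    n       = 1ℚ
  bin (suc m) zero    = 1ℚ
  bin (suc m) (suc n) = bin m (suc n) + bin (suc m) n

  bin-zeroʳ : ∀ m → bin m 0 ≡ 1ℚ
  bin-zeroʳ zero    = refl
  bin-zeroʳ (suc m) = refl

  -- The coefficients of (z⁻¹ - x)⁻ˢ.
  geo : ℚ → ℕ → ℕ → ℚ
  geo z zero    = δ
  geo z (suc s) = λ η → bin η s * z ^ (suc s ℕ.+ η)

  geo-zero : ∀ z s → geo z s 0 ≡ z ^ s
  geo-zero z zero    = refl
  geo-zero z (suc s) = trans (*-identityˡ _) (cong (z ^_) (ℕₚ.+-identityʳ (suc s)))

  -- Comparison of coefficients in (z⁻¹ - x) (z⁻¹ - x)⁻ˢ⁻¹ = (z⁻¹ - x)⁻ˢ, multiplied through by z;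
  -- on binomials it is Pascal's rule.
  geo-suc : ∀ z s η → geo z (suc s) (suc η) ≡ z * (geo z (suc s) η + geo z s (suc η))
  geo-suc z zero η = begin
    1ℚ * (z * z ^ suc η)              ≡⟨ solve 2 (λ z w → con 1ℚ :* (z :* w) := z :* (con 1ℚ :* w :+ con 0ℚ)) refl z (z ^ suc η) ⟩
    z * (1ℚ * z ^ suc η + 0ℚ)         ≡⟨ cong (λ u → z * (u * z ^ suc η + 0ℚ)) (sym (bin-zeroʳ η)) ⟩
    z * (bin η 0 * z ^ suc η + 0ℚ)    ∎
    where open ≡-Reasoning
  geo-suc z (suc s) η = begin
    (bin η (suc s) + bin (suc η) s) * (z * z ^ (suc s ℕ.+ suc η))
      ≡⟨ solve 4 (λ p q z w → (p :+ q) :* (z :* w) := z :* (p :* w :+ q :* w)) refl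
           (bin η (suc s)) (bin (suc η) s) z (z ^ (suc s ℕ.+ suc η)) ⟩
    z * (bin η (suc s) * z ^ (suc s ℕ.+ suc η) + bin (suc η) s * z ^ (suc s ℕ.+ suc η))
      ≡⟨ cong (λ n → z * (bin η (suc s) * z ^ n + bin (suc η) s * z ^ (suc s ℕ.+ suc η))) (ℕₚ.+-suc (suc s) η) ⟩
    z * (bin η (suc s) * z ^ (suc (suc s) ℕ.+ η) + bin (suc η) s * z ^ (suc s ℕ.+ suc η)) ∎
    where open ≡-Reasoning

  -- The hypotheses say that `h` is `g` times z⁻¹ - x, without dividing by z. Multiplying both
  -- series by `f` preserves the relation.
  conv-recurrence : ∀ z (f g h : ℕ → ℚ) → g 0 ≡ z * h 0 → (∀ n → g (suc n) ≡ z * (g n + h (suc n))) →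
                    ∀ n → conv f g (suc n) ≡ z * (conv f g n + conv f h (suc n))
  conv-recurrence z f g h g₀ g₊ zero = begin
    f 0 * g 1 + f 1 * g 0                            ≡⟨ cong₂ (λ p q → f 0 * p + f 1 * q) (g₊ 0) g₀ ⟩
    f 0 * (z * (g 0 + h 1)) + f 1 * (z * h 0)        ≡⟨ solve 6 (λ f₀ f₁ g₀ h₀ h₁ z →
                                                          f₀ :* (z :* (g₀ :+ h₁)) :+ f₁ :* (z :* h₀) :=
                                                          z :* (f₀ :* g₀ :+ (f₀ :* h₁ :+ f₁ :* h₀))) refl
                                                          (f 0) (f 1) (g 0) (h 0) (h 1) z ⟩
    z * (f 0 * g 0 + (f 0 * h 1 + f 1 * h 0))        ∎
    where open ≡-Reasoning
  conv-recurrence z f g h g₀ g₊ (suc n) = begin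
    f 0 * g (suc (suc n)) + conv f′ g (suc n)
      ≡⟨ cong₂ (λ p q → f 0 * p + q) (g₊ (suc n)) (conv-recurrence z f′ g h g₀ g₊ n) ⟩
    f 0 * (z * (g (suc n) + h (suc (suc n)))) + z * (conv f′ g n + conv f′ h (suc n))
      ≡⟨ solve 6 (λ f₀ p q u v z → f₀ :* (z :* (p :+ q)) :+ z :* (u :+ v) :=
                                   z :* ((f₀ :* p :+ u) :+ (f₀ :* q :+ v))) refl
           (f 0) (g (suc n)) (h (suc (suc n))) (conv f′ g n) (conv f′ h (suc n)) z ⟩
    z * ((f 0 * g (suc n) + conv f′ g n) + (f 0 * h (suc (suc n)) + conv f′ h (suc n))) ∎
    where
    open ≡-Reasoning
    f′ = f ∘ suc

  conv-geo : ∀ z f s n →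
             conv f (geo z (suc s)) (suc n) ≡ z * (conv f (geo z (suc s)) n + conv f (geo z s) (suc n))
  conv-geo z f s = conv-recurrence z f (geo z (suc s)) (geo z s)
    (trans (geo-zero z (suc s)) (cong (z *_) (sym (geo-zero z s)))) (geo-suc z s)

  -- Index 0 is cut off because a partial fraction expansion consists of poles of order at least 1.
  pow⁺ : ℚ → ℕ → ℚ
  pow⁺ x zero    = 0ℚ
  pow⁺ x (suc n) = x ^ suc n

  -- The hypothesis is 1/x + 1/y = 1/z without denominators. Each use of it lowers one of the two
  -- exponents, and by `conv-geo` the right side obeys the same recurrence. The exponents a = c = 0
  -- are excluded, since there the left side is 1 and the right side 0.
  partial-fraction : ∀ x y z → x * y ≡ z * (x + y) → ∀ a c → 0 ℕ.< a ℕ.+ c →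
    x ^ a * y ^ c ≡ conv (pow⁺ x) (geo z c) a + conv (pow⁺ y) (geo z a) c
  partial-fraction x y z xy zero (suc c) _ = begin
    1ℚ * y ^ suc c                               ≡⟨ *-identityˡ (y ^ suc c) ⟩
    y ^ suc c                                    ≡⟨ sym (conv-δ (pow⁺ y) (suc c)) ⟩
    conv (pow⁺ y) δ (suc c)                      ≡⟨ sym (+-identityˡ _) ⟩
    0ℚ + conv (pow⁺ y) δ (suc c)                 ≡⟨ cong (_+ conv (pow⁺ y) δ (suc c)) (sym (*-zeroˡ (geo z (suc c) 0))) ⟩
    0ℚ * geo z (suc c) 0 + conv (pow⁺ y) δ (suc c) ∎
    where open ≡-Reasoning
  partial-fraction x y z xy (suc a) zero _ = begin
    x ^ suc a * 1ℚ                               ≡⟨ *-identityʳ (x ^ suc a) ⟩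
    x ^ suc a                                    ≡⟨ sym (conv-δ (pow⁺ x) (suc a)) ⟩
    conv (pow⁺ x) δ (suc a)                      ≡⟨ sym (+-identityʳ _) ⟩
    conv (pow⁺ x) δ (suc a) + 0ℚ                 ≡⟨ cong (λ r → conv (pow⁺ x) δ (suc a) + r) (sym (*-zeroˡ (geo z (suc a) 0))) ⟩
    conv (pow⁺ x) δ (suc a) + 0ℚ * geo z (suc a) 0 ∎
    where open ≡-Reasoning
  partial-fraction x y z xy (suc a) (suc c) _ = begin
    x * x ^ a * (y * y ^ c)
      ≡⟨ solve 4 (λ x y p q → x :* p :* (y :* q) := x :* y :* (p :* q)) refl x y (x ^ a) (y ^ c) ⟩
    x * y * (x ^ a * y ^ c)
      ≡⟨ cong (_* (x ^ a * y ^ c)) xy ⟩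
    z * (x + y) * (x ^ a * y ^ c)
      ≡⟨ solve 5 (λ x y z p q → z :* (x :+ y) :* (p :* q) := z :* (p :* (y :* q) :+ x :* p :* q)) refl
           x y z (x ^ a) (y ^ c) ⟩
    z * (x ^ a * y ^ suc c + x ^ suc a * y ^ c)
      ≡⟨ cong₂ (λ p q → z * (p + q))
           (partial-fraction x y z xy a (suc c) (ℕₚ.≤-trans (s≤s z≤n) (ℕₚ.m≤n+m (suc c) a)))
           (partial-fraction x y z xy (suc a) c (s≤s z≤n)) ⟩
    z * ((conv X (geo z (suc c)) a + conv Y (geo z a) (suc c)) + (conv X (geo z c) (suc a) + conv Y (geo z (suc a)) c))
      ≡⟨ solve 5 (λ z p q r s → z :* ((p :+ q) :+ (r :+ s)) := z :* (p :+ r) :+ z :* (s :+ q)) refl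
           z (conv X (geo z (suc c)) a) (conv Y (geo z a) (suc c)) (conv X (geo z c) (suc a)) (conv Y (geo z (suc a)) c) ⟩
    z * (conv X (geo z (suc c)) a + conv X (geo z c) (suc a)) + z * (conv Y (geo z (suc a)) c + conv Y (geo z a) (suc c))
      ≡⟨ sym (cong₂ _+_ (conv-geo z X c a) (conv-geo z Y a c)) ⟩
    conv X (geo z (suc c)) (suc a) + conv Y (geo z (suc a)) (suc c) ∎
    where
    open ≡-Reasoning
    X = pow⁺ x
    Y = pow⁺ y

  -- For positive a and c this is the hockey-stick identity for binomials, proved through the
  -- recurrence of `geo`. It evaluates the expansion around one pole at the location of the other
  -- pole.
  conv-pow⁺-geo : ∀ z a c → 0 ℕ.< a ℕ.+ c → conv (pow⁺ z) (geo z a) c ≡ geo z c a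
  conv-pow⁺-geo z zero (suc c) _ = trans (conv-δ (pow⁺ z) (suc c)) (sym (geo-zero z (suc c)))
  conv-pow⁺-geo z (suc a) zero _ = *-zeroˡ (geo z (suc a) 0)
  conv-pow⁺-geo z (suc a) (suc c) _ = begin
    conv (pow⁺ z) (geo z (suc a)) (suc c)
      ≡⟨ conv-geo z (pow⁺ z) a c ⟩
    z * (conv (pow⁺ z) (geo z (suc a)) c + conv (pow⁺ z) (geo z a) (suc c))
      ≡⟨ cong₂ (λ p q → z * (p + q)) (conv-pow⁺-geo z (suc a) c (s≤s z≤n))
           (conv-pow⁺-geo z a (suc c) (ℕₚ.≤-trans (s≤s z≤n) (ℕₚ.m≤n+m (suc c) a))) ⟩
    z * (geo z c (suc a) + geo z (suc c) a)
      ≡⟨ cong (z *_) (+-comm (geo z c (suc a)) (geo z (suc c) a)) ⟩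
    z * (geo z (suc c) a + geo z c (suc a))
      ≡⟨ sym (geo-suc z c a) ⟩
    geo z (suc c) (suc a) ∎
    where open ≡-Reasoning

  -- Reciprocals of integers and sums over windows in ℤ

  neg-involutive : ∀ p → - - p ≡ p
  neg-involutive = solve 1 (λ p → :- (:- p) := p) refl

  ι : ℤ → ℚ
  ι i = mkℚ i 0 (Coprimality.sym (1-coprimeTo ℤ.∣ i ∣))

  ι-+ : ∀ i j → ι (i ℤ.+ j) ≡ ι i + ι j
  ι-+ i j = toℚᵘ-injective (ℚᵘₚ.≃-trans
    (ℚᵘ.*≡* (cong (ℤ._* + 1) (sym (cong₂ ℤ._+_ (ℤₚ.*-identityʳ i) (ℤₚ.*-identityʳ j)))))
    (ℚᵘₚ.≃-sym (toℚᵘ-homo-+ (ι i) (ι j))))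

  -- The reciprocal, with the junk value 0 at 0.
  e : ℤ → ℚ
  e (+ zero)  = 0ℚ
  e (+ suc n) = inv n
  e -[1+ n ]  = - inv n

  e-neg : ∀ i → e (ℤ.- i) ≡ - e i
  e-neg (+ zero)  = refl
  e-neg (+ suc n) = refl
  e-neg -[1+ n ]  = sym (neg-involutive (inv n))

  e-inverse : ∀ i → i ≢ + 0 → e i * ι i ≡ 1ℚ
  e-inverse (+ zero)  i≢0 = ⊥-elim (i≢0 refl)
  e-inverse (+ suc n) _   = 1/-inverse n
  e-inverse -[1+ n ]  _   =
    trans (solve 2 (λ p q → (:- p) :* (:- q) := p :* q) refl (inv n) (ι (+ suc n))) (1/-inverse n)

  e-* : ∀ i j → i ≢ + 0 → j ≢ + 0 → i ℤ.+ j ≢ + 0 → e i * e j ≡ e (i ℤ.+ j) * (e i + e j)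
  e-* i j i≢0 j≢0 i+j≢0 = begin
    e i * e j                                            ≡⟨ sym (*-identityˡ (e i * e j)) ⟩
    1ℚ * (e i * e j)                                     ≡⟨ cong (_* (e i * e j)) (sym (e-inverse (i ℤ.+ j) i+j≢0)) ⟩
    e (i ℤ.+ j) * ι (i ℤ.+ j) * (e i * e j)              ≡⟨ cong (λ p → e (i ℤ.+ j) * p * (e i * e j)) (ι-+ i j) ⟩
    e (i ℤ.+ j) * (ι i + ι j) * (e i * e j)              ≡⟨ solve 5 (λ z p q u v → z :* (p :+ q) :* (u :* v) :=
                                                              z :* ((v :* q) :* u :+ (u :* p) :* v)) refl
                                                              (e (i ℤ.+ j)) (ι i) (ι j) (e i) (e j) ⟩
    e (i ℤ.+ j) * (e j * ι j * e i + e i * ι i * e j)    ≡⟨ cong₂ (λ p q → e (i ℤ.+ j) * (p * e i + q * e j))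
                                                              (e-inverse j j≢0) (e-inverse i i≢0) ⟩
    e (i ℤ.+ j) * (1ℚ * e i + 1ℚ * e j)                  ≡⟨ cong₂ (λ p q → e (i ℤ.+ j) * (p + q))
                                                              (*-identityˡ (e i)) (*-identityˡ (e j)) ⟩
    e (i ℤ.+ j) * (e i + e j)                            ∎
    where open ≡-Reasoning

  -- The coefficient of xⁱ⁻¹ in 1 / (k - x). The convention at i = 0 makes the partial
  -- fraction expansion hold at the poles too, and it is the source of ζ(0) = -1/2:
  -- the sum of E k 0 over all k is -1 = 2 ζ(0).
  E : ℤ → ℕ → ℚ
  E (+ zero)  zero    = - 1ℚ
  E (+ suc n) zero    = 0ℚ
  E -[1+ n ]  zero    = 0ℚ
  E k         (suc i) = e k ^ suc i

  E≡pow⁺ : ∀ k → k ≢ + 0 → ∀ i → E k i ≡ pow⁺ (e k) i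
  E≡pow⁺ (+ zero)  k≢0 i       = ⊥-elim (k≢0 refl)
  E≡pow⁺ (+ suc n) _   zero    = refl
  E≡pow⁺ (+ suc n) _   (suc i) = refl
  E≡pow⁺ -[1+ n ]  _   zero    = refl
  E≡pow⁺ -[1+ n ]  _   (suc i) = refl

  E-0 : ∀ i → E (+ 0) i ≡ - 1ℚ * δ i
  E-0 zero    = refl
  E-0 (suc i) = *-zeroˡ (0ℚ ^ i)

  δ-conv : ∀ f n → conv δ f n ≡ f n
  δ-conv f zero    = *-identityˡ (f 0)
  δ-conv f (suc n) = trans (cong₂ _+_ (*-identityˡ (f (suc n))) (conv-zeroˡ f n)) (+-identityʳ (f (suc n)))

  conv-E-0 : ∀ f n → conv (E (+ 0)) f n ≡ - f n
  conv-E-0 f n = begin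
    conv (E (+ 0)) f n            ≡⟨ conv-cong n E-0 (λ _ → refl) ⟩
    conv (λ i → - 1ℚ * δ i) f n   ≡⟨ conv-*ˡ (- 1ℚ) δ f n ⟩
    - 1ℚ * conv δ f n             ≡⟨ cong (- 1ℚ *_) (δ-conv f n) ⟩
    - 1ℚ * f n                    ≡⟨ solve 1 (λ p → con (- 1ℚ) :* p := :- p) refl (f n) ⟩
    - f n                         ∎
    where open ≡-Reasoning

  -- At k = 0 the product vanishes because `e` is 0 there. The -1 in `E` at index 0 contributes
  -- minus one coefficient of `geo`, and the hockey-stick identity gives the same coefficient with a
  -- plus sign from the other pole.
  partial-fraction-0 : ∀ a c l → l ≢ + 0 →
    0ℚ ≡ conv (E (+ 0)) (geo (e l) (suc c)) (suc a) + conv (E l) (geo (e l) (suc a)) (suc c)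
  partial-fraction-0 a c l l≢0 = begin
    0ℚ                                       ≡⟨ sym (+-inverseˡ (g (suc a))) ⟩
    - g (suc a) + g (suc a)                  ≡⟨ cong₂ _+_ (sym (conv-E-0 g (suc a)))
                                                  (sym (conv-pow⁺-geo (e l) (suc a) (suc c) (s≤s z≤n))) ⟩
    conv (E (+ 0)) g (suc a) + conv (pow⁺ (e l)) (geo (e l) (suc a)) (suc c)
                                             ≡⟨ cong (λ r → conv (E (+ 0)) g (suc a) + r)
                                                  (conv-cong (suc c) (λ i → sym (E≡pow⁺ l l≢0 i)) (λ _ → refl)) ⟩
    conv (E (+ 0)) g (suc a) + conv (E l) (geo (e l) (suc a)) (suc c) ∎
    where
    open ≡-Reasoning
    g = geo (e l) (suc c)

  -- The poles k = 0 and l = 0 are included, so a whole window can be summed without exceptional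
  -- terms. They are mirror images of each other; elsewhere `E` agrees with `pow⁺`.
  partial-fraction-E : ∀ a c k l n → k ℤ.+ l ≡ n → n ≢ + 0 →
    e k ^ suc a * e l ^ suc c ≡ conv (E k) (geo (e n) (suc c)) (suc a) + conv (E l) (geo (e n) (suc a)) (suc c)
  partial-fraction-E a c k l n k+l≡n n≢0 with k ℤ.≟ + 0 | l ℤ.≟ + 0
  ... | yes refl | _ rewrite sym k+l≡n | ℤₚ.+-identityˡ l =
    trans (solve 2 (λ p q → con 0ℚ :* p :* q := con 0ℚ) refl (0ℚ ^ a) (e l ^ suc c)) (partial-fraction-0 a c l n≢0)
  ... | no _ | yes refl rewrite sym k+l≡n | ℤₚ.+-identityʳ k =
    trans (solve 2 (λ p q → p :* (con 0ℚ :* q) := con 0ℚ) refl (e k ^ suc a) (0ℚ ^ c))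
      (trans (partial-fraction-0 c a k n≢0)
        (+-comm (conv (E (+ 0)) (geo (e k) (suc a)) (suc c)) (conv (E k) (geo (e k) (suc c)) (suc a))))
  ... | no k≢0 | no l≢0 = trans
    (partial-fraction (e k) (e l) (e n)
      (subst (λ m → e k * e l ≡ e m * (e k + e l)) k+l≡n
        (e-* k l k≢0 l≢0 (λ k+l≡0 → n≢0 (trans (sym k+l≡n) k+l≡0))))
      (suc a) (suc c) (s≤s z≤n))
    (cong₂ _+_ (conv-cong (suc a) (λ i → sym (E≡pow⁺ k k≢0 i)) (λ _ → refl))
               (conv-cong (suc c) (λ i → sym (E≡pow⁺ l l≢0 i)) (λ _ → refl)))

  sgn : ℕ → ℚ
  sgn n = (- 1ℚ) ^ n

  ^-neg : ∀ x n → (- x) ^ n ≡ sgn n * x ^ n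
  ^-neg x zero    = refl
  ^-neg x (suc n) = trans (cong (- x *_) (^-neg x n))
    (solve 3 (λ x s p → :- x :* (s :* p) := con (- 1ℚ) :* s :* (x :* p)) refl x (sgn n) (x ^ n))

  -- The sum of F over the integers in [-m, n).
  W : ℕ → ℕ → (ℤ → ℚ) → ℚ
  W m n F = ∑ m (λ j → F -[1+ j ]) + ∑ n (λ k → F (+ k))

  W-cong : ∀ m n {F G} → (∀ k → F k ≡ G k) → W m n F ≡ W m n G
  W-cong m n F≡G = cong₂ _+_ (∑-cong m (λ j → F≡G -[1+ j ])) (∑-cong n (λ k → F≡G (+ k)))

  W-+ : ∀ m n F G → W m n (λ k → F k + G k) ≡ W m n F + W m n G
  W-+ m n F G = trans (cong₂ _+_ (∑-+ m (λ j → F -[1+ j ]) (λ j → G -[1+ j ])) (∑-+ n (λ k → F (+ k)) (λ k → G (+ k))))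
                      (+-interchange (∑ m (λ j → F -[1+ j ])) (∑ m (λ j → G -[1+ j ])) _ _)

  W-*ˡ : ∀ m n c F → W m n (λ k → c * F k) ≡ c * W m n F
  W-*ˡ m n c F = trans (cong₂ _+_ (∑-*ˡ m c (λ j → F -[1+ j ])) (∑-*ˡ n c (λ k → F (+ k))))
                       (sym (*-distribˡ-+ c _ _))

  W-conv : ∀ m n (F : ℤ → ℕ → ℚ) g r → W m n (λ k → conv (F k) g r) ≡ conv (λ i → W m n (λ k → F k i)) g r
  W-conv m n F g r = sym (trans
    (conv-+ˡ (λ i → ∑ m (λ j → F -[1+ j ] i)) (λ i → ∑ n (λ k → F (+ k) i)) g r)
    (cong₂ _+_ (conv-∑ˡ m (λ j → F -[1+ j ]) g r) (conv-∑ˡ n (λ k → F (+ k)) g r)))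

  +-+ : ∀ n i → i ℕ.≤ n → + n ℤ.- + i ≡ + (n ∸ i)
  +-+ n i i≤n = trans (ℤₚ.[+m]-[+n]≡m⊖n n i) (ℤₚ.⊖-≥ i≤n)

  -- k ↦ n - k maps [-m₁, n + m₂] onto [-m₂, n + m₁]: the two outer blocks change places and the
  -- block [0, n] is reversed.
  W-reflect : ∀ m₁ m₂ n F → W m₁ (suc (n ℕ.+ m₂)) (λ k → F (+ n ℤ.- k)) ≡ W m₂ (suc (n ℕ.+ m₁)) F
  W-reflect m₁ m₂ n F = begin
    ∑ m₁ (λ j → F (+ (n ℕ.+ suc j))) + ∑ (suc n ℕ.+ m₂) (λ k → F (+ n ℤ.- + k))
      ≡⟨ cong₂ _+_ (∑-cong m₁ (λ j → cong (λ i → F (+ i)) (ℕₚ.+-suc n j))) (∑-split (suc n) m₂ _) ⟩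
    R + (∑ (suc n) (λ k → F (+ n ℤ.- + k)) + ∑ m₂ (λ i → F (+ n ℤ.- + (suc n ℕ.+ i))))
      ≡⟨ cong₂ (λ p q → R + (p + q))
           (trans (∑-cong< (suc n) (λ { k (s≤s k≤n) → cong F (+-+ n k k≤n) })) (sym (∑-rev (suc n) (λ k → F (+ k)))))
           (∑-cong m₂ (λ i → cong F (below i))) ⟩
    R + (P + L)
      ≡⟨ solve 3 (λ r p l → r :+ (p :+ l) := l :+ (p :+ r)) refl R P L ⟩
    L + (P + R)
      ≡⟨ cong (λ r → L + r) (sym (∑-split (suc n) m₁ (λ k → F (+ k)))) ⟩
    L + ∑ (suc n ℕ.+ m₁) (λ k → F (+ k)) ∎
    where
    open ≡-Reasoning
    L = ∑ m₂ (λ j → F -[1+ j ])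
    P = ∑ (suc n) (λ k → F (+ k))
    R = ∑ m₁ (λ j → F (+ (suc n ℕ.+ j)))
    below : ∀ i → + n ℤ.- + (suc n ℕ.+ i) ≡ -[1+ i ]
    below i = begin
      + n ℤ.- + (suc n ℕ.+ i)     ≡⟨ ℤₚ.[+m]-[+n]≡m⊖n n (suc n ℕ.+ i) ⟩
      n ⊖ (suc n ℕ.+ i)           ≡⟨ cong₂ _⊖_ (sym (ℕₚ.+-identityʳ n)) (sym (ℕₚ.+-suc n i)) ⟩
      (n ℕ.+ 0) ⊖ (n ℕ.+ suc i)   ≡⟨ ℤₚ.+-cancelˡ-⊖ n 0 (suc i) ⟩
      -[1+ i ]                    ∎

  -- The window [-m, p + q + m] is cut at p, and its upper piece is reflected by k ↦ p + q - k onto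
  -- [-m, q).
  W-split : ∀ m p q F →
            W m (suc (p ℕ.+ q ℕ.+ m)) F ≡ W m p F + F (+ p) + W m q (λ k → F (+ (p ℕ.+ q) ℤ.- k))
  W-split m p q F = begin
    L + ∑ (suc (p ℕ.+ q ℕ.+ m)) F⁺
      ≡⟨ cong (λ n → L + ∑ n F⁺) (trans (cong suc (ℕₚ.+-assoc p q m)) (sym (ℕₚ.+-suc p (q ℕ.+ m)))) ⟩
    L + ∑ (p ℕ.+ suc (q ℕ.+ m)) F⁺
      ≡⟨ cong (λ r → L + r) (∑-split p (suc (q ℕ.+ m)) F⁺) ⟩
    L + (P + ∑ (suc (q ℕ.+ m)) (λ i → F⁺ (p ℕ.+ i)))
      ≡⟨ cong (λ u → L + (P + u)) (∑-head (q ℕ.+ m) (λ i → F⁺ (p ℕ.+ i))) ⟩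
    L + (P + (F⁺ (p ℕ.+ 0) + ∑ (q ℕ.+ m) (λ i → F⁺ (p ℕ.+ suc i))))
      ≡⟨ cong₂ (λ u v → L + (P + (u + v))) (cong F⁺ (ℕₚ.+-identityʳ p)) (∑-split q m (λ i → F⁺ (p ℕ.+ suc i))) ⟩
    L + (P + (F⁺ p + (∑ q (λ i → F⁺ (p ℕ.+ suc i)) + ∑ m (λ i → F⁺ (p ℕ.+ suc (q ℕ.+ i))))))
      ≡⟨ cong₂ (λ u v → L + (P + (F⁺ p + (u + v))))
           (trans (∑-rev q (λ i → F⁺ (p ℕ.+ suc i))) (∑-cong< q (λ i i<q → sym (cong F (inner i i<q)))))
           (∑-cong m (λ i → cong F⁺ (outer i))) ⟩
    L + (P + (F⁺ p + (Q + R)))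
      ≡⟨ solve 5 (λ l p f q r → l :+ (p :+ (f :+ (q :+ r))) := l :+ p :+ f :+ (r :+ q)) refl L P (F⁺ p) Q R ⟩
    L + P + F⁺ p + (R + Q) ∎
    where
    open ≡-Reasoning
    F⁺ : ℕ → ℚ
    F⁺ k = F (+ k)
    L = ∑ m (λ j → F -[1+ j ])
    P = ∑ p F⁺
    Q = ∑ q (λ k → F (+ (p ℕ.+ q) ℤ.- + k))
    R = ∑ m (λ j → F (+ (p ℕ.+ q) ℤ.- -[1+ j ]))
    outer : ∀ i → p ℕ.+ suc (q ℕ.+ i) ≡ p ℕ.+ q ℕ.+ suc i
    outer i = trans (cong (p ℕ.+_) (sym (ℕₚ.+-suc q i))) (sym (ℕₚ.+-assoc p q (suc i)))
    inner : ∀ i → i ℕ.< q → + (p ℕ.+ q) ℤ.- + i ≡ + (p ℕ.+ suc (q ∸ suc i))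
    inner i i<q = begin
      + (p ℕ.+ q) ℤ.- + i           ≡⟨ +-+ (p ℕ.+ q) i (ℕₚ.≤-trans (ℕₚ.<⇒≤ i<q) (ℕₚ.m≤n+m q p)) ⟩
      + (p ℕ.+ q ∸ i)               ≡⟨ cong +_ (ℕₚ.+-∸-assoc p (ℕₚ.<⇒≤ i<q)) ⟩
      + (p ℕ.+ (q ∸ i))             ≡⟨ cong (λ n → + (p ℕ.+ n)) (ℕₚ.+-∸-assoc 1 i<q) ⟩
      + (p ℕ.+ suc (q ∸ suc i))     ∎

  -- The summand and its two partial fraction expansions

  term : (a b c : ℕ) → (n₁ n₂ : ℤ) → ℤ → ℚ
  term a b c n₁ n₂ k = e k ^ a * e (n₁ ℤ.- k) ^ b * e (n₂ ℤ.- k) ^ c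

  -- The half of the first expansion with poles at k = 0. The half with poles at k = n₂ needs no
  -- separate definition, since reflection turns it into a `part` with a and c exchanged.
  part : (a b c : ℕ) → (n₁ n₂ : ℤ) → ℤ → ℚ
  part a b c n₁ n₂ k = conv (E k) (geo (e n₂) c) a * e (n₁ ℤ.- k) ^ b

  module _ (p q : ℤ) where
    open ℤ-Solver using () renaming (solve to solveℤ; _:+_ to _⊕_; _:-_ to _⊝_; :-_ to ⊝_; _:=_ to _⊜_)

    reflect₁ : ∀ k → q ℤ.- k ≡ ℤ.- (p ℤ.- (p ℤ.+ q ℤ.- k))
    reflect₁ = solveℤ 3 (λ p q k → q ⊝ k ⊜ ⊝ (p ⊝ ((p ⊕ q) ⊝ k))) refl p q

    reflect₂ : ∀ k → k ≡ p ℤ.+ q ℤ.- (p ℤ.+ q ℤ.- k)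
    reflect₂ = solveℤ 3 (λ p q k → k ⊜ (p ⊕ q) ⊝ ((p ⊕ q) ⊝ k)) refl p q

    reflect₃ : ∀ k → k ℤ.+ (p ℤ.+ q ℤ.- k) ≡ p ℤ.+ q
    reflect₃ = solveℤ 3 (λ p q k → k ⊕ ((p ⊕ q) ⊝ k) ⊜ (p ⊕ q)) refl p q

    e-reflect : ∀ b k → e (p ℤ.- (p ℤ.+ q ℤ.- k)) ^ b ≡ sgn b * e (q ℤ.- k) ^ b
    e-reflect b k = begin
      e j ^ b                   ≡⟨ cong (_^ b) (sym (neg-involutive (e j))) ⟩
      (- (- e j)) ^ b           ≡⟨ ^-neg (- e j) b ⟩
      sgn b * (- e j) ^ b       ≡⟨ cong (λ u → sgn b * u ^ b) (sym (e-neg j)) ⟩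
      sgn b * e (ℤ.- j) ^ b     ≡⟨ cong (λ u → sgn b * e u ^ b) (sym (reflect₁ k)) ⟩
      sgn b * e (q ℤ.- k) ^ b   ∎
      where
      open ≡-Reasoning
      j = p ℤ.- (p ℤ.+ q ℤ.- k)

    term-reflect : ∀ a b c k → term a b c p (p ℤ.+ q) (p ℤ.+ q ℤ.- k) ≡ sgn b * term c b a q (p ℤ.+ q) k
    term-reflect a b c k = trans
      (cong₂ (λ u v → e (p ℤ.+ q ℤ.- k) ^ a * u * e v ^ c) (e-reflect b k) (sym (reflect₂ k)))
      (solve 4 (λ x s y z → x :* (s :* y) :* z := s :* (z :* y :* x)) refl
        (e (p ℤ.+ q ℤ.- k) ^ a) (sgn b) (e (q ℤ.- k) ^ b) (e k ^ c))

    -- Here n₁ = p and n₂ = p + q. In the half with poles at n₂, the middle factor is rewritten in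
    -- terms of n₂ - k; it then belongs to q = n₂ - n₁ and costs the sign (-1)ᵇ.
    term-parts : p ℤ.+ q ≢ + 0 → ∀ a b c k →
      term (suc a) b (suc c) p (p ℤ.+ q) k ≡
      part (suc a) b (suc c) p (p ℤ.+ q) k + sgn b * part (suc c) b (suc a) q (p ℤ.+ q) (p ℤ.+ q ℤ.- k)
    term-parts p+q≢0 a b c k = begin
      x * y * z
        ≡⟨ solve 3 (λ x y z → x :* y :* z := x :* z :* y) refl x y z ⟩
      x * z * y
        ≡⟨ cong (_* y) (partial-fraction-E a c k (p ℤ.+ q ℤ.- k) (p ℤ.+ q) (reflect₃ k) p+q≢0) ⟩
      (u + v) * y
        ≡⟨ *-distribʳ-+ y u v ⟩
      u * y + v * y
        ≡⟨ cong (λ w → u * y + v * w) (trans (cong (λ j → e (p ℤ.- j) ^ b) (reflect₂ k)) (e-reflect b (p ℤ.+ q ℤ.- k))) ⟩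
      u * y + v * (sgn b * w)
        ≡⟨ cong (λ r → u * y + r) (solve 3 (λ v s w → v :* (s :* w) := s :* (v :* w)) refl v (sgn b) w) ⟩
      u * y + sgn b * (v * w) ∎
      where
      open ≡-Reasoning
      x = e k ^ suc a
      y = e (p ℤ.- k) ^ b
      z = e (p ℤ.+ q ℤ.- k) ^ suc c
      u = conv (E k) (geo (e (p ℤ.+ q)) (suc c)) (suc a)
      v = conv (E (p ℤ.+ q ℤ.- k)) (geo (e (p ℤ.+ q)) (suc a)) (suc c)
      w = e (q ℤ.- (p ℤ.+ q ℤ.- k)) ^ b

  -- The positive middle exponent and the convention that `e` is 0 at 0 remove the single point k =
  -- n₁ left over by `W-split`.
  term-pole : ∀ a b c p n → term a (suc b) c p n p ≡ 0ℚ
  term-pole a b c p n = trans (cong (λ j → e p ^ a * e j ^ suc b * e (n ℤ.- p) ^ c) (ℤₚ.+-inverseʳ p))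
    (solve 3 (λ x y z → x :* (con 0ℚ :* y) :* z := con 0ℚ) refl (e p ^ a) (0ℚ ^ b) (e (n ℤ.- p) ^ c))

  -- The window [-M, n₂ + M] is invariant under k ↦ n₂ - k, so the identity is exact for every M.
  -- The left side comes from cutting at k = n₁, the right side from expanding and reflecting the
  -- second half.
  terms≡parts : ∀ a b c x y M → let p = + suc x ; q = + suc y ; n = p ℤ.+ q ; L = suc (suc x ℕ.+ suc y ℕ.+ M) in
    W M (suc x) (term (suc a) (suc b) (suc c) p n) + sgn (suc b) * W M (suc y) (term (suc c) (suc b) (suc a) q n) ≡
    W M L (part (suc a) (suc b) (suc c) p n) + sgn (suc b) * W M L (part (suc c) (suc b) (suc a) q n)
  terms≡parts a b c x y M = begin
    W M (suc x) T + s * W M (suc y) T′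
      ≡⟨ cong₂ _+_ (sym (+-identityʳ (W M (suc x) T))) (sym (W-*ˡ M (suc y) s T′)) ⟩
    W M (suc x) T + 0ℚ + W M (suc y) (λ k → s * T′ k)
      ≡⟨ cong₂ (λ u v → W M (suc x) T + u + v) (sym (term-pole (suc a) b (suc c) p n))
           (W-cong M (suc y) (λ k → sym (term-reflect p q (suc a) (suc b) (suc c) k))) ⟩
    W M (suc x) T + T p + W M (suc y) (λ k → T (n ℤ.- k))
      ≡⟨ sym (W-split M (suc x) (suc y) T) ⟩
    W M L T
      ≡⟨ W-cong M L (term-parts p q (λ ()) a (suc b) c) ⟩
    W M L (λ k → U k + s * U′ (n ℤ.- k))
      ≡⟨ W-+ M L U (λ k → s * U′ (n ℤ.- k)) ⟩
    W M L U + W M L (λ k → s * U′ (n ℤ.- k))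
      ≡⟨ cong (λ r → W M L U + r) (W-*ˡ M L s (λ k → U′ (n ℤ.- k))) ⟩
    W M L U + s * W M L (λ k → U′ (n ℤ.- k))
      ≡⟨ cong (λ u → W M L U + s * u) (W-reflect M M (suc x ℕ.+ suc y) U′) ⟩
    W M L U + s * W M L U′ ∎
    where
    open ≡-Reasoning
    p = + suc x
    q = + suc y
    n = p ℤ.+ q
    L = suc (suc x ℕ.+ suc y ℕ.+ M)
    s = sgn (suc b)
    T = term (suc a) (suc b) (suc c) p n
    T′ = term (suc c) (suc b) (suc a) q n
    U = part (suc a) (suc b) (suc c) p n
    U′ = part (suc c) (suc b) (suc a) q n

  -- `E` at index 0 is supported on k = 0, where n - k is n.
  E-0-* : ∀ b k n → E k 0 * e (n ℤ.- k) ^ b ≡ E k 0 * e n ^ b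
  E-0-* b (+ zero)  n = cong (λ j → - 1ℚ * e j ^ b) (ℤₚ.+-identityʳ n)
  E-0-* b (+ suc k) n = trans (*-zeroˡ (e (n ℤ.- + suc k) ^ b)) (sym (*-zeroˡ (e n ^ b)))
  E-0-* b -[1+ k ]  n = trans (*-zeroˡ (e (n ℤ.- -[1+ k ]) ^ b)) (sym (*-zeroˡ (e n ^ b)))

  -- Coefficients in x of (z₁⁻¹ - x)⁻ᵇ (z₂⁻¹ - x)⁻ᶜ, and of yᵝ xᵃ in (z₁⁻¹ - x - y)⁻¹ (z₂⁻¹ - x)⁻ᶜ.
  geo₁ : ℚ → ℚ → ℕ → ℕ → ℕ → ℚ
  geo₁ z₁ z₂ b c = conv (geo z₁ b) (geo z₂ c)

  geo₂ : ℚ → ℚ → ℕ → ℕ → ℕ → ℚ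
  geo₂ z₁ z₂ a c β = conv (λ ω → geo z₁ (suc ω) β) (geo z₂ c) a

  -- Each product of `E k i` with the middle factor is split into poles at k = 0 and at k = n₁. The
  -- former combine with the first expansion by associativity, the latter by `conv-fubini`.
  part-expand : ∀ a b c n₁ n₂ → n₁ ≢ + 0 → ∀ k →
    part (suc a) (suc b) c n₁ n₂ k ≡
    conv (E k) (geo₁ (e n₁) (e n₂) (suc b) c) (suc a) + conv (E (n₁ ℤ.- k)) (geo₂ (e n₁) (e n₂) a c) (suc b)
  part-expand a b c n₁ n₂ n₁≢0 k = begin
    conv (E k) h (suc a) * y
      ≡⟨ *-comm (conv (E k) h (suc a)) y ⟩
    y * conv (E k) h (suc a)
      ≡⟨ sym (conv-*ˡ y (E k) h (suc a)) ⟩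
    conv (λ i → y * E k i) h (suc a)
      ≡⟨ conv-cong (suc a) second-pole (λ _ → refl) ⟩
    conv (λ i → conv (E k) g i + rest i) h (suc a)
      ≡⟨ conv-+ˡ (conv (E k) g) rest h (suc a) ⟩
    conv (conv (E k) g) h (suc a) + (0ℚ * h (suc a) + conv (rest ∘ suc) h a)
      ≡⟨ cong₂ _+_ (conv-assoc (E k) g h (suc a))
           (trans (cong (_+ conv (rest ∘ suc) h a) (*-zeroˡ (h (suc a)))) (+-identityˡ (conv (rest ∘ suc) h a))) ⟩
    conv (E k) (conv g h) (suc a) + conv (rest ∘ suc) h a
      ≡⟨ cong (λ r → conv (E k) (conv g h) (suc a) + r)
           (conv-fubini (E (n₁ ℤ.- k)) (λ ω → geo (e n₁) (suc ω)) h (suc b) a) ⟩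
    conv (E k) (conv g h) (suc a) + conv (E (n₁ ℤ.- k)) (geo₂ (e n₁) (e n₂) a c) (suc b) ∎
    where
    open ≡-Reasoning
    h = geo (e n₂) c
    g = geo (e n₁) (suc b)
    y = e (n₁ ℤ.- k) ^ suc b
    rest : ℕ → ℚ
    -- Index 0 produces no pole at n₁, because there the middle factor is constant on the support of
    -- `E`. This zero head is what lowers the index to a, hence the upper limit a - 1 of ω in the
    -- theorem.
    rest zero    = 0ℚ
    rest (suc ω) = conv (E (n₁ ℤ.- k)) (geo (e n₁) (suc ω)) (suc b)
    E-suc : ∀ k i → E k (suc i) ≡ e k ^ suc i
    E-suc (+ zero)  i = refl
    E-suc (+ suc _) i = refl
    E-suc -[1+ _ ]  i = refl
    second-pole : ∀ i → y * E k i ≡ conv (E k) g i + rest i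
    second-pole zero = begin
      y * E k 0                ≡⟨ *-comm y (E k 0) ⟩
      E k 0 * y                ≡⟨ E-0-* (suc b) k n₁ ⟩
      E k 0 * e n₁ ^ suc b     ≡⟨ cong (E k 0 *_) (sym (geo-zero (e n₁) (suc b))) ⟩
      E k 0 * g 0              ≡⟨ sym (+-identityʳ (E k 0 * g 0)) ⟩
      E k 0 * g 0 + 0ℚ         ∎
    second-pole (suc i) = begin
      y * E k (suc i)          ≡⟨ *-comm y (E k (suc i)) ⟩
      E k (suc i) * y          ≡⟨ cong (_* y) (E-suc k i) ⟩
      e k ^ suc i * y          ≡⟨ partial-fraction-E i b k (n₁ ℤ.- k) n₁ k+[n₁-k]≡n₁ n₁≢0 ⟩
      conv (E k) g (suc i) + rest (suc i) ∎
      where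
      k+[n₁-k]≡n₁ : k ℤ.+ (n₁ ℤ.- k) ≡ n₁
      k+[n₁-k]≡n₁ = ℤ-Solver.solve 2 (λ k n → k ℤ-Solver.:+ (n ℤ-Solver.:- k) ℤ-Solver.:= n) refl k n₁

  ΣE : ℕ → ℕ → ℕ → ℚ
  ΣE m n i = W m n (λ k → E k i)

  -- The poles at n₁ are moved to 0 by k ↦ n₁ - k, which carries [-M, n₂ + M] to
  -- [-(n₂ - n₁) - M, n₁ + M]. Neither window is symmetric, but the defects do not grow with M.
  W-part : ∀ a b c x y M → let n₂ = suc x ℕ.+ suc y in
    W M (suc (n₂ ℕ.+ M)) (part (suc a) (suc b) c (+ suc x) (+ n₂)) ≡
    conv (ΣE M (suc (n₂ ℕ.+ M))) (geo₁ (inv x) (e (+ n₂)) (suc b) c) (suc a) +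
    conv (ΣE (suc y ℕ.+ M) (suc (suc x ℕ.+ M))) (geo₂ (inv x) (e (+ n₂)) a c) (suc b)
  W-part a b c x y M = begin
    W M L (part (suc a) (suc b) c (+ suc x) (+ n₂))
      ≡⟨ W-cong M L (part-expand a b c (+ suc x) (+ n₂) (λ ())) ⟩
    W M L (λ k → conv (E k) g₁ (suc a) + conv (E (+ suc x ℤ.- k)) g₂ (suc b))
      ≡⟨ W-+ M L (λ k → conv (E k) g₁ (suc a)) (λ k → conv (E (+ suc x ℤ.- k)) g₂ (suc b)) ⟩
    W M L (λ k → conv (E k) g₁ (suc a)) + W M L (λ k → conv (E (+ suc x ℤ.- k)) g₂ (suc b))
      ≡⟨ cong₂ _+_ (W-conv M L E g₁ (suc a)) (begin
           W M L (λ k → conv (E (+ suc x ℤ.- k)) g₂ (suc b))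
             ≡⟨ cong (λ l → W M (suc l) (λ k → conv (E (+ suc x ℤ.- k)) g₂ (suc b))) (ℕₚ.+-assoc (suc x) (suc y) M) ⟩
           W M (suc (suc x ℕ.+ (suc y ℕ.+ M))) (λ k → conv (E (+ suc x ℤ.- k)) g₂ (suc b))
             ≡⟨ W-reflect M (suc y ℕ.+ M) (suc x) (λ k → conv (E k) g₂ (suc b)) ⟩
           W (suc y ℕ.+ M) (suc (suc x ℕ.+ M)) (λ k → conv (E k) g₂ (suc b))
             ≡⟨ W-conv (suc y ℕ.+ M) (suc (suc x ℕ.+ M)) E g₂ (suc b) ⟩
           conv (ΣE (suc y ℕ.+ M) (suc (suc x ℕ.+ M))) g₂ (suc b) ∎) ⟩
    conv (ΣE M L) g₁ (suc a) + conv (ΣE (suc y ℕ.+ M) (suc (suc x ℕ.+ M))) g₂ (suc b) ∎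
    where
    open ≡-Reasoning
    n₂ = suc x ℕ.+ suc y
    L = suc (n₂ ℕ.+ M)
    g₁ = geo₁ (inv x) (e (+ n₂)) (suc b) c
    g₂ = geo₂ (inv x) (e (+ n₂)) a c

  -- Truncated multiple zeta values

  recip≡^ : ∀ k s → recip k s ≡ inv k ^ s
  recip≡^ k zero    = refl
  recip≡^ k (suc s) = trans (recip-suc k s) (cong (inv k *_) (recip≡^ k s))

  recip-+ : ∀ k s t → recip k (s ℕ.+ t) ≡ recip k s * recip k t
  recip-+ k s t = trans (recip≡^ k (s ℕ.+ t))
    (trans (^-homo-* (inv k) s t) (sym (cong₂ _*_ (recip≡^ k s) (recip≡^ k t))))

  nested≡∑ : ∀ s ss N → nested (s ∷ ss) N ≡ ∑ N (λ k → recip k s * nested ss k)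
  nested≡∑ s ss zero    = refl
  nested≡∑ s ss (suc N) = cong (_+ recip N s * nested ss N) (nested≡∑ s ss N)

  nested₁ : ∀ s N → nested (s ∷ []) N ≡ ∑ N (λ k → recip k s)
  nested₁ s N = trans (nested≡∑ s [] N) (∑-cong N (λ k → *-identityʳ (recip k s)))

  nested₂ : ∀ t s N → nested (t ∷ s ∷ []) N ≡ ∑ N (λ m → recip m t * ∑ m (λ x → recip x s))
  nested₂ t s N = trans (nested≡∑ t (s ∷ []) N) (∑-cong N (λ m → cong (recip m t *_) (nested₁ s m)))

  ∑-triangle : ∀ n (G : ℕ → ℕ → ℚ) →
               ∑ n (λ x → ∑ x (λ k → G k (x ∸ suc k))) ≡ ∑ n (λ k → ∑ (n ∸ suc k) (G k))
  ∑-triangle zero    G = refl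
  ∑-triangle (suc n) G = begin
    ∑ n (λ x → ∑ x (λ k → G k (x ∸ suc k))) + ∑ n (λ k → G k (n ∸ suc k))
      ≡⟨ cong (_+ ∑ n (λ k → G k (n ∸ suc k))) (∑-triangle n G) ⟩
    ∑ n (λ k → ∑ (n ∸ suc k) (G k)) + ∑ n (λ k → G k (n ∸ suc k))
      ≡⟨ sym (∑-+ n (λ k → ∑ (n ∸ suc k) (G k)) (λ k → G k (n ∸ suc k))) ⟩
    ∑ n (λ k → ∑ (suc (n ∸ suc k)) (G k))
      ≡⟨ ∑-cong< n (λ k k<n → cong (λ l → ∑ l (G k)) (sym (ℕₚ.+-∸-assoc 1 k<n))) ⟩
    ∑ n (λ k → ∑ (n ∸ k) (G k))
      ≡⟨ sym (+-identityʳ (∑ n (λ k → ∑ (n ∸ k) (G k)))) ⟩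
    ∑ n (λ k → ∑ (n ∸ k) (G k)) + 0ℚ
      ≡⟨ cong (λ l → ∑ n (λ k → ∑ (n ∸ k) (G k)) + ∑ l (G n)) (sym (ℕₚ.n∸n≡0 n)) ⟩
    ∑ n (λ k → ∑ (n ∸ k) (G k)) + ∑ (n ∸ n) (G n) ∎
    where open ≡-Reasoning

  -- The sum over 0 < n₁ < n₂ ≤ N, where n₁ = x + 1 and n₂ - n₁ = y + 1.
  ∑∑ : ℕ → (ℕ → ℕ → ℚ) → ℚ
  ∑∑ N f = ∑ N (λ m → ∑ m (λ x → f x (m ∸ suc x)))

  ∑∑-cong : ∀ N {f g} → (∀ x y → f x y ≡ g x y) → ∑∑ N f ≡ ∑∑ N g
  ∑∑-cong N f≡g = ∑-cong N (λ m → ∑-cong m (λ x → f≡g x (m ∸ suc x)))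

  ∑∑-+ : ∀ N f g → ∑∑ N (λ x y → f x y + g x y) ≡ ∑∑ N f + ∑∑ N g
  ∑∑-+ N f g = trans (∑-cong N (λ m → ∑-+ m (λ x → f x (m ∸ suc x)) (λ x → g x (m ∸ suc x))))
                     (∑-+ N (λ m → ∑ m (λ x → f x (m ∸ suc x))) (λ m → ∑ m (λ x → g x (m ∸ suc x))))

  ∑∑-*ˡ : ∀ N c f → ∑∑ N (λ x y → c * f x y) ≡ c * ∑∑ N f
  ∑∑-*ˡ N c f = trans (∑-cong N (λ m → ∑-*ˡ m c (λ x → f x (m ∸ suc x))))
                      (∑-*ˡ N c (λ m → ∑ m (λ x → f x (m ∸ suc x))))

  ∑∑-swap : ∀ N f → ∑∑ N f ≡ ∑∑ N (λ x y → f y x)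
  ∑∑-swap N f = ∑-cong N (λ m → trans (∑-rev m (λ x → f x (m ∸ suc x)))
    (∑-cong< m (λ x x<m → cong (f (m ∸ suc x)) (inner x<m))))
    where
    inner : ∀ {x m} → x ℕ.< m → m ∸ suc (m ∸ suc x) ≡ x
    inner {x} {m} x<m = trans (cong (m ∸_) (sym (ℕₚ.+-∸-assoc 1 x<m))) (ℕₚ.m∸[m∸n]≡n (ℕₚ.<⇒≤ x<m))

  ∑∑-outer : ∀ N (g : ℕ → ℕ → ℚ) → ∑∑ N (λ x y → g x (x ℕ.+ suc y)) ≡ ∑ N (λ m → ∑ m (λ x → g x m))
  ∑∑-outer N g = ∑-cong N (λ m → ∑-cong< m (λ x x<m → cong (g x)
    (trans (ℕₚ.+-suc x (m ∸ suc x)) (trans (ℕₚ.+-comm (suc x) (m ∸ suc x)) (ℕₚ.m∸n+n≡m x<m)))))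

  -- With k = -(j + 1) the denominators are j + 1 < n₁ + j + 1 < n₂ + j + 1, where n₁ = x + 1 and n₂
  -- = m + 1: the shape of a triple zeta value. The sign (-1)ᵃ is left out.
  neg-part : (a b c M x m : ℕ) → ℚ
  neg-part a b c M x m = ∑ M (λ j → recip j a * (recip (x ℕ.+ suc j) b * recip (m ℕ.+ suc j) c))

  -- For 0 < k < n₁ the variables k and n₁ - k < n₂ - k are independent apart from the truncation,
  -- so summing leads to a product of ζ(a) and ζ₂(b,c).
  pos-part : (a b c x m : ℕ) → ℚ
  pos-part a b c x m = ∑ x (λ k → recip k a * (recip (x ∸ suc k) b * recip (m ∸ suc k) c))

  W-term : ∀ a b c M x y → let m = x ℕ.+ suc y in
    W M (suc x) (term (suc a) b c (+ suc x) (+ suc m)) ≡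
    sgn (suc a) * neg-part (suc a) b c M x m + pos-part (suc a) b c x m
  W-term a b c M x y = cong₂ _+_
    (trans (∑-cong M (λ j → trans
             (cong₂ (λ u v → u * inv (x ℕ.+ suc j) ^ b * v) (^-neg (inv j) (suc a)) (sym (recip≡^ (m ℕ.+ suc j) c)))
             (trans (cong₂ (λ u v → sgn (suc a) * u * v * recip (m ℕ.+ suc j) c)
                       (sym (recip≡^ j (suc a))) (sym (recip≡^ (x ℕ.+ suc j) b)))
               (solve 4 (λ s p q r → s :* p :* q :* r := s :* (p :* (q :* r))) refl
                 (sgn (suc a)) (recip j (suc a)) (recip (x ℕ.+ suc j) b) (recip (m ℕ.+ suc j) c)))))
           (∑-*ˡ M (sgn (suc a)) (λ j → recip j (suc a) * (recip (x ℕ.+ suc j) b * recip (m ℕ.+ suc j) c))))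
    (trans (∑-head x (λ k → T (+ k)))
      (trans (cong₂ _+_ at-zero (∑-cong< x at-suc)) (+-identityˡ (pos-part (suc a) b c x m))))
    where
    m = x ℕ.+ suc y
    T = term (suc a) b c (+ suc x) (+ suc m)
    at-zero : T (+ 0) ≡ 0ℚ
    at-zero = solve 3 (λ p q r → con 0ℚ :* p :* q :* r := con 0ℚ) refl
      (0ℚ ^ a) (e (+ suc x ℤ.- + 0) ^ b) (e (+ suc m ℤ.- + 0) ^ c)
    difference : ∀ n k → k ℕ.< n → e (+ suc n ℤ.- + suc k) ≡ inv (n ∸ suc k)
    difference n k k<n = cong e (trans (+-+ (suc n) (suc k) (s≤s (ℕₚ.<⇒≤ k<n))) (cong +_ (ℕₚ.+-∸-assoc 1 k<n)))
    at-suc : ∀ k → k ℕ.< x → T (+ suc k) ≡ recip k (suc a) * (recip (x ∸ suc k) b * recip (m ∸ suc k) c)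
    at-suc k k<x = trans
      (cong₂ (λ u v → inv k ^ suc a * u ^ b * v ^ c) (difference x k k<x)
        (difference m k (ℕₚ.≤-trans k<x (ℕₚ.m≤m+n x (suc y)))))
      (trans (*-assoc (inv k ^ suc a) (inv (x ∸ suc k) ^ b) (inv (m ∸ suc k) ^ c))
        (sym (cong₂ _*_ (recip≡^ k (suc a)) (cong₂ _*_ (recip≡^ (x ∸ suc k) b) (recip≡^ (m ∸ suc k) c)))))

  shifted : (b c j : ℕ) → ℕ → ℚ
  shifted b c j n = ∑ n (λ m → recip (m ℕ.+ suc j) c * ∑ m (λ x → recip (x ℕ.+ suc j) b))

  ∑-neg-part : ∀ a b c M N →
    ∑ N (λ m → ∑ m (λ x → neg-part a b c M x m)) ≡ ∑ M (λ j → recip j a * shifted b c j N)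
  ∑-neg-part a b c M N = begin
    ∑ N (λ m → ∑ m (λ x → ∑ M (λ j → t j x m)))
      ≡⟨ ∑-cong N (λ m → ∑-swap m M (λ x j → t j x m)) ⟩
    ∑ N (λ m → ∑ M (λ j → ∑ m (λ x → t j x m)))
      ≡⟨ ∑-swap N M (λ m j → ∑ m (λ x → t j x m)) ⟩
    ∑ M (λ j → ∑ N (λ m → ∑ m (λ x → t j x m)))
      ≡⟨ ∑-cong M (λ j → trans
           (∑-cong N (λ m → trans (∑-*ˡ m (recip j a) (λ x → recip (x ℕ.+ suc j) b * recip (m ℕ.+ suc j) c))
             (cong (recip j a *_) (trans (∑-*ʳ m (recip (m ℕ.+ suc j) c) (λ x → recip (x ℕ.+ suc j) b))
               (*-comm (∑ m (λ x → recip (x ℕ.+ suc j) b)) (recip (m ℕ.+ suc j) c))))))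
           (∑-*ˡ N (recip j a) (λ m → recip (m ℕ.+ suc j) c * ∑ m (λ x → recip (x ℕ.+ suc j) b)))) ⟩
    ∑ M (λ j → recip j a * shifted b c j N) ∎
    where
    open ≡-Reasoning
    t : ℕ → ℕ → ℕ → ℚ
    t j x m = recip j a * (recip (x ℕ.+ suc j) b * recip (m ℕ.+ suc j) c)

  -- The triple sum is ordered by its smallest variable j + 1. It differs from `∑-neg-part` only in
  -- the range of the inner sums: K - (j + 1) here, a length independent of j there.
  nested₃-shifted : ∀ a b c K →
    nested (c ∷ b ∷ a ∷ []) K ≡ ∑ K (λ j → recip j a * shifted b c j (K ∸ suc j))
  nested₃-shifted a b c K = begin
    nested (c ∷ b ∷ a ∷ []) K
      ≡⟨ nested≡∑ c (b ∷ a ∷ []) K ⟩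
    ∑ K (λ m → recip m c * nested (b ∷ a ∷ []) m)
      ≡⟨ ∑-cong K (λ m → cong (recip m c *_) (inner m)) ⟩
    ∑ K (λ m → recip m c * ∑ m (λ j → recip j a * S j (m ∸ suc j)))
      ≡⟨ ∑-cong K (λ m → trans (sym (∑-*ˡ m (recip m c) (λ j → recip j a * S j (m ∸ suc j))))
           (∑-cong< m (λ j j<m → trans
             (cong (λ l → recip l c * (recip j a * S j (m ∸ suc j))) (sym (ℕₚ.m∸n+n≡m j<m)))
             (solve 3 (λ p q r → p :* (q :* r) := q :* (p :* r)) refl
               (recip (m ∸ suc j ℕ.+ suc j) c) (recip j a) (S j (m ∸ suc j)))))) ⟩
    ∑ K (λ m → ∑ m (λ j → H j (m ∸ suc j)))
      ≡⟨ ∑-triangle K H ⟩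
    ∑ K (λ j → ∑ (K ∸ suc j) (H j))
      ≡⟨ ∑-cong K (λ j → ∑-*ˡ (K ∸ suc j) (recip j a) (λ l → recip (l ℕ.+ suc j) c * S j l)) ⟩
    ∑ K (λ j → recip j a * shifted b c j (K ∸ suc j)) ∎
    where
    open ≡-Reasoning
    S : ℕ → ℕ → ℚ
    S j l = ∑ l (λ x → recip (x ℕ.+ suc j) b)
    H : ℕ → ℕ → ℚ
    H j l = recip j a * (recip (l ℕ.+ suc j) c * S j l)
    inner : ∀ m → nested (b ∷ a ∷ []) m ≡ ∑ m (λ j → recip j a * S j (m ∸ suc j))
    inner m = begin
      nested (b ∷ a ∷ []) m
        ≡⟨ nested₂ b a m ⟩
      ∑ m (λ x → recip x b * ∑ x (λ j → recip j a))
        ≡⟨ ∑-cong m (λ x → trans (sym (∑-*ˡ x (recip x b) (λ j → recip j a)))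
             (∑-cong< x (λ j j<x → trans (*-comm (recip x b) (recip j a))
               (cong (λ l → recip j a * recip l b) (sym (ℕₚ.m∸n+n≡m j<x)))))) ⟩
      ∑ m (λ x → ∑ x (λ j → recip j a * recip (x ∸ suc j ℕ.+ suc j) b))
        ≡⟨ ∑-triangle m (λ j l → recip j a * recip (l ℕ.+ suc j) b) ⟩
      ∑ m (λ j → ∑ (m ∸ suc j) (λ l → recip j a * recip (l ℕ.+ suc j) b))
        ≡⟨ ∑-cong m (λ j → ∑-*ˡ (m ∸ suc j) (recip j a) (λ l → recip (l ℕ.+ suc j) b)) ⟩
      ∑ m (λ j → recip j a * S j (m ∸ suc j)) ∎

  ∑-pos-part : ∀ a b c N →
    ∑ N (λ m → ∑ m (λ x → pos-part a b c x m)) ≡ ∑ N (λ k → recip k a * nested (c ∷ b ∷ []) (N ∸ suc k))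
  ∑-pos-part a b c N = begin
    ∑ N (λ m → ∑ m (λ x → ∑ x (λ k → recip k a * (recip (x ∸ suc k) b * recip (m ∸ suc k) c))))
      ≡⟨ ∑-cong N (λ m → ∑-triangle m (λ k l → recip k a * (recip l b * recip (m ∸ suc k) c))) ⟩
    ∑ N (λ m → ∑ m (λ k → ∑ (m ∸ suc k) (λ l → recip k a * (recip l b * recip (m ∸ suc k) c))))
      ≡⟨ ∑-cong N (λ m → ∑-cong m (λ k → trans
           (∑-*ˡ (m ∸ suc k) (recip k a) (λ l → recip l b * recip (m ∸ suc k) c))
           (cong (recip k a *_) (trans (∑-*ʳ (m ∸ suc k) (recip (m ∸ suc k) c) (λ l → recip l b))
             (*-comm (∑ (m ∸ suc k) (λ l → recip l b)) (recip (m ∸ suc k) c)))))) ⟩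
    ∑ N (λ m → ∑ m (λ k → recip k a * (recip (m ∸ suc k) c * ∑ (m ∸ suc k) (λ l → recip l b))))
      ≡⟨ ∑-triangle N (λ k n → recip k a * (recip n c * ∑ n (λ l → recip l b))) ⟩
    ∑ N (λ k → ∑ (N ∸ suc k) (λ n → recip k a * (recip n c * ∑ n (λ l → recip l b))))
      ≡⟨ ∑-cong N (λ k → trans
           (∑-*ˡ (N ∸ suc k) (recip k a) (λ n → recip n c * ∑ n (λ l → recip l b)))
           (cong (recip k a *_) (sym (nested₂ c b (N ∸ suc k))))) ⟩
    ∑ N (λ k → recip k a * nested (c ∷ b ∷ []) (N ∸ suc k)) ∎
    where open ≡-Reasoning

  -- Stuffle relations for truncated sums

  stuffle₂ : ∀ a b N → nested (a ∷ []) N * nested (b ∷ []) N ≡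
             nested (b ∷ a ∷ []) N + nested (a ∷ b ∷ []) N + nested (a ℕ.+ b ∷ []) N
  stuffle₂ a b zero    = refl
  stuffle₂ a b (suc N) = begin
    (A + p * 1ℚ) * (B + q * 1ℚ)
      ≡⟨ solve 4 (λ A B p q → (A :+ p :* con 1ℚ) :* (B :+ q :* con 1ℚ) :=
                   A :* B :+ q :* A :+ p :* B :+ p :* q :* con 1ℚ) refl A B p q ⟩
    A * B + q * A + p * B + p * q * 1ℚ
      ≡⟨ cong₂ (λ u v → u + q * A + p * B + v * 1ℚ) (stuffle₂ a b N) (sym (recip-+ N a b)) ⟩
    (X + Y + Z) + q * A + p * B + r * 1ℚ
      ≡⟨ solve 6 (λ X Y Z u v w → X :+ Y :+ Z :+ u :+ v :+ w := (X :+ u) :+ (Y :+ v) :+ (Z :+ w)) refl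
           X Y Z (q * A) (p * B) (r * 1ℚ) ⟩
    (X + q * A) + (Y + p * B) + (Z + r * 1ℚ) ∎
    where
    open ≡-Reasoning
    A = nested (a ∷ []) N
    B = nested (b ∷ []) N
    X = nested (b ∷ a ∷ []) N
    Y = nested (a ∷ b ∷ []) N
    Z = nested (a ℕ.+ b ∷ []) N
    p = recip N a
    q = recip N b
    r = recip N (a ℕ.+ b)

  -- Passing from N to N + 1 adds the terms in which a largest variable equals N + 1: that of the
  -- second factor, which leaves a `stuffle₂` product, that of the first, or both at once.
  stuffle₃ : ∀ a b c N → nested (a ∷ []) N * nested (c ∷ b ∷ []) N ≡
             nested (c ∷ b ∷ a ∷ []) N + nested (c ∷ a ∷ b ∷ []) N + nested (a ∷ c ∷ b ∷ []) N
             + nested (c ∷ a ℕ.+ b ∷ []) N + nested (a ℕ.+ c ∷ b ∷ []) N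
  stuffle₃ a b c zero    = refl
  stuffle₃ a b c (suc N) = begin
    (A + p * 1ℚ) * (D + q * B)
      ≡⟨ solve 5 (λ A B D p q → (A :+ p :* con 1ℚ) :* (D :+ q :* B) :=
                   A :* D :+ q :* (A :* B) :+ p :* D :+ p :* q :* B) refl A B D p q ⟩
    A * D + q * (A * B) + p * D + p * q * B
      ≡⟨ cong₂ (λ u v → u + q * v + p * D + p * q * B) (stuffle₃ a b c N) (stuffle₂ a b N) ⟩
    (X + Y + Z + U + V) + q * (x + y + u) + p * D + p * q * B
      ≡⟨ cong (λ v → (X + Y + Z + U + V) + q * (x + y + u) + p * D + v * B) (sym (recip-+ N a c)) ⟩
    (X + Y + Z + U + V) + q * (x + y + u) + p * D + r * B
      ≡⟨ cong (λ w → (X + Y + Z + U + V) + w + p * D + r * B)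
           (solve 4 (λ q x y u → q :* (x :+ y :+ u) := q :* x :+ q :* y :+ q :* u) refl q x y u) ⟩
    (X + Y + Z + U + V) + (q * x + q * y + q * u) + p * D + r * B
      ≡⟨ solve 10 (λ X Y Z U V f g h i j → (X :+ Y :+ Z :+ U :+ V) :+ (f :+ g :+ h) :+ i :+ j :=
                    (X :+ f) :+ (Y :+ g) :+ (Z :+ i) :+ (U :+ h) :+ (V :+ j)) refl
           X Y Z U V (q * x) (q * y) (q * u) (p * D) (r * B) ⟩
    (X + q * x) + (Y + q * y) + (Z + p * D) + (U + q * u) + (V + r * B) ∎
    where
    open ≡-Reasoning
    A = nested (a ∷ []) N
    B = nested (b ∷ []) N
    D = nested (c ∷ b ∷ []) N
    X = nested (c ∷ b ∷ a ∷ []) N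
    Y = nested (c ∷ a ∷ b ∷ []) N
    Z = nested (a ∷ c ∷ b ∷ []) N
    U = nested (c ∷ a ℕ.+ b ∷ []) N
    V = nested (a ℕ.+ c ∷ b ∷ []) N
    x = nested (b ∷ a ∷ []) N
    y = nested (a ∷ b ∷ []) N
    u = nested (a ℕ.+ b ∷ []) N
    p = recip N a
    q = recip N c
    r = recip N (a ℕ.+ c)

  -- Null sequences

  -- Abstracting from the meaning of "large" lets one calculus of null sequences serve both the
  -- limit in N and the iterated limit in M and N.
  record Filter (I : Set) : Set₁ where
    field
      Large : (I → Set) → Set
      all   : ∀ {P} → (∀ i → P i) → Large P
      mono  : ∀ {P Q} → (∀ i → P i → Q i) → Large P → Large Q
      _∩_   : ∀ {P Q} → Large P → Large Q → Large (λ i → P i × Q i)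

  open Filter using (Large)

  eventually : Filter ℕ
  eventually = record
    { Large = λ P → ∃ λ N → ∀ n → N ℕ.≤ n → P n
    ; all   = λ p → 0 , λ n _ → p n
    ; mono  = λ { f (N , p) → N , λ n N≤n → f n (p n N≤n) }
    ; _∩_   = λ { (M , p) (N , q) → M ⊔ N , λ n M⊔N≤n →
                  p n (ℕₚ.m⊔n≤o⇒m≤o M N M⊔N≤n) , q n (ℕₚ.m⊔n≤o⇒n≤o M N M⊔N≤n) }
    }

  -- The iterated product of filters: how large the second index must be may depend on the first.
  _⋉_ : ∀ {I J} → Filter I → Filter J → Filter (I × J)
  F ⋉ G = record
    { Large = λ P → F.Large (λ i → G.Large (λ j → P (i , j)))
    ; all   = λ p → F.all (λ i → G.all (λ j → p (i , j)))
    ; mono  = λ f → F.mono (λ i → G.mono (λ j → f (i , j)))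
    ; _∩_   = λ p q → F.mono (λ { i (u , v) → u G.∩ v }) (p F.∩ q)
    }
    where
    module F = Filter F
    module G = Filter G

  -- First let the second index tend to infinity, then the first.
  eventually² : Filter (ℕ × ℕ)
  eventually² = eventually ⋉ eventually

  module _ {I : Set} (F : Filter I) where
    private module F = Filter F

    Null Bounded : (I → ℚ) → Set
    Null x    = ∀ ε → 0ℚ < ε → F.Large (λ i → ∣ x i ∣ < ε)
    Bounded x = ∃ λ B → 0ℚ < B × F.Large (λ i → ∣ x i ∣ ≤ B)

    null-cong : ∀ {x y} → (∀ i → x i ≡ y i) → Null x → Null y
    null-cong x≡y nx ε 0<ε = F.mono (λ i → subst (λ p → ∣ p ∣ < ε) (x≡y i)) (nx ε 0<ε)

    null-≤ : ∀ {x y} → F.Large (λ i → ∣ x i ∣ ≤ ∣ y i ∣) → Null y → Null x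
    null-≤ x≤y ny ε 0<ε = F.mono (λ { i (p , q) → ≤-<-trans p q }) (x≤y F.∩ ny ε 0<ε)

    null-0 : Null (λ _ → 0ℚ)
    null-0 ε 0<ε = F.all (λ _ → 0<ε)

    null-+ : ∀ {x y} → Null x → Null y → Null (λ i → x i + y i)
    null-+ {x} {y} nx ny ε 0<ε = F.mono
      (λ { i (p , q) → ≤-<-trans (∣p+q∣≤∣p∣+∣q∣ (x i) (y i)) (subst (∣ x i ∣ + ∣ y i ∣ <_) (½+½ ε) (+-mono-< p q)) })
      (nx (½ * ε) (½*-pos 0<ε) F.∩ ny (½ * ε) (½*-pos 0<ε))

    bounded-const : ∀ c → Bounded (λ _ → c)
    bounded-const c = 1ℚ + ∣ c ∣ , <-≤-trans (positive⁻¹ 1ℚ) (p≤p+q 1ℚ (nonNegative⁻¹ ∣ c ∣ {{∣-∣-nonNeg c}})) ,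
      F.all (λ _ → subst (_≤ 1ℚ + ∣ c ∣) (+-identityˡ ∣ c ∣) (+-monoˡ-≤ ∣ c ∣ (nonNegative⁻¹ 1ℚ)))

    bounded-+ : ∀ {x y} → Bounded x → Bounded y → Bounded (λ i → x i + y i)
    bounded-+ {x} {y} (B , 0<B , p) (K , 0<K , q) = B + K , +-mono-< 0<B 0<K ,
      F.mono (λ { i (u , v) → ≤-trans (∣p+q∣≤∣p∣+∣q∣ (x i) (y i)) (+-mono-≤ u v) }) (p F.∩ q)

    bounded-* : ∀ {x y} → Bounded x → Bounded y → Bounded (λ i → x i * y i)
    bounded-* {x} {y} (B , 0<B , p) (K , 0<K , q) =
      B * K , positive⁻¹ (B * K) {{pos*pos⇒pos B {{positive 0<B}} K {{positive 0<K}}}} ,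
      F.mono (λ { i (u , v) → subst (_≤ B * K) (sym (∣p*q∣≡∣p∣*∣q∣ (x i) (y i)))
                                (*-mono-≤ (nonNegative⁻¹ ∣ y i ∣ {{∣-∣-nonNeg (y i)}}) (<⇒≤ 0<B) u v) }) (p F.∩ q)

    bounded-∑ : ∀ n (x : ℕ → I → ℚ) → (∀ k → Bounded (x k)) → Bounded (λ i → ∑ n (λ k → x k i))
    bounded-∑ zero    x bx = bounded-const 0ℚ
    bounded-∑ (suc n) x bx = bounded-+ (bounded-∑ n x bx) (bx n)

    null-* : ∀ {x y} → Null x → Bounded y → Null (λ i → x i * y i)
    null-* {x} {y} nx (B , 0<B , p) ε 0<ε = F.mono bound (p F.∩ nx (1/B * ε) 0<1/B*ε)
      where
      instance
        _ = positive 0<B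
        _ = positive 0<ε
        _ = pos⇒nonZero B
      1/B = 1/ B
      0<1/B*ε : 0ℚ < 1/B * ε
      0<1/B*ε = positive⁻¹ (1/B * ε) {{pos*pos⇒pos 1/B {{1/pos⇒pos B}} ε}}
      bound : ∀ i → ∣ y i ∣ ≤ B × ∣ x i ∣ < 1/B * ε → ∣ x i * y i ∣ < ε
      bound i (u , v) = begin-strict
        ∣ x i * y i ∣       ≡⟨ ∣p*q∣≡∣p∣*∣q∣ (x i) (y i) ⟩
        ∣ x i ∣ * ∣ y i ∣   ≤⟨ *-monoˡ-≤-nonNeg ∣ x i ∣ {{∣-∣-nonNeg (x i)}} u ⟩
        ∣ x i ∣ * B         <⟨ *-monoˡ-<-pos B v ⟩
        1/B * ε * B         ≡⟨ solve 3 (λ r e b → r :* e :* b := r :* b :* e) refl 1/B ε B ⟩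
        1/B * B * ε         ≡⟨ cong (_* ε) (*-inverseˡ B) ⟩
        1ℚ * ε              ≡⟨ *-identityˡ ε ⟩
        ε                   ∎
        where open ≤-Reasoning

    null-*ˡ : ∀ c {x} → Null x → Null (λ i → c * x i)
    null-*ˡ c {x} nx = null-cong (λ i → *-comm (x i) c) (null-* nx (bounded-const c))

    null-neg : ∀ {x} → Null x → Null (λ i → - x i)
    null-neg {x} nx ε 0<ε = F.mono (λ i → subst (_< ε) (sym (∣-p∣≡∣p∣ (x i)))) (nx ε 0<ε)

    null-∑ : ∀ n (x : ℕ → I → ℚ) → (∀ k → Null (x k)) → Null (λ i → ∑ n (λ k → x k i))
    null-∑ zero    x nx = null-0
    null-∑ (suc n) x nx = null-+ (null-∑ n x nx) (nx n)

    null-conv : ∀ (f g : I → ℕ → ℚ) → (∀ k → Null (λ i → f i k)) → (∀ k → Bounded (λ i → g i k)) →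
                ∀ n → Null (λ i → conv (f i) (g i) n)
    null-conv f g nf bg zero    = null-* (nf 0) (bg 0)
    null-conv f g nf bg (suc n) =
      null-+ (null-* (nf 0) (bg (suc n))) (null-conv (λ i → f i ∘ suc) g (nf ∘ suc) bg n)

  null-fst : ∀ {x} → Null eventually x → Null eventually² (λ { (N , _) → x N })
  null-fst nx ε 0<ε = proj₁ (nx ε 0<ε) , λ N N₀≤N → 0 , λ _ _ → proj₂ (nx ε 0<ε) N N₀≤N

  -- No uniformity in N is asked for, which is the benefit of the iterated limit.
  null-snd : ∀ {x : ℕ × ℕ → ℚ} → (∀ N → Null eventually (λ M → x (N , M))) → Null eventually² x
  null-snd nx ε 0<ε = 0 , λ N _ → nx N ε 0<ε

  bounded-fst : ∀ {x} → Cauchy x → Bounded eventually² (λ { (N , _) → x N })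
  bounded-fst {x} cx = proj₁ b , proj₁ (proj₂ b) , proj₁ (proj₂ (proj₂ b)) ,
      λ N N₀≤N → 0 , λ _ _ → proj₂ (proj₂ (proj₂ b)) N N₀≤N
    where b = eventually-bounded x cx

  null-cauchy : ∀ {x} → Cauchy x → Null eventually² (λ { (N , M) → x M - x N })
  null-cauchy cx ε 0<ε = N₀ , λ N N₀≤N → N₀ , λ M N₀≤M → proj₂ (cx ε 0<ε) M N N₀≤M N₀≤N
    where N₀ = proj₁ (cx ε 0<ε)

  inv-null : Null eventually inv
  inv-null ε 0<ε = N , λ n N≤n → begin-strict
      ∣ inv n ∣                        ≡⟨ 0≤p⇒∣p∣≡p (inv-nonneg n) ⟩
      inv n                            ≡⟨ sym (*-identityʳ (inv n)) ⟩
      inv n * 1ℚ                       ≤⟨ *-monoˡ-≤-nonNeg (inv n) {{nonNegative (inv-nonneg n)}}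
                                            (≤-trans (proj₂ A) (*-monoˡ-≤-nonNeg δ₀ {{pos⇒nonNeg δ₀ {{positive 0<δ₀}}}}
                                              (fromℕ-mono (ℕₚ.m≤n⇒m≤1+n N≤n)))) ⟩
      inv n * (δ₀ * fromℕ (suc n))     ≡⟨ solve 3 (λ v d x → v :* (d :* x) := d :* (v :* x)) refl (inv n) δ₀ (fromℕ (suc n)) ⟩
      δ₀ * (inv n * fromℕ (suc n))     ≡⟨ cong (δ₀ *_) (1/-inverse n) ⟩
      δ₀ * 1ℚ                          ≡⟨ solve 1 (λ d → d :* con 1ℚ := d :+ con 0ℚ) refl δ₀ ⟩
      δ₀ + 0ℚ                          <⟨ +-mono-≤-< (≤-refl {δ₀}) 0<δ₀ ⟩
      δ₀ + δ₀                          ≡⟨ ½+½ ε ⟩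
      ε                                ∎
    where
    open ≤-Reasoning
    δ₀ = ½ * ε
    0<δ₀ = ½*-pos 0<ε
    A = archimedean 1ℚ δ₀ 0<δ₀
    N = proj₁ A

  null-shift : ∀ {x} → Null eventually x → ∀ s → Null eventually (λ n → x (s ℕ.+ n))
  null-shift nx s ε 0<ε =
    proj₁ (nx ε 0<ε) , λ n N≤n → proj₂ (nx ε 0<ε) (s ℕ.+ n) (ℕₚ.≤-trans N≤n (ℕₚ.m≤n+m n s))

  recip-null : ∀ s → Null eventually (λ k → recip k (suc s))
  recip-null s = null-≤ eventually (0 , λ k _ → subst₂ _≤_
    (sym (0≤p⇒∣p∣≡p (recip-nonneg k (suc s)))) (sym (0≤p⇒∣p∣≡p (inv-nonneg k))) (recip≤inv k s)) inv-null

  -- A fixed shift of the truncation adds a fixed number of terms, each tending to 0. Convergence of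
  -- the series is not assumed, so the harmonic case u = 0 is covered.
  nested-shift-null : ∀ u s → Null eventually (λ M → nested (suc u ∷ []) (s ℕ.+ M) - nested (suc u ∷ []) M)
  nested-shift-null u zero    = null-cong eventually (λ M → sym (+-inverseʳ (nested (suc u ∷ []) M))) (null-0 eventually)
  nested-shift-null u (suc s) = null-cong eventually
    (λ M → solve 3 (λ p q r → (p :- q) :+ r := (p :+ r :* con 1ℚ) :- q) refl
       (nested (suc u ∷ []) (s ℕ.+ M)) (nested (suc u ∷ []) M) (recip (s ℕ.+ M) (suc u)))
    (null-+ eventually (nested-shift-null u s) (null-shift (recip-null u) s))

  -- The truncated value of 2 ζ(i) at even i, and 0 at odd i.
  Z : ℕ → ℕ → ℚ
  Z N zero    = - 1ℚ
  Z N (suc u) = (1ℚ + sgn (suc u)) * nested (suc u ∷ []) N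

  ΣE-zero : ∀ m n → ΣE m (suc n) 0 ≡ - 1ℚ
  ΣE-zero m n = trans
    (cong₂ _+_ (∑-zero m) (trans (∑-head n (λ k → E (+ k) 0)) (cong (λ r → - 1ℚ + r) (∑-zero n))))
    refl

  ΣE-suc : ∀ m n u → ΣE m (suc n) (suc u) ≡ sgn (suc u) * nested (suc u ∷ []) m + nested (suc u ∷ []) n
  ΣE-suc m n u = cong₂ _+_
    (trans (∑-cong m (λ j → trans (^-neg (inv j) (suc u)) (cong (sgn (suc u) *_) (sym (recip≡^ j (suc u))))))
      (trans (∑-*ˡ m (sgn (suc u)) (λ j → recip j (suc u))) (cong (sgn (suc u) *_) (sym (nested₁ (suc u) m)))))
    (trans (∑-head n (λ k → E (+ k) (suc u)))
      (trans (cong₂ _+_ (*-zeroˡ (0ℚ ^ u)) (trans (∑-cong n (λ k → sym (recip≡^ k (suc u)))) (sym (nested₁ (suc u) n))))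
        (+-identityˡ (nested (suc u ∷ []) n))))

  -- The two halves are compared with the same truncation M, so only bounded shifts have to vanish.
  -- For i = 1 the divergent harmonic sums then cancel.
  ΣE-null : ∀ s t i → Null eventually (λ M → ΣE (s ℕ.+ M) (suc (t ℕ.+ M)) i - Z M i)
  ΣE-null s t zero = null-cong eventually
    (λ M → sym (trans (cong (_+ 1ℚ) (ΣE-zero (s ℕ.+ M) (t ℕ.+ M))) (+-inverseˡ 1ℚ))) (null-0 eventually)
  ΣE-null s t (suc u) = null-cong eventually
    (λ M → trans
      (solve 4 (λ g p q r → g :* (p :- r) :+ (q :- r) := (g :* p :+ q) :- (con 1ℚ :+ g) :* r) refl
        (sgn (suc u)) (nested (suc u ∷ []) (s ℕ.+ M)) (nested (suc u ∷ []) (t ℕ.+ M)) (nested (suc u ∷ []) M))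
      (cong (_- Z M (suc u)) (sym (ΣE-suc (s ℕ.+ M) (t ℕ.+ M) u))))
    (null-+ eventually (null-*ˡ eventually (sgn (suc u)) (nested-shift-null u s)) (nested-shift-null u t))

  Z-one : ∀ N → Z N 1 ≡ 0ℚ
  Z-one N = *-zeroˡ (nested (1 ∷ []) N)

  -- The case i = 1 is apart: the harmonic sum is not Cauchy, but its factor 1 + (-1) is 0.
  Z-null : ∀ i → Null eventually² (λ { (N , M) → Z M i - Z N i })
  Z-null zero          = null-0 eventually²
  Z-null (suc zero)    = null-cong eventually² (λ { (N , M) → sym (cong₂ _-_ (Z-one M) (Z-one N)) }) (null-0 eventually²)
  Z-null (suc (suc u)) = null-cong eventually²
    (λ { (N , M) → solve 3 (λ g p q → g :* (p :- q) := g :* p :- g :* q) refl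
           (1ℚ + sgn (suc (suc u))) (nested (suc (suc u) ∷ []) M) (nested (suc (suc u) ∷ []) N) })
    (null-*ˡ eventually² (1ℚ + sgn (suc (suc u))) (null-cauchy {nested (suc (suc u) ∷ [])} (nested-cauchy u [])))

  -- Squeeze estimates for sums of nonnegative terms

  ∑-mono : ∀ n {f g} → (∀ i → i ℕ.< n → f i ≤ g i) → ∑ n f ≤ ∑ n g
  ∑-mono zero    f≤g = ≤-refl
  ∑-mono (suc n) f≤g = +-mono-≤ (∑-mono n (λ i i<n → f≤g i (ℕₚ.m<n⇒m<1+n i<n))) (f≤g n ℕₚ.≤-refl)

  ∑-nonneg : ∀ n {f} → (∀ i → 0ℚ ≤ f i) → 0ℚ ≤ ∑ n f
  ∑-nonneg zero    0≤f = ≤-refl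
  ∑-nonneg (suc n) 0≤f = +-nonneg (∑-nonneg n 0≤f) (0≤f n)

  ∑-extend : ∀ {m n} → m ℕ.≤ n → ∀ {f} → (∀ i → 0ℚ ≤ f i) → ∑ m f ≤ ∑ n f
  ∑-extend {m} {n} m≤n {f} 0≤f = subst (λ l → ∑ m f ≤ ∑ l f) (ℕₚ.m+[n∸m]≡n m≤n)
    (subst (∑ m f ≤_) (sym (∑-split m (n ∸ m) f))
      (p≤p+q (∑ m f) (∑-nonneg (n ∸ m) (λ i → 0≤f (m ℕ.+ i)))))

  p≤q⇒0≤q-p : ∀ {p q} → p ≤ q → 0ℚ ≤ q - p
  p≤q⇒0≤q-p {p} {q} p≤q = subst (_≤ q - p) (+-inverseʳ p) (+-monoˡ-≤ (- p) p≤q)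

  ∣-∣-sandwich : ∀ {p q r} → p ≤ q → q ≤ r → ∣ q - p ∣ ≤ ∣ r - p ∣
  ∣-∣-sandwich {p} {q} {r} p≤q q≤r = subst₂ _≤_
    (sym (0≤p⇒∣p∣≡p (p≤q⇒0≤q-p p≤q))) (sym (0≤p⇒∣p∣≡p (p≤q⇒0≤q-p (≤-trans p≤q q≤r)))) (+-monoˡ-≤ (- p) q≤r)

  shifted-nonneg-term : ∀ b c j m → 0ℚ ≤ recip (m ℕ.+ suc j) c * ∑ m (λ x → recip (x ℕ.+ suc j) b)
  shifted-nonneg-term b c j m =
    *-nonneg (recip-nonneg (m ℕ.+ suc j) c) (∑-nonneg m (λ x → recip-nonneg (x ℕ.+ suc j) b))

  weighted-shifted-mono : ∀ a b c j {m n} → m ℕ.≤ n → recip j a * shifted b c j m ≤ recip j a * shifted b c j n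
  weighted-shifted-mono a b c j m≤n =
    *-monoˡ-≤-nonNeg (recip j a) {{nonNegative (recip-nonneg j a)}} (∑-extend m≤n (shifted-nonneg-term b c j))

  weighted-shifted-nonneg : ∀ a b c j n → 0ℚ ≤ recip j a * shifted b c j n
  weighted-shifted-nonneg a b c j n = *-nonneg (recip-nonneg j a) (∑-nonneg n (shifted-nonneg-term b c j))

  -- All terms are nonnegative, so the sum lies between the triple sums truncated at N and at N + M;
  -- the Cauchy property closes the gap.
  neg-part-null : ∀ {a b c} → Cauchy (nested (c ∷ b ∷ a ∷ [])) → Null eventually²
    (λ { (N , M) → ∑ N (λ m → ∑ m (λ x → neg-part a b c M x m)) - nested (c ∷ b ∷ a ∷ []) N })
  neg-part-null {a} {b} {c} cauchy = null-≤ eventually²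
    -- The lower bound needs N ≤ M, which is harmless because M tends to infinity first.
    (0 , λ N _ → N , λ M N≤M → subst (λ p → ∣ p - t N ∣ ≤ ∣ t (N ℕ.+ M) - t N ∣) (sym (∑-neg-part a b c M N))
      (∣-∣-sandwich (lower N M N≤M) (upper N M)))
    bound
    where
    t = nested (c ∷ b ∷ a ∷ [])
    P : ℕ → ℕ → ℚ
    P N M = ∑ M (λ j → recip j a * shifted b c j N)
    lower : ∀ N M → N ℕ.≤ M → t N ≤ P N M
    lower N M N≤M = subst (_≤ P N M) (sym (nested₃-shifted a b c N)) (≤-trans
      (∑-mono N (λ j _ → weighted-shifted-mono a b c j (ℕₚ.m∸n≤m N (suc j))))
      (∑-extend N≤M (λ j → weighted-shifted-nonneg a b c j N)))
    upper : ∀ N M → P N M ≤ t (N ℕ.+ M)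
    upper N M = subst (P N M ≤_) (sym (nested₃-shifted a b c (N ℕ.+ M))) (≤-trans
      (∑-mono M (λ j j<M → weighted-shifted-mono a b c j
        (subst (N ℕ.≤_) (sym (ℕₚ.+-∸-assoc N j<M)) (ℕₚ.m≤m+n N (M ∸ suc j)))))
      (∑-extend (ℕₚ.m≤n+m M N) (λ j → weighted-shifted-nonneg a b c j (N ℕ.+ M ∸ suc j))))
    bound : Null eventually² (λ { (N , M) → t (N ℕ.+ M) - t N })
    bound ε 0<ε = proj₁ (cauchy ε 0<ε) , λ N N₀≤N → 0 , λ M _ →
      proj₂ (cauchy ε 0<ε) (N ℕ.+ M) N (ℕₚ.≤-trans N₀≤N (ℕₚ.m≤m+n N M)) N₀≤N

  -- By monotonicity the triangular sum lies between the products of truncations at m and at N as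
  -- soon as N ≥ 2m, and these products form a Cauchy sequence.
  cauchy-product : ∀ {a s ss} → Cauchy (nested (a ∷ [])) → Cauchy (nested (s ∷ ss)) → Null eventually
    (λ N → ∑ N (λ k → recip k a * nested (s ∷ ss) (N ∸ suc k)) - nested (a ∷ []) N * nested (s ∷ ss) N)
  cauchy-product {a} {s} {ss} cX ch ε 0<ε = m ℕ.+ m , λ N m+m≤N → begin-strict
      ∣ P N - XH N ∣        ≡⟨ ∣p-q∣≡∣q-p∣ (P N) (XH N) ⟩
      ∣ XH N - P N ∣        ≡⟨ 0≤p⇒∣p∣≡p (p≤q⇒0≤q-p (upper N)) ⟩
      XH N - P N            ≤⟨ +-monoʳ-≤ (XH N) (neg-antimono-≤ (lower N m+m≤N)) ⟩
      XH N - XH m           ≡⟨ sym (0≤p⇒∣p∣≡p (p≤q⇒0≤q-p (≤-trans (lower N m+m≤N) (upper N)))) ⟩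
      ∣ XH N - XH m ∣       <⟨ proj₂ K N m (ℕₚ.≤-trans (ℕₚ.m≤m+n m m) m+m≤N) ℕₚ.≤-refl ⟩
      ε                     ∎
    where
    open ≤-Reasoning
    X = nested (a ∷ [])
    h = nested (s ∷ ss)
    XH : ℕ → ℚ
    XH N = X N * h N
    K = *-cauchy X h cX ch ε 0<ε
    m = proj₁ K
    P : ℕ → ℚ
    P N = ∑ N (λ k → recip k a * h (N ∸ suc k))
    XH≡ : ∀ n → XH n ≡ ∑ n (λ k → recip k a * h n)
    XH≡ n = trans (cong (_* h n) (nested₁ a n)) (sym (∑-*ʳ n (h n) (λ k → recip k a)))
    step : ∀ k {i j} → i ℕ.≤ j → recip k a * h i ≤ recip k a * h j
    step k i≤j = *-monoˡ-≤-nonNeg (recip k a) {{nonNegative (recip-nonneg k a)}} (nested-mono′ s ss (ℕₚ.≤⇒≤′ i≤j))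
    upper : ∀ N → P N ≤ XH N
    upper N = subst (P N ≤_) (sym (XH≡ N)) (∑-mono N (λ k _ → step k (ℕₚ.m∸n≤m N (suc k))))
    lower : ∀ N → m ℕ.+ m ℕ.≤ N → XH m ≤ P N
    lower N m+m≤N = subst (_≤ P N) (sym (XH≡ m)) (≤-trans
      -- For k < m and N ≥ 2m the remaining length N - (k + 1) is at least m.
      (∑-mono m (λ k k<m → step k (ℕₚ.≤-trans (ℕₚ.≤-reflexive (sym (ℕₚ.m+n∸n≡m m m)))
        (ℕₚ.∸-mono m+m≤N k<m))))
      (∑-extend (ℕₚ.≤-trans (ℕₚ.m≤m+n m m) m+m≤N)
        (λ k → *-nonneg (recip-nonneg k a) (nested-nonneg (s ∷ ss) (N ∸ suc k)))))

  -- Both evaluations of the truncated sum and their limits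

  cauchy₁ : ∀ {s} → 2 ℕ.≤ s → Cauchy (nested (s ∷ []))
  cauchy₁ (s≤s (s≤s {n = s} z≤n)) = nested-cauchy s []

  cauchy₂ : ∀ {s t} → 2 ℕ.≤ t → 1 ℕ.≤ s → Cauchy (nested (t ∷ s ∷ []))
  cauchy₂ (s≤s (s≤s {n = t} z≤n)) 1≤s = nested-cauchy t (1≤s ∷ [])

  cauchy₃ : ∀ {r s t} → 2 ℕ.≤ t → 1 ℕ.≤ s → 1 ℕ.≤ r → Cauchy (nested (t ∷ s ∷ r ∷ []))
  cauchy₃ (s≤s (s≤s {n = t} z≤n)) 1≤s 1≤r = nested-cauchy t (1≤s ∷ 1≤r ∷ [])

  terms parts : (a b c N M : ℕ) → ℚ
  terms a b c N M = ∑∑ N (λ x y → W M (suc x) (term a b c (+ suc x) (+ (suc x ℕ.+ suc y))))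
  parts a b c N M = ∑∑ N (λ x y → W M (suc (suc x ℕ.+ suc y ℕ.+ M)) (part a b c (+ suc x) (+ (suc x ℕ.+ suc y))))

  -- In `terms≡parts` the second summands belong to n₂ - n₁. Exchanging n₁ and n₂ - n₁ permutes the
  -- pairs n₁ < n₂ ≤ N, so after summation only a and c remain exchanged.
  ∑∑-terms≡parts : ∀ a b c N M →
    terms (suc a) (suc b) (suc c) N M + sgn (suc b) * terms (suc c) (suc b) (suc a) N M ≡
    parts (suc a) (suc b) (suc c) N M + sgn (suc b) * parts (suc c) (suc b) (suc a) N M
  ∑∑-terms≡parts a b c N M = begin
    ∑∑ N T + s * ∑∑ N T′
      ≡⟨ cong (λ r → ∑∑ N T + s * r) (trans (∑∑-swap N T′) (∑∑-cong N (λ x y → cong (T″ y) (n-comm y x)))) ⟩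
    ∑∑ N T + s * ∑∑ N (λ x y → T″ y (+ (suc x ℕ.+ suc y)))
      ≡⟨ combine T (λ x y → T″ y (+ (suc x ℕ.+ suc y))) ⟩
    ∑∑ N (λ x y → T x y + s * T″ y (+ (suc x ℕ.+ suc y)))
      ≡⟨ ∑∑-cong N (λ x y → terms≡parts a b c x y M) ⟩
    ∑∑ N (λ x y → U x y + s * U″ y (suc x ℕ.+ suc y))
      ≡⟨ sym (combine U (λ x y → U″ y (suc x ℕ.+ suc y))) ⟩
    ∑∑ N U + s * ∑∑ N (λ x y → U″ y (suc x ℕ.+ suc y))
      ≡⟨ cong (λ r → ∑∑ N U + s * r)
           (trans (∑∑-cong N (λ x y → cong (U″ y) (ℕₚ.+-comm (suc x) (suc y)))) (sym (∑∑-swap N U′))) ⟩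
    ∑∑ N U + s * ∑∑ N U′ ∎
    where
    open ≡-Reasoning
    s = sgn (suc b)
    T″ : ℕ → ℤ → ℚ
    T″ x n = W M (suc x) (term (suc c) (suc b) (suc a) (+ suc x) n)
    U″ : ℕ → ℕ → ℚ
    U″ x n = W M (suc (n ℕ.+ M)) (part (suc c) (suc b) (suc a) (+ suc x) (+ n))
    T T′ U U′ : ℕ → ℕ → ℚ
    T x y = W M (suc x) (term (suc a) (suc b) (suc c) (+ suc x) (+ (suc x ℕ.+ suc y)))
    T′ x y = T″ x (+ (suc x ℕ.+ suc y))
    U x y = W M (suc (suc x ℕ.+ suc y ℕ.+ M)) (part (suc a) (suc b) (suc c) (+ suc x) (+ (suc x ℕ.+ suc y)))
    U′ x y = U″ x (suc x ℕ.+ suc y)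
    n-comm : ∀ x y → + (suc x ℕ.+ suc y) ≡ + (suc y ℕ.+ suc x)
    n-comm x y = cong +_ (ℕₚ.+-comm (suc x) (suc y))
    combine : ∀ f g → ∑∑ N f + s * ∑∑ N g ≡ ∑∑ N (λ x y → f x y + s * g x y)
    combine f g = trans (cong (λ r → ∑∑ N f + r) (sym (∑∑-*ˡ N s g))) (sym (∑∑-+ N f (λ x y → s * g x y)))

  terms-split : ∀ a b c N M → terms (suc a) b c N M ≡
    sgn (suc a) * ∑ N (λ m → ∑ m (λ x → neg-part (suc a) b c M x m)) + ∑ N (λ m → ∑ m (λ x → pos-part (suc a) b c x m))
  terms-split a b c N M = begin
    terms (suc a) b c N M
      ≡⟨ ∑∑-cong N (λ x y → W-term a b c M x y) ⟩
    ∑∑ N (λ x y → sgn (suc a) * neg-part (suc a) b c M x (x ℕ.+ suc y) + pos-part (suc a) b c x (x ℕ.+ suc y))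
      ≡⟨ ∑∑-+ N (λ x y → sgn (suc a) * neg-part (suc a) b c M x (x ℕ.+ suc y)) (λ x y → pos-part (suc a) b c x (x ℕ.+ suc y)) ⟩
    ∑∑ N (λ x y → sgn (suc a) * neg-part (suc a) b c M x (x ℕ.+ suc y)) + ∑∑ N (λ x y → pos-part (suc a) b c x (x ℕ.+ suc y))
      ≡⟨ cong₂ _+_
           (trans (∑∑-*ˡ N (sgn (suc a)) (λ x y → neg-part (suc a) b c M x (x ℕ.+ suc y)))
                  (cong (sgn (suc a) *_) (∑∑-outer N (neg-part (suc a) b c M))))
           (∑∑-outer N (pos-part (suc a) b c)) ⟩
    sgn (suc a) * ∑ N (λ m → ∑ m (λ x → neg-part (suc a) b c M x m)) + ∑ N (λ m → ∑ m (λ x → pos-part (suc a) b c x m)) ∎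
    where open ≡-Reasoning

  terms-limit : (a b c N : ℕ) → ℚ
  terms-limit a b c N = sgn a * nested (c ∷ b ∷ a ∷ []) N + nested (a ∷ []) N * nested (c ∷ b ∷ []) N

  -- The part with k < 0 tends to the triple sum in the iterated limit; the part with k > 0 does not
  -- involve M and is a Cauchy product in N.
  terms-null : ∀ {a b c} → 2 ℕ.≤ a → 1 ℕ.≤ b → 2 ℕ.≤ c →
    Null eventually² (λ { (N , M) → terms a b c N M - terms-limit a b c N })
  terms-null {suc a} {b} {c} 2≤a 1≤b 2≤c = null-cong eventually²
    (λ { (N , M) → trans
      (solve 5 (λ s p q t r → s :* (p :- t) :+ (q :- r) := (s :* p :+ q) :- (s :* t :+ r)) refl
        (sgn (suc a)) (n⁻ N M) (∑ N (λ k → recip k (suc a) * nested (c ∷ b ∷ []) (N ∸ suc k)))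
        (nested (c ∷ b ∷ suc a ∷ []) N) (nested (suc a ∷ []) N * nested (c ∷ b ∷ []) N))
      (cong (_- terms-limit (suc a) b c N)
        (sym (trans (terms-split a b c N M)
          (cong (λ r → sgn (suc a) * n⁻ N M + r) (∑-pos-part (suc a) b c N))))) })
    (null-+ eventually²
      (null-*ˡ eventually² (sgn (suc a)) (neg-part-null (cauchy₃ 2≤c 1≤b (s≤s z≤n))))
      (null-fst {x = λ N → ∑ N (λ k → recip k (suc a) * nested (c ∷ b ∷ []) (N ∸ suc k)) - nested (suc a ∷ []) N * nested (c ∷ b ∷ []) N}
        (cauchy-product {suc a} {c} {b ∷ []} (cauchy₁ 2≤a) (cauchy₂ 2≤c 1≤b))))
    where
    n⁻ : ℕ → ℕ → ℚ
    n⁻ N M = ∑ N (λ m → ∑ m (λ x → neg-part (suc a) b c M x m))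

  -- The sums of `geo₁` and `geo₂` over n₁ < n₂ ≤ N, which are the inner sums of the theorem at r =
  -- a - 2ξ and β = b - 2ξ. The first two arguments are exponents lowered by one.
  D₁ D₂ : (n c N : ℕ) → ℕ → ℚ
  D₁ b c N r = ∑ (suc r) (λ ω → bin ω b * bin (r ∸ ω) c * nested (suc c ℕ.+ (r ∸ ω) ∷ suc b ℕ.+ ω ∷ []) N)
  D₂ a c N β = ∑ (suc a) (λ ω → bin β ω * bin (a ∸ ω) c * nested (suc c ℕ.+ (a ∸ ω) ∷ suc ω ℕ.+ β ∷ []) N)

  ∑∑-∑ : ∀ N n (f : ℕ → ℕ → ℕ → ℚ) → ∑∑ N (λ x y → ∑ n (f x y)) ≡ ∑ n (λ i → ∑∑ N (λ x y → f x y i))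
  ∑∑-∑ N n f = trans (∑-cong N (λ m → ∑-swap m n (λ x → f x (m ∸ suc x))))
                     (∑-swap N n (λ m i → ∑ m (λ x → f x (m ∸ suc x) i)))

  ∑∑-powers : ∀ p q s t N →
    ∑∑ N (λ x y → p * inv x ^ s * (q * inv (x ℕ.+ suc y) ^ t)) ≡ p * q * nested (t ∷ s ∷ []) N
  ∑∑-powers p q s t N = begin
    ∑∑ N (λ x y → p * inv x ^ s * (q * inv (x ℕ.+ suc y) ^ t))
      ≡⟨ ∑∑-cong N (λ x y → trans
           (cong₂ (λ u v → p * u * (q * v)) (sym (recip≡^ x s)) (sym (recip≡^ (x ℕ.+ suc y) t)))
           (solve 4 (λ p u q v → p :* u :* (q :* v) := p :* q :* (v :* u)) refl p (recip x s) q (recip (x ℕ.+ suc y) t))) ⟩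
    ∑∑ N (λ x y → p * q * (recip (x ℕ.+ suc y) t * recip x s))
      ≡⟨ ∑∑-*ˡ N (p * q) (λ x y → recip (x ℕ.+ suc y) t * recip x s) ⟩
    p * q * ∑∑ N (λ x y → recip (x ℕ.+ suc y) t * recip x s)
      ≡⟨ cong (p * q *_) (trans (∑∑-outer N (λ x m → recip m t * recip x s))
           (trans (∑-cong N (λ m → ∑-*ˡ m (recip m t) (λ x → recip x s))) (sym (nested₂ t s N)))) ⟩
    p * q * nested (t ∷ s ∷ []) N ∎
    where open ≡-Reasoning

  ∑∑-geo₁ : ∀ b c N r → ∑∑ N (λ x y → geo₁ (inv x) (inv (x ℕ.+ suc y)) (suc b) (suc c) r) ≡ D₁ b c N r
  ∑∑-geo₁ b c N r = trans
    (∑∑-cong N (λ x y → conv≡∑ (geo (inv x) (suc b)) (geo (inv (x ℕ.+ suc y)) (suc c)) r))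
    (trans (∑∑-∑ N (suc r) (λ x y ω → geo (inv x) (suc b) ω * geo (inv (x ℕ.+ suc y)) (suc c) (r ∸ ω)))
      (∑-cong (suc r) (λ ω → ∑∑-powers (bin ω b) (bin (r ∸ ω) c) (suc b ℕ.+ ω) (suc c ℕ.+ (r ∸ ω)) N)))

  ∑∑-geo₂ : ∀ a c N β → ∑∑ N (λ x y → geo₂ (inv x) (inv (x ℕ.+ suc y)) a (suc c) β) ≡ D₂ a c N β
  ∑∑-geo₂ a c N β = trans
    (∑∑-cong N (λ x y → conv≡∑ (λ ω → geo (inv x) (suc ω) β) (geo (inv (x ℕ.+ suc y)) (suc c)) a))
    (trans (∑∑-∑ N (suc a) (λ x y ω → geo (inv x) (suc ω) β * geo (inv (x ℕ.+ suc y)) (suc c) (a ∸ ω)))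
      (∑-cong (suc a) (λ ω → ∑∑-powers (bin β ω) (bin (a ∸ ω) c) (suc ω ℕ.+ β) (suc c ℕ.+ (a ∸ ω)) N)))

  D₁-bounded : ∀ b {c} → 1 ℕ.≤ c → ∀ r → Bounded eventually² (λ { (N , _) → D₁ b c N r })
  D₁-bounded b {c} 1≤c r = bounded-∑ eventually² (suc r)
    (λ { ω (N , _) → bin ω b * bin (r ∸ ω) c * nested (suc c ℕ.+ (r ∸ ω) ∷ suc b ℕ.+ ω ∷ []) N })
    (λ ω → bounded-* eventually² (bounded-const eventually² (bin ω b * bin (r ∸ ω) c))
      (bounded-fst (cauchy₂ {suc b ℕ.+ ω} (s≤s (ℕₚ.m≤n⇒m≤n+o (r ∸ ω) 1≤c)) (s≤s z≤n))))

  D₂-bounded : ∀ a {c} → 1 ℕ.≤ c → ∀ β → Bounded eventually² (λ { (N , _) → D₂ a c N β })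
  D₂-bounded a {c} 1≤c β = bounded-∑ eventually² (suc a)
    (λ { ω (N , _) → bin β ω * bin (a ∸ ω) c * nested (suc c ℕ.+ (a ∸ ω) ∷ suc ω ℕ.+ β ∷ []) N })
    (λ ω → bounded-* eventually² (bounded-const eventually² (bin β ω * bin (a ∸ ω) c))
      (bounded-fst (cauchy₂ {suc ω ℕ.+ β} (s≤s (ℕₚ.m≤n⇒m≤n+o (a ∸ ω) 1≤c)) (s≤s z≤n))))

  conv-∑∑ʳ : ∀ N f (g : ℕ → ℕ → ℕ → ℚ) n →
             conv f (λ i → ∑∑ N (λ x y → g x y i)) n ≡ ∑∑ N (λ x y → conv f (g x y) n)
  conv-∑∑ʳ N f g n = trans (conv-∑ʳ N f (λ m i → ∑ m (λ x → g x (m ∸ suc x) i)) n)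
    (∑-cong N (λ m → conv-∑ʳ m f (λ x → g x (m ∸ suc x)) n))

  conv-differenceˡ : ∀ f f′ g n → conv (λ i → f i - f′ i) g n ≡ conv f g n - conv f′ g n
  conv-differenceˡ f f′ g n = trans
    (solve 2 (λ p q → p := (p :+ q) :- q) refl (conv (λ i → f i - f′ i) g n) (conv f′ g n))
    (cong (_- conv f′ g n) (trans (sym (conv-+ˡ (λ i → f i - f′ i) f′ g n))
      (conv-cong n (λ i → solve 2 (λ p q → (p :- q) :+ q := p) refl (f i) (f′ i)) (λ _ → refl))))

  null-∑∑ : ∀ {I} (F : Filter I) N (f : ℕ → ℕ → I → ℚ) → (∀ x y → Null F (f x y)) → Null F (λ i → ∑∑ N (λ x y → f x y i))
  null-∑∑ F N f nf = null-∑ F N (λ m i → ∑ m (λ x → f x (m ∸ suc x) i))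
    (λ m → null-∑ F m (λ x → f x (m ∸ suc x)) (λ x → nf x (m ∸ suc x)))

  ∑∑-difference : ∀ N f g → ∑∑ N (λ x y → f x y - g x y) ≡ ∑∑ N f - ∑∑ N g
  ∑∑-difference N f g = trans
    (solve 2 (λ p q → p := (p :+ q) :- q) refl (∑∑ N (λ x y → f x y - g x y)) (∑∑ N g))
    (cong (_- ∑∑ N g) (trans (sym (∑∑-+ N (λ x y → f x y - g x y) g))
      (∑∑-cong N (λ x y → solve 2 (λ p q → (p :- q) :+ q := p) refl (f x y) (g x y)))))

  parts-limit : (a b c N : ℕ) → ℚ
  parts-limit a b c N = conv (Z N) (D₁ b c N) (suc a) + conv (Z N) (D₂ a c N) (suc b)

  -- `V` is the intermediate stage, with coefficients truncated at M and double sums at N. Windows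
  -- are replaced by `Z M` for fixed N, over finitely many pairs; then `Z M` is replaced by `Z N`,
  -- where boundedness of `D₁` and `D₂` in N is needed.
  parts-null : ∀ a b {c} → 1 ℕ.≤ c →
    Null eventually² (λ { (N , M) → parts (suc a) (suc b) (suc c) N M - parts-limit a b c N })
  parts-null a b {c} 1≤c = null-cong eventually²
    (λ { (N , M) → solve 3 (λ p q r → (p :- q) :+ (q :- r) := p :- r) refl
           (parts (suc a) (suc b) (suc c) N M) (V N M) (parts-limit a b c N) })
    (null-+ eventually² (null-snd inner) outer)
    where
    g₁ g₂ : ℕ → ℕ → ℕ → ℚ
    g₁ x y = geo₁ (inv x) (inv (x ℕ.+ suc y)) (suc b) (suc c)
    g₂ x y = geo₂ (inv x) (inv (x ℕ.+ suc y)) a (suc c)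
    V : ℕ → ℕ → ℚ
    V N M = conv (Z M) (D₁ b c N) (suc a) + conv (Z M) (D₂ a c N) (suc b)
    V-∑∑ : ∀ N M → ∑∑ N (λ x y → conv (Z M) (g₁ x y) (suc a) + conv (Z M) (g₂ x y) (suc b)) ≡ V N M
    V-∑∑ N M = trans (∑∑-+ N (λ x y → conv (Z M) (g₁ x y) (suc a)) (λ x y → conv (Z M) (g₂ x y) (suc b)))
      (cong₂ _+_
        (trans (sym (conv-∑∑ʳ N (Z M) g₁ (suc a))) (conv-cong (suc a) {f = Z M} (λ _ → refl) (∑∑-geo₁ b c N)))
        (trans (sym (conv-∑∑ʳ N (Z M) g₂ (suc b))) (conv-cong (suc b) {f = Z M} (λ _ → refl) (∑∑-geo₂ a c N))))
    E₁ E₂ : ℕ → ℕ → ℕ → ℕ → ℚ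
    E₁ x y M = ΣE M (suc (suc x ℕ.+ suc y ℕ.+ M))
    E₂ x y M = ΣE (suc y ℕ.+ M) (suc (suc x ℕ.+ M))
    d : ℕ → ℕ → ℕ → ℚ
    d x y M = conv (λ i → E₁ x y M i - Z M i) (g₁ x y) (suc a) + conv (λ i → E₂ x y M i - Z M i) (g₂ x y) (suc b)
    inner : ∀ N → Null eventually (λ M → parts (suc a) (suc b) (suc c) N M - V N M)
    inner N = null-cong eventually
      (λ M → begin
        ∑∑ N (λ x y → d x y M)
          ≡⟨ ∑∑-cong N (λ x y → trans
               (cong₂ _+_ (conv-differenceˡ (E₁ x y M) (Z M) (g₁ x y) (suc a))
                          (conv-differenceˡ (E₂ x y M) (Z M) (g₂ x y) (suc b)))
               (trans (solve 4 (λ p q r s → (p :- q) :+ (r :- s) := (p :+ r) :- (q :+ s)) refl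
                        (conv (E₁ x y M) (g₁ x y) (suc a)) (conv (Z M) (g₁ x y) (suc a))
                        (conv (E₂ x y M) (g₂ x y) (suc b)) (conv (Z M) (g₂ x y) (suc b)))
                 (cong (_- (conv (Z M) (g₁ x y) (suc a) + conv (Z M) (g₂ x y) (suc b)))
                   (sym (W-part a b (suc c) x y M))))) ⟩
        ∑∑ N (λ x y → w x y M - v x y M)
          ≡⟨ ∑∑-difference N (λ x y → w x y M) (λ x y → v x y M) ⟩
        parts (suc a) (suc b) (suc c) N M - ∑∑ N (λ x y → v x y M)
          ≡⟨ cong (λ r → parts (suc a) (suc b) (suc c) N M - r) (V-∑∑ N M) ⟩
        parts (suc a) (suc b) (suc c) N M - V N M ∎)
      (null-∑∑ eventually N d (λ x y → null-+ eventually
        (null-conv eventually (λ M i → E₁ x y M i - Z M i) (λ _ → g₁ x y)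
          (ΣE-null 0 (suc x ℕ.+ suc y)) (λ i → bounded-const eventually (g₁ x y i)) (suc a))
        (null-conv eventually (λ M i → E₂ x y M i - Z M i) (λ _ → g₂ x y)
          (ΣE-null (suc y) (suc x)) (λ i → bounded-const eventually (g₂ x y i)) (suc b))))
      where
      open ≡-Reasoning
      w v : ℕ → ℕ → ℕ → ℚ
      w x y M = W M (suc (suc x ℕ.+ suc y ℕ.+ M)) (part (suc a) (suc b) (suc c) (+ suc x) (+ (suc x ℕ.+ suc y)))
      v x y M = conv (Z M) (g₁ x y) (suc a) + conv (Z M) (g₂ x y) (suc b)
    outer : Null eventually² (λ { (N , M) → V N M - parts-limit a b c N })
    outer = null-cong eventually²
      (λ { (N , M) → trans
        (cong₂ _+_ (conv-differenceˡ (Z M) (Z N) (D₁ b c N) (suc a)) (conv-differenceˡ (Z M) (Z N) (D₂ a c N) (suc b)))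
        (solve 4 (λ p q r s → (p :- q) :+ (r :- s) := (p :+ r) :- (q :+ s)) refl
          (conv (Z M) (D₁ b c N) (suc a)) (conv (Z N) (D₁ b c N) (suc a))
          (conv (Z M) (D₂ a c N) (suc b)) (conv (Z N) (D₂ a c N) (suc b))) })
      (null-+ eventually²
        (null-conv eventually² (λ { (N , M) i → Z M i - Z N i }) (λ { (N , _) → D₁ b c N }) Z-null (D₁-bounded b 1≤c) (suc a))
        (null-conv eventually² (λ { (N , M) i → Z M i - Z N i }) (λ { (N , _) → D₂ a c N }) Z-null (D₂-bounded a 1≤c) (suc b)))

  limits-null : ∀ {a b c} → 1 ℕ.≤ a → 1 ℕ.≤ c → Null eventually (λ N →
    (terms-limit (suc a) (suc b) (suc c) N + sgn (suc b) * terms-limit (suc c) (suc b) (suc a) N) -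
    (parts-limit a b c N + sgn (suc b) * parts-limit c b a N))
  -- The expression no longer involves M, so the estimate is read off at one admissible M, the
  -- threshold itself.
  limits-null {a} {b} {c} 1≤a 1≤c ε 0<ε = proj₁ null² , λ N N₀≤N → proj₂ (proj₂ null² N N₀≤N) _ ℕₚ.≤-refl
    where
    s = sgn (suc b)
    T T′ P P′ : ℕ → ℕ → ℚ
    T = terms (suc a) (suc b) (suc c)
    T′ = terms (suc c) (suc b) (suc a)
    P = parts (suc a) (suc b) (suc c)
    P′ = parts (suc c) (suc b) (suc a)
    t t′ p p′ : ℕ → ℚ
    t = terms-limit (suc a) (suc b) (suc c)
    t′ = terms-limit (suc c) (suc b) (suc a)
    p = parts-limit a b c
    p′ = parts-limit c b a
    regroup : ∀ s t t′ p p′ T T′ P P′ → T + s * T′ ≡ P + s * P′ →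
      ((P - p) + s * (P′ - p′)) + - ((T - t) + s * (T′ - t′)) ≡ (t + s * t′) - (p + s * p′)
    regroup s t t′ p p′ T T′ P P′ eq = begin
      ((P - p) + s * (P′ - p′)) + - ((T - t) + s * (T′ - t′))
        ≡⟨ solve 9 (λ s t t′ p p′ T T′ P P′ →
             ((P :- p) :+ s :* (P′ :- p′)) :+ :- ((T :- t) :+ s :* (T′ :- t′)) :=
             ((P :+ s :* P′) :- (T :+ s :* T′)) :+ ((t :+ s :* t′) :- (p :+ s :* p′))) refl s t t′ p p′ T T′ P P′ ⟩
      ((P + s * P′) - (T + s * T′)) + ((t + s * t′) - (p + s * p′))
        ≡⟨ cong (λ u → ((P + s * P′) - u) + ((t + s * t′) - (p + s * p′))) eq ⟩
      ((P + s * P′) - (P + s * P′)) + ((t + s * t′) - (p + s * p′))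
        ≡⟨ cong (_+ ((t + s * t′) - (p + s * p′))) (+-inverseʳ (P + s * P′)) ⟩
      0ℚ + ((t + s * t′) - (p + s * p′))
        ≡⟨ +-identityˡ ((t + s * t′) - (p + s * p′)) ⟩
      (t + s * t′) - (p + s * p′) ∎
      where open ≡-Reasoning
    null² = null-cong eventually²
      (λ { (N , M) → regroup s (t N) (t′ N) (p N) (p′ N) (T N M) (T′ N M) (P N M) (P′ N M) (∑∑-terms≡parts a b c N M) })
      (null-+ eventually²
        (null-+ eventually² (parts-null a b 1≤c) (null-*ˡ eventually² s (parts-null c b 1≤a)))
        (null-neg eventually² (null-+ eventually² (terms-null (s≤s 1≤a) (s≤s z≤n) (s≤s 1≤c))
          (null-*ˡ eventually² s (terms-null (s≤s 1≤c) (s≤s z≤n) (s≤s 1≤a)))))) ε 0<ε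

  -- Comparison with the real numbers of the theorem

  /1≡ι : ∀ i → i / 1 ≡ ι i
  /1≡ι (+ n)    = normalize-coprime (Coprimality.sym (1-coprimeTo n))
  /1≡ι -[1+ n ] = cong (-_) (normalize-coprime (Coprimality.sym (1-coprimeTo (suc n))))

  ι-* : ∀ i j → ι (i ℤ.* j) ≡ ι i * ι j
  ι-* i j = toℚᵘ-injective (ℚᵘₚ.≃-trans (ℚᵘ.*≡* refl) (ℚᵘₚ.≃-sym (toℚᵘ-homo-* (ι i) (ι j))))

  -1^≡sgn : ∀ n → (ℤ.-1ℤ ℤ.^ n) / 1 ≡ sgn n
  -1^≡sgn n = trans (/1≡ι (ℤ.-1ℤ ℤ.^ n)) (ι-sgn n)
    where
    ι-sgn : ∀ n → ι (ℤ.-1ℤ ℤ.^ n) ≡ sgn n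
    ι-sgn zero    = refl
    ι-sgn (suc n) = trans (ι-* ℤ.-1ℤ (ℤ.-1ℤ ℤ.^ n)) (cong (- 1ℚ *_) (ι-sgn n))

  bin≡C : ∀ m n → bin m n ≡ ι (+ ((m ℕ.+ n) C m))
  bin≡C zero    n       = cong (λ k → ι (+ k)) (sym (trans (nCk≡nC[n∸k] {n = n} z≤n) (nCn≡1 n)))
  bin≡C (suc m) zero    = cong (λ k → ι (+ k)) (sym (trans (cong (_C suc m) (ℕₚ.+-identityʳ (suc m))) (nCn≡1 (suc m))))
  bin≡C (suc m) (suc n) = begin
    bin m (suc n) + bin (suc m) n
      ≡⟨ cong₂ _+_ (bin≡C m (suc n)) (bin≡C (suc m) n) ⟩
    ι (+ ((m ℕ.+ suc n) C m)) + ι (+ (suc (m ℕ.+ n) C suc m))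
      ≡⟨ cong (λ k → ι (+ ((m ℕ.+ suc n) C m)) + ι (+ (k C suc m))) (sym (ℕₚ.+-suc m n)) ⟩
    ι (+ ((m ℕ.+ suc n) C m)) + ι (+ ((m ℕ.+ suc n) C suc m))
      ≡⟨ sym (ι-+ (+ ((m ℕ.+ suc n) C m)) (+ ((m ℕ.+ suc n) C suc m))) ⟩
    ι (+ ((m ℕ.+ suc n) C m ℕ.+ (m ℕ.+ suc n) C suc m))
      ≡⟨ cong (λ k → ι (+ k)) (nCk+nC[k+1]≡[n+1]C[k+1] (m ℕ.+ suc n) m) ⟩
    ι (+ (suc (m ℕ.+ suc n) C suc m)) ∎
    where open ≡-Reasoning

  bin-comm : ∀ m n → bin m n ≡ bin n m
  bin-comm zero    zero    = refl
  bin-comm zero    (suc n) = refl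
  bin-comm (suc m) zero    = refl
  bin-comm (suc m) (suc n) = trans (+-comm (bin m (suc n)) (bin (suc m) n))
    (cong₂ _+_ (bin-comm (suc m) n) (bin-comm m (suc n)))

  C≡bin : ∀ {k l} m n → k ≡ m ℕ.+ n → l ≡ m → + (k C l) / 1 ≡ bin m n
  C≡bin m n refl refl = trans (/1≡ι (+ ((m ℕ.+ n) C m))) (sym (bin≡C m n))

  seq-ζ₂ : ∀ {s t s′ t′} N → s ≡ s′ → t ≡ t′ → 1 ℕ.≤ s′ → 2 ℕ.≤ t′ → seq (ζ₂ s t) N ≡ nested (t′ ∷ s′ ∷ []) N
  seq-ζ₂ N refl refl (s≤s z≤n) (s≤s (s≤s z≤n)) = refl

  seq-ζ₃ : ∀ {r s t} N → 1 ℕ.≤ r → 1 ℕ.≤ s → 2 ℕ.≤ t → seq (ζ₃ r s t) N ≡ nested (t ∷ s ∷ r ∷ []) N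
  seq-ζ₃ N (s≤s z≤n) (s≤s z≤n) (s≤s (s≤s z≤n)) = refl

  seq-∑≤ : ∀ n f N → seq (∑≤ n f) N ≡ ∑ (suc n) (λ i → seq (f i) N)
  seq-∑≤ zero    f N = sym (+-identityˡ (seq (f 0) N))
  seq-∑≤ (suc n) f N = cong (_+ seq (f (suc n)) N) (seq-∑≤ n f N)

  -- Even indices and the double sums of the right-hand side

  2*suc : ∀ ξ → 2 ℕ.* suc ξ ≡ suc (suc (2 ℕ.* ξ))
  2*suc = ℕₚ.*-suc 2

  ∑-even : ∀ n F → (∀ ξ → F (suc (2 ℕ.* ξ)) ≡ 0ℚ) → ∑ (suc n) F ≡ ∑ (suc ⌊ n /2⌋) (λ ξ → F (2 ℕ.* ξ))
  ∑-even zero          F odd = refl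
  ∑-even (suc zero)    F odd = trans (cong (λ r → 0ℚ + F 0 + r) (odd 0)) (+-identityʳ (0ℚ + F 0))
  ∑-even (suc (suc n)) F odd = begin
    ∑ (suc (suc (suc n))) F
      ≡⟨ trans (∑-head (suc (suc n)) F) (cong (λ r → F 0 + r) (∑-head (suc n) (F ∘ suc))) ⟩
    F 0 + (F 1 + ∑ (suc n) (F ∘ suc ∘ suc))
      ≡⟨ cong (λ r → F 0 + r) (trans (cong (_+ ∑ (suc n) (F ∘ suc ∘ suc)) (odd 0)) (+-identityˡ (∑ (suc n) (F ∘ suc ∘ suc)))) ⟩
    F 0 + ∑ (suc n) (F ∘ suc ∘ suc)
      ≡⟨ cong (λ r → F 0 + r) (∑-even n (F ∘ suc ∘ suc) (λ ξ → trans (cong (F ∘ suc) (sym (2*suc ξ))) (odd (suc ξ)))) ⟩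
    F 0 + ∑ (suc ⌊ n /2⌋) (λ ξ → F (suc (suc (2 ℕ.* ξ))))
      ≡⟨ cong (λ r → F 0 + r) (∑-cong (suc ⌊ n /2⌋) (λ ξ → cong F (sym (2*suc ξ)))) ⟩
    F 0 + ∑ (suc ⌊ n /2⌋) (λ ξ → F (2 ℕ.* suc ξ))
      ≡⟨ sym (∑-head (suc ⌊ n /2⌋) (λ ξ → F (2 ℕ.* ξ))) ⟩
    ∑ (suc (suc ⌊ n /2⌋)) (λ ξ → F (2 ℕ.* ξ)) ∎
    where open ≡-Reasoning

  sgn-2* : ∀ ξ → sgn (2 ℕ.* ξ) ≡ 1ℚ
  sgn-2* zero    = refl
  sgn-2* (suc ξ) = trans (cong sgn (2*suc ξ))
    (trans (solve 1 (λ s → con (- 1ℚ) :* (con (- 1ℚ) :* s) := s) refl (sgn (2 ℕ.* ξ))) (sgn-2* ξ))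

  Z-odd : ∀ N ξ → Z N (suc (2 ℕ.* ξ)) ≡ 0ℚ
  Z-odd N ξ = trans (cong (λ s → (1ℚ + - 1ℚ * s) * nested (suc (2 ℕ.* ξ) ∷ []) N) (sgn-2* ξ))
                    (*-zeroˡ (nested (suc (2 ℕ.* ξ) ∷ []) N))

  2ℚ : ℚ
  2ℚ = + 2 / 1

  -- At ξ = 0 the value -1 is twice ζ(0) = -1/2; for ξ > 0 the factor 1 + (-1)²ᵘ with u = ξ is 2.
  Z-even : ∀ N ξ → Z N (2 ℕ.* ξ) ≡ 2ℚ * seq (ζ (2 ℕ.* ξ)) N
  Z-even N zero    = refl
  Z-even N (suc ξ) = subst (λ n → Z N n ≡ 2ℚ * seq (ζ n) N) (sym (2*suc ξ))
    (cong (λ s → (1ℚ + s) * nested (suc (suc (2 ℕ.* ξ)) ∷ []) N)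
      (trans (cong sgn (sym (2*suc ξ))) (sgn-2* (suc ξ))))

  2*ξ≤n : ∀ {ξ} n → ξ ℕ.< suc ⌊ n /2⌋ → 2 ℕ.* ξ ℕ.≤ n
  2*ξ≤n {ξ} n (s≤s ξ≤) = begin
    2 ℕ.* ξ                    ≤⟨ ℕₚ.*-monoʳ-≤ 2 ξ≤ ⟩
    2 ℕ.* ⌊ n /2⌋              ≡⟨ cong (⌊ n /2⌋ ℕ.+_) (ℕₚ.+-identityʳ ⌊ n /2⌋) ⟩
    ⌊ n /2⌋ ℕ.+ ⌊ n /2⌋        ≤⟨ ℕₚ.+-monoʳ-≤ ⌊ n /2⌋ (ℕₚ.⌊n/2⌋≤⌈n/2⌉ n) ⟩
    ⌊ n /2⌋ ℕ.+ ⌈ n /2⌉        ≡⟨ ℕₚ.⌊n/2⌋+⌈n/2⌉≡n n ⟩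
    n                          ∎
    where open ℕₚ.≤-Reasoning

  conv-Z : ∀ n (D : ℕ → ℚ) (x : ℕ → ℝ) N →
    (∀ ξ → 2 ℕ.* ξ ℕ.≤ n → seq (x ξ) N ≡ D (n ∸ 2 ℕ.* ξ)) →
    2ℚ * seq (∑≤ ⌊ n /2⌋ (λ ξ → ζ (2 ℕ.* ξ) *ℝ x ξ)) N ≡ conv (Z N) D n
  conv-Z n D x N x≡D = begin
    2ℚ * seq (∑≤ ⌊ n /2⌋ (λ ξ → ζ (2 ℕ.* ξ) *ℝ x ξ)) N
      ≡⟨ cong (2ℚ *_) (seq-∑≤ ⌊ n /2⌋ (λ ξ → ζ (2 ℕ.* ξ) *ℝ x ξ) N) ⟩
    2ℚ * ∑ (suc ⌊ n /2⌋) (λ ξ → seq (ζ (2 ℕ.* ξ)) N * seq (x ξ) N)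
      ≡⟨ sym (∑-*ˡ (suc ⌊ n /2⌋) 2ℚ (λ ξ → seq (ζ (2 ℕ.* ξ)) N * seq (x ξ) N)) ⟩
    ∑ (suc ⌊ n /2⌋) (λ ξ → 2ℚ * (seq (ζ (2 ℕ.* ξ)) N * seq (x ξ) N))
      ≡⟨ ∑-cong< (suc ⌊ n /2⌋) (λ ξ ξ< → trans (sym (*-assoc 2ℚ (seq (ζ (2 ℕ.* ξ)) N) (seq (x ξ) N)))
           (cong₂ _*_ (sym (Z-even N ξ)) (x≡D ξ (2*ξ≤n n ξ<)))) ⟩
    ∑ (suc ⌊ n /2⌋) (λ ξ → Z N (2 ℕ.* ξ) * D (n ∸ 2 ℕ.* ξ))
      ≡⟨ sym (∑-even n (λ i → Z N i * D (n ∸ i)) (λ ξ → trans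
           (cong (_* D (n ∸ suc (2 ℕ.* ξ))) (Z-odd N ξ)) (*-zeroˡ (D (n ∸ suc (2 ℕ.* ξ)))))) ⟩
    ∑ (suc n) (λ i → Z N i * D (n ∸ i))
      ≡⟨ sym (conv≡∑ (Z N) D n) ⟩
    conv (Z N) D n ∎
    where open ≡-Reasoning

  -- The common shape of the four double sums. Its instances `U₁` and `U₂` unfold to the expressions
  -- written in the theorem.
  doubleSum : ℕ → (ℕ → ℕ) → (p q s t : ℕ → ℕ → ℕ) → ℝ
  doubleSum n r p q s t = ∑[ ξ ≤ ⌊ n /2⌋ ] ζ (2 ℕ.* ξ) *ℝ
    (∑[ ω ≤ r ξ ] ⟦ p ξ ω ⟧ *ℝ ⟦ q ξ ω ⟧ *ℝ ζ₂ (s ξ ω) (t ξ ω))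

  seq-doubleSum : ∀ n (D : ℕ → ℚ) r p q s t N →
    (∀ ξ → 2 ℕ.* ξ ℕ.≤ n →
      ∑ (suc (r ξ)) (λ ω → + p ξ ω / 1 * (+ q ξ ω / 1) * seq (ζ₂ (s ξ ω) (t ξ ω)) N) ≡ D (n ∸ 2 ℕ.* ξ)) →
    2ℚ * seq (doubleSum n r p q s t) N ≡ conv (Z N) D n
  seq-doubleSum n D r p q s t N x≡D =
    conv-Z n D (λ ξ → ∑[ ω ≤ r ξ ] ⟦ p ξ ω ⟧ *ℝ ⟦ q ξ ω ⟧ *ℝ ζ₂ (s ξ ω) (t ξ ω)) N
      (λ ξ 2ξ≤n → trans (seq-∑≤ (r ξ) (λ ω → ⟦ p ξ ω ⟧ *ℝ ⟦ q ξ ω ⟧ *ℝ ζ₂ (s ξ ω) (t ξ ω)) N) (x≡D ξ 2ξ≤n))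

  ∸-∸-+ : ∀ a c {i j} → i ℕ.≤ a → j ℕ.≤ a ∸ i → a ℕ.+ c ∸ i ∸ j ≡ c ℕ.+ (a ∸ i ∸ j)
  ∸-∸-+ a c {i} {j} i≤a j≤a∸i = trans (cong (_∸ j) (ℕₚ.+-∸-comm c i≤a))
    (trans (ℕₚ.+-∸-comm c j≤a∸i) (ℕₚ.+-comm (a ∸ i ∸ j) c))

  -- The argument m stands for both a + c and c + a.
  U₁ U₂ : (a b c m : ℕ) → ℝ
  U₁ a b c m = doubleSum a (λ ξ → a ∸ 2 ℕ.* ξ)
    (λ ξ ω → (ω ℕ.+ b ∸ 1) C ω) (λ ξ ω → (m ∸ 2 ℕ.* ξ ∸ ω ∸ 1) C (c ∸ 1))
    (λ ξ ω → b ℕ.+ ω) (λ ξ ω → m ∸ 2 ℕ.* ξ ∸ ω)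
  U₂ a b c m = doubleSum b (λ ξ → a ∸ 1)
    (λ ξ ω → (ω ℕ.+ b ∸ 2 ℕ.* ξ) C ω) (λ ξ ω → (m ∸ ω ∸ 2) C (c ∸ 1))
    (λ ξ ω → b ∸ 2 ℕ.* ξ ℕ.+ ω ℕ.+ 1) (λ ξ ω → m ∸ 1 ∸ ω)

  seq-U₁ : ∀ a b {c m} N → 1 ℕ.≤ c → m ≡ a ℕ.+ suc c →
    2ℚ * seq (U₁ a (suc b) (suc c) m) N ≡ conv (Z N) (D₁ b c N) a
  seq-U₁ a b {c} N 1≤c refl = seq-doubleSum a (D₁ b c N) (λ ξ → a ∸ 2 ℕ.* ξ)
    (λ ξ ω → (ω ℕ.+ suc b ∸ 1) C ω) (λ ξ ω → (a ℕ.+ suc c ∸ 2 ℕ.* ξ ∸ ω ∸ 1) C (suc c ∸ 1))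
    (λ ξ ω → suc b ℕ.+ ω) (λ ξ ω → a ℕ.+ suc c ∸ 2 ℕ.* ξ ∸ ω) N
    (λ ξ 2ξ≤a → ∑-cong< (suc (a ∸ 2 ℕ.* ξ)) (λ { ω (s≤s ω≤) → summand ξ ω 2ξ≤a ω≤ }))
    where
    summand : ∀ ξ ω → 2 ℕ.* ξ ℕ.≤ a → ω ℕ.≤ a ∸ 2 ℕ.* ξ →
      + ((ω ℕ.+ suc b ∸ 1) C ω) / 1 * (+ ((a ℕ.+ suc c ∸ 2 ℕ.* ξ ∸ ω ∸ 1) C (suc c ∸ 1)) / 1) *
        seq (ζ₂ (suc b ℕ.+ ω) (a ℕ.+ suc c ∸ 2 ℕ.* ξ ∸ ω)) N ≡
      bin ω b * bin (a ∸ 2 ℕ.* ξ ∸ ω) c * nested (suc c ℕ.+ (a ∸ 2 ℕ.* ξ ∸ ω) ∷ suc b ℕ.+ ω ∷ []) N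
    summand ξ ω 2ξ≤a ω≤ = cong₂ _*_
      (cong₂ _*_ (C≡bin ω b (ℕₚ.+-∸-assoc ω {suc b} {1} (s≤s z≤n)) refl)
                 (trans (C≡bin c r (cong (_∸ 1) t≡) refl) (bin-comm c r)))
      (seq-ζ₂ N refl t≡ (s≤s z≤n) (s≤s (ℕₚ.m≤n⇒m≤n+o r 1≤c)))
      where
      r = a ∸ 2 ℕ.* ξ ∸ ω
      t≡ : a ℕ.+ suc c ∸ 2 ℕ.* ξ ∸ ω ≡ suc c ℕ.+ r
      t≡ = ∸-∸-+ a (suc c) 2ξ≤a ω≤

  seq-U₂ : ∀ a b {c m} N → 1 ℕ.≤ c → m ≡ suc a ℕ.+ suc c →
    2ℚ * seq (U₂ (suc a) b (suc c) m) N ≡ conv (Z N) (D₂ a c N) b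
  seq-U₂ a b {c} N 1≤c refl = seq-doubleSum b (D₂ a c N) (λ ξ → suc a ∸ 1)
    (λ ξ ω → (ω ℕ.+ b ∸ 2 ℕ.* ξ) C ω) (λ ξ ω → (suc a ℕ.+ suc c ∸ ω ∸ 2) C (suc c ∸ 1))
    (λ ξ ω → b ∸ 2 ℕ.* ξ ℕ.+ ω ℕ.+ 1) (λ ξ ω → suc a ℕ.+ suc c ∸ 1 ∸ ω) N
    (λ ξ 2ξ≤b → ∑-cong< (suc a) (λ { ω (s≤s ω≤a) → summand ξ ω 2ξ≤b ω≤a }))
    where
    summand : ∀ ξ ω → 2 ℕ.* ξ ℕ.≤ b → ω ℕ.≤ a →
      + ((ω ℕ.+ b ∸ 2 ℕ.* ξ) C ω) / 1 * (+ ((suc a ℕ.+ suc c ∸ ω ∸ 2) C (suc c ∸ 1)) / 1) *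
        seq (ζ₂ (b ∸ 2 ℕ.* ξ ℕ.+ ω ℕ.+ 1) (suc a ℕ.+ suc c ∸ 1 ∸ ω)) N ≡
      bin (b ∸ 2 ℕ.* ξ) ω * bin (a ∸ ω) c * nested (suc c ℕ.+ (a ∸ ω) ∷ suc ω ℕ.+ (b ∸ 2 ℕ.* ξ) ∷ []) N
    summand ξ ω 2ξ≤b ω≤a = cong₂ _*_
      (cong₂ _*_ (trans (C≡bin ω β (ℕₚ.+-∸-assoc ω 2ξ≤b) refl) (bin-comm ω β))
                 (trans (C≡bin c r k≡ refl) (bin-comm c r)))
      (seq-ζ₂ N (trans (ℕₚ.+-comm (β ℕ.+ ω) 1) (cong suc (ℕₚ.+-comm β ω))) t≡
        (s≤s z≤n) (s≤s (ℕₚ.m≤n⇒m≤n+o r 1≤c)))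
      where
      open ≡-Reasoning
      β = b ∸ 2 ℕ.* ξ
      r = a ∸ ω
      t≡ : a ℕ.+ suc c ∸ ω ≡ suc c ℕ.+ r
      t≡ = ∸-∸-+ a (suc c) {0} z≤n ω≤a
      k≡ : suc (a ℕ.+ suc c) ∸ ω ∸ 2 ≡ c ℕ.+ r
      k≡ = begin
        suc (a ℕ.+ suc c) ∸ ω ∸ 2       ≡⟨ ℕₚ.∸-+-assoc (suc (a ℕ.+ suc c)) ω 2 ⟩
        suc (a ℕ.+ suc c) ∸ (ω ℕ.+ 2)   ≡⟨ cong (suc (a ℕ.+ suc c) ∸_) (ℕₚ.+-suc ω 1) ⟩
        a ℕ.+ suc c ∸ (ω ℕ.+ 1)         ≡⟨ sym (ℕₚ.∸-+-assoc (a ℕ.+ suc c) ω 1) ⟩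
        a ℕ.+ suc c ∸ ω ∸ 1             ≡⟨ cong (_∸ 1) t≡ ⟩
        c ℕ.+ r                         ∎

  -- The two stuffle products share t₂, t₃ and d₂, which explains their factor 1 + β. The terms t₁
  -- and t₄ occur once in a stuffle product and once with the sign from negative k.
  rearrange : ∀ α β γ t₁ t₂ t₃ t₄ d₁ d₂ d₃ u₁ u₂ u₃ u₄ {σ T T′ P P′} →
    σ ≡ β →
    T ≡ α * t₁ + (t₁ + t₂ + t₃ + d₁ + d₂) → T′ ≡ γ * t₄ + (t₄ + t₃ + t₂ + d₃ + d₂) →
    P ≡ 2ℚ * u₁ + 2ℚ * u₂ → P′ ≡ 2ℚ * u₃ + 2ℚ * u₄ →
    (T + σ * T′) - (P + σ * P′) ≡
    ((1ℚ + α) * t₁ + (1ℚ + β) * (t₂ + t₃) + β * (1ℚ + γ) * t₄) -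
    (2ℚ * (u₁ + u₂ + β * u₃ + β * u₄) - d₁ - (1ℚ + β) * d₂ - β * d₃)
  rearrange α β γ t₁ t₂ t₃ t₄ d₁ d₂ d₃ u₁ u₂ u₃ u₄ refl refl refl refl refl =
    solve 14 (λ α β γ t₁ t₂ t₃ t₄ d₁ d₂ d₃ u₁ u₂ u₃ u₄ →
      ((α :* t₁ :+ (t₁ :+ t₂ :+ t₃ :+ d₁ :+ d₂)) :+ β :* (γ :* t₄ :+ (t₄ :+ t₃ :+ t₂ :+ d₃ :+ d₂))) :-
      ((con 2ℚ :* u₁ :+ con 2ℚ :* u₂) :+ β :* (con 2ℚ :* u₃ :+ con 2ℚ :* u₄)) :=
      ((con 1ℚ :+ α) :* t₁ :+ (con 1ℚ :+ β) :* (t₂ :+ t₃) :+ β :* (con 1ℚ :+ γ) :* t₄) :-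
      (con 2ℚ :* (u₁ :+ u₂ :+ β :* u₃ :+ β :* u₄) :- d₁ :- (con 1ℚ :+ β) :* d₂ :- β :* d₃)) refl
      α β γ t₁ t₂ t₃ t₄ d₁ d₂ d₃ u₁ u₂ u₃ u₄

  -- `p` and `q` are left free so that the copy with a and c exchanged can keep the theorem's order
  -- of addition in its arguments.
  terms-limit-ζ : ∀ a b c {p q} N → 2 ℕ.≤ a → 1 ℕ.≤ b → 2 ℕ.≤ c → p ≡ a ℕ.+ b → q ≡ a ℕ.+ c →
    terms-limit a b c N ≡ seq ([-1]^ a) N * seq (ζ₃ a b c) N +
    (seq (ζ₃ a b c) N + seq (ζ₃ b a c) N + seq (ζ₃ b c a) N + seq (ζ₂ p c) N + seq (ζ₂ b q) N)
  terms-limit-ζ a b c N 2≤a 1≤b 2≤c p≡ q≡ = cong₂ _+_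
    (sym (cong₂ _*_ (-1^≡sgn a) (seq-ζ₃ N 1≤a 1≤b 2≤c)))
    (trans (stuffle₃ a b c N) (sym (cong₂ _+_
      (cong₂ _+_ (cong₂ _+_ (cong₂ _+_ (seq-ζ₃ N 1≤a 1≤b 2≤c) (seq-ζ₃ N 1≤b 1≤a 2≤c)) (seq-ζ₃ N 1≤b (ℕₚ.<⇒≤ 2≤c) 2≤a))
        (seq-ζ₂ N p≡ refl (ℕₚ.m≤n⇒m≤n+o b 1≤a) 2≤c))
      (seq-ζ₂ N refl q≡ 1≤b (ℕₚ.m≤n⇒m≤o+n a 2≤c)))))
    where
    1≤a = ℕₚ.<⇒≤ 2≤a

  parts-limit-ζ : ∀ a b {c m} N → 1 ℕ.≤ c → m ≡ suc a ℕ.+ suc c →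
    parts-limit a b c N ≡ 2ℚ * seq (U₁ (suc a) (suc b) (suc c) m) N + 2ℚ * seq (U₂ (suc a) (suc b) (suc c) m) N
  parts-limit-ζ a b {c} {m} N 1≤c m≡ = sym (cong₂ _+_
    {2ℚ * seq (U₁ (suc a) (suc b) (suc c) m) N} {conv (Z N) (D₁ b c N) (suc a)}
    {2ℚ * seq (U₂ (suc a) (suc b) (suc c) m) N} {conv (Z N) (D₂ a c N) (suc b)}
    (seq-U₁ (suc a) b {c} {m} N 1≤c m≡) (seq-U₂ a (suc b) {c} {m} N 1≤c m≡))

  -- Stuffle relations and even-index sums are exact at each truncation N, so the difference of the
  -- theorem's two sides equals the null expression term by term.
  limits≡ : ∀ a b c N → 1 ℕ.≤ a → 1 ℕ.≤ c →
    (terms-limit (suc a) (suc b) (suc c) N + sgn (suc b) * terms-limit (suc c) (suc b) (suc a) N) -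
    (parts-limit a b c N + sgn (suc b) * parts-limit c b a N) ≡
    ((1ℚ + seq ([-1]^ suc a) N) * seq (ζ₃ (suc a) (suc b) (suc c)) N
      + (1ℚ + seq ([-1]^ suc b) N) * (seq (ζ₃ (suc b) (suc a) (suc c)) N + seq (ζ₃ (suc b) (suc c) (suc a)) N)
      + seq ([-1]^ suc b) N * (1ℚ + seq ([-1]^ suc c) N) * seq (ζ₃ (suc c) (suc b) (suc a)) N) -
    (2ℚ * (seq (U₁ (suc a) (suc b) (suc c) (suc a ℕ.+ suc c)) N
        + seq (U₂ (suc a) (suc b) (suc c) (suc a ℕ.+ suc c)) N
        + seq ([-1]^ suc b) N * seq (U₁ (suc c) (suc b) (suc a) (suc a ℕ.+ suc c)) N
        + seq ([-1]^ suc b) N * seq (U₂ (suc c) (suc b) (suc a) (suc a ℕ.+ suc c)) N)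
      - seq (ζ₂ (suc a ℕ.+ suc b) (suc c)) N
      - (1ℚ + seq ([-1]^ suc b) N) * seq (ζ₂ (suc b) (suc a ℕ.+ suc c)) N
      - seq ([-1]^ suc b) N * seq (ζ₂ (suc b ℕ.+ suc c) (suc a)) N)
  limits≡ a b c N 1≤a 1≤c = rearrange
    (seq ([-1]^ suc a) N) (seq ([-1]^ suc b) N) (seq ([-1]^ suc c) N)
    (seq (ζ₃ (suc a) (suc b) (suc c)) N) (seq (ζ₃ (suc b) (suc a) (suc c)) N)
    (seq (ζ₃ (suc b) (suc c) (suc a)) N) (seq (ζ₃ (suc c) (suc b) (suc a)) N)
    (seq (ζ₂ (suc a ℕ.+ suc b) (suc c)) N) (seq (ζ₂ (suc b) (suc a ℕ.+ suc c)) N) (seq (ζ₂ (suc b ℕ.+ suc c) (suc a)) N)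
    (seq (U₁ (suc a) (suc b) (suc c) (suc a ℕ.+ suc c)) N) (seq (U₂ (suc a) (suc b) (suc c) (suc a ℕ.+ suc c)) N)
    (seq (U₁ (suc c) (suc b) (suc a) (suc a ℕ.+ suc c)) N) (seq (U₂ (suc c) (suc b) (suc a) (suc a ℕ.+ suc c)) N)
    {sgn (suc b)} {terms-limit (suc a) (suc b) (suc c) N} {terms-limit (suc c) (suc b) (suc a) N}
    {parts-limit a b c N} {parts-limit c b a N}
    (sym (-1^≡sgn (suc b)))
    (terms-limit-ζ (suc a) (suc b) (suc c) {suc a ℕ.+ suc b} {suc a ℕ.+ suc c} N
      (s≤s 1≤a) (s≤s z≤n) (s≤s 1≤c) refl refl)
    (terms-limit-ζ (suc c) (suc b) (suc a) {suc b ℕ.+ suc c} {suc a ℕ.+ suc c} N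
      (s≤s 1≤c) (s≤s z≤n) (s≤s 1≤a) (ℕₚ.+-comm (suc b) (suc c)) (ℕₚ.+-comm (suc a) (suc c)))
    (parts-limit-ζ a b {c} {suc a ℕ.+ suc c} N 1≤c refl)
    (parts-limit-ζ c b {a} {suc a ℕ.+ suc c} N 1≤a (ℕₚ.+-comm (suc a) (suc c)))

open import Data.Nat using (ℕ; _+_; _∸_; _*_; _≤_; ⌊_/2⌋)
open import Data.Nat.Combinatorics using (_C_)
open import Defs using (_≈_; _+ℝ_; _-ℝ_; _*ℝ_; ∑≤; [-1]^_; ⟦_⟧; ζ; ζ₂; ζ₃)
open import Data.Nat using (suc; s≤s)
open Proof using (null-cong; eventually; limits≡; limits-null)

theorem5p2 :
  ∀ (a b c : ℕ) → 2 ≤ a → 2 ≤ b → 2 ≤ c →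
    (⟦ 1 ⟧ +ℝ [-1]^ a) *ℝ ζ₃ a b c
      +ℝ (⟦ 1 ⟧ +ℝ [-1]^ b) *ℝ (ζ₃ b a c +ℝ ζ₃ b c a)
      +ℝ [-1]^ b *ℝ (⟦ 1 ⟧ +ℝ [-1]^ c) *ℝ ζ₃ c b a
    ≈
    ⟦ 2 ⟧ *ℝ
      ( (∑[ ξ ≤ ⌊ a /2⌋ ] ζ (2 * ξ) *ℝ
          (∑[ ω ≤ a ∸ 2 * ξ ]
            ⟦ (ω + b ∸ 1) C ω ⟧ *ℝ ⟦ (a + c ∸ 2 * ξ ∸ ω ∸ 1) C (c ∸ 1) ⟧
              *ℝ ζ₂ (b + ω) (a + c ∸ 2 * ξ ∸ ω)))
      +ℝ
        (∑[ ξ ≤ ⌊ b /2⌋ ] ζ (2 * ξ) *ℝ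
          (∑[ ω ≤ a ∸ 1 ]
            ⟦ (ω + b ∸ 2 * ξ) C ω ⟧ *ℝ ⟦ (a + c ∸ ω ∸ 2) C (c ∸ 1) ⟧
              *ℝ ζ₂ (b ∸ 2 * ξ + ω + 1) (a + c ∸ 1 ∸ ω)))
      +ℝ [-1]^ b *ℝ
        (∑[ ξ ≤ ⌊ c /2⌋ ] ζ (2 * ξ) *ℝ
          (∑[ ω ≤ c ∸ 2 * ξ ]
            ⟦ (ω + b ∸ 1) C ω ⟧ *ℝ ⟦ (a + c ∸ 2 * ξ ∸ ω ∸ 1) C (a ∸ 1) ⟧
              *ℝ ζ₂ (b + ω) (a + c ∸ 2 * ξ ∸ ω)))
      +ℝ [-1]^ b *ℝ
        (∑[ ξ ≤ ⌊ b /2⌋ ] ζ (2 * ξ) *ℝ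
          (∑[ ω ≤ c ∸ 1 ]
            ⟦ (ω + b ∸ 2 * ξ) C ω ⟧ *ℝ ⟦ (a + c ∸ ω ∸ 2) C (a ∸ 1) ⟧
              *ℝ ζ₂ (b ∸ 2 * ξ + ω + 1) (a + c ∸ 1 ∸ ω)))
      )
    -ℝ ζ₂ (a + b) c
    -ℝ (⟦ 1 ⟧ +ℝ [-1]^ b) *ℝ ζ₂ b (a + c)
    -ℝ [-1]^ b *ℝ ζ₂ (b + c) a
-- By definition `≈` says that the difference of the two sequences is null.
theorem5p2 (suc a) (suc b) (suc c) (s≤s 1≤a) _ (s≤s 1≤c) =
  null-cong eventually (λ N → limits≡ a b c N 1≤a 1≤c) (limits-null 1≤a 1≤c)
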